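{- Let $\epsilon<1/3$ be a positive constant and let $d\ge 2$ be a power of two with $d=O(\log^{\epsilon}n)$. There is a parallel algorithm which, given a sequence $S$ of length $n$ over the alphabet $\Sigma=\{0,\ldots,\sigma-1\}$ with $\sigma\le n$, constructs the $d$-ary (multiary) wavelet tree of $S$ using $O(n\log_d\sigma)$ work and $O(\log n\log_d\sigma)$ depth.
   Context: Model: work-depth model with concurrent reads and writes permitted, with unit-cost operations on machine words of $\Theta(\log n)$ bits. The work is the total number of operations and the depth is the number of parallel time steps. $\log$ is base 2, and, as usual in asymptotic bounds, logarithmic factors (including $\log_d\sigma$) are read as being at least $1$. In the multiary wavelet tree each node has up to $d$ children and stores a sequence of symbols in the range $[0,\ldots,d-1]$, and the height is $O(\log_d\sigma)$. Explicitly: write each symbol with $\lceil\log_d\sigma\rceil$ base-$d$ digits (i.e. blocks of $\log d$ bits), most significant first. The nodes on level $l$ ($l=0$ being the root, $0\le l<\lceil\log_d\sigma\rceil$) correspond to the length-$l$ digit prefixes occurring among the symbols of $S$; the node $v$ for prefix $p$ stores the sequence of $(l+1)$'st digits of the subsequence (in the original order) of the symbols of $S$ with prefix $p$, as a sequence of $\log d$-bit entries. The children of $v$ are the nodes for the prefixes $p$ extended by one digit. Each node also stores a generalized rank/select structure on its sequence $T$, supporting in $O(1)$ work the queries $\mathrm{rank}_c(T,i)$ (the number of symbols less than or equal to $c$ in positions $0$ to $i$ of $T$) and $\mathrm{select}_c(T,i)$ (the position of the $i$'th occurrence of $c$ in $T$). -}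

module Defs where

open import Data.Bool using (Bool; true; false; _∧_; _∨_; _xor_; if_then_else_)
open import Data.Fin using (Fin; toℕ) renaming (_≟_ to _≟ᶠ_)
open import Data.Integer using (∣_∣)
open import Data.List using (List; []; _∷_; _++_; _∷ʳ_; length; map; filter; take; lookup; upTo)
open import Data.List.Membership.Propositional using (_∈_; _∉_)
open import Data.List.Relation.Unary.Any using (here; there)
open import Data.List.Properties using (≡-dec)
open import Data.Nat
open import Data.Nat.DivMod using (_mod_)
open import Data.Nat.Logarithm using (⌈log₂_⌉)
open import Data.Nat.Properties using (m^n≢0)
open import Data.Product using (∃; _×_; _,_; proj₁; proj₂)
open import Data.Rational using (ℚ; ↥_; ↧ₙ_)
open import Data.Sum using (_⊎_; inj₁; inj₂)
open import Data.Vec using (Vec; toList) renaming (lookup to lookupᵛ)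
open import Relation.Binary.PropositionalEquality using (_≡_; refl)
open import Relation.Nullary using (¬_; yes; no)

------------------------------------------------------------------------
-- Logarithms

-- Logarithmic factors are read as being at least 1.  Rounding up then
-- changes them by a factor of at most 2, which the O-constants absorb.

log₂ : ℕ → ℕ
log₂ n = 1 ⊔ ⌈log₂ n ⌉

-- For d ≥ 2 the exponents e with d ^ e < m form an initial segment of ℕ
-- contained in {0, …, m - 1}; their number is the least e with m ≤ d ^ e.

⌈log[_]_⌉ : ℕ → ℕ → ℕ
⌈log[ d ] m ⌉ = length (filter (λ e → d ^ e <? m) (upTo m))

log[_]_ : ℕ → ℕ → ℕ
log[ d ] m = 1 ⊔ ⌈log[ d ] m ⌉

-- With ε = p / q in lowest terms (ε > 0), this is  d ^ q ≤ K · (log n) ^ p,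
-- i.e.  d ≤ K ^ (1/q) · (log n) ^ ε.

_≤[_]·log^[_]_ : ℕ → ℕ → ℚ → ℕ → Set
d ≤[ K ]·log^[ ε ] n = d ^ (↧ₙ ε) ≤ K * log₂ n ^ ∣ ↥ ε ∣

------------------------------------------------------------------------
-- Programs: registers are private to a thread, M is the shared memory

Reg : Set
Reg = ℕ

data Op : Set where
  ADD SUB MUL DIV REM AND OR XOR SHL SHR EQ LT : Op

infixr 5 _⨾_

data Cmd : Set where
  skip   : Cmd
  lit    : Reg → ℕ → Cmd                 -- lit r a:     r := a
  op     : Reg → Op → Reg → Reg → Cmd    -- op r ∘ s t:  r := s ∘ t
  load   : Reg → Reg → Cmd               -- load r a:    r := M[ a ]
  store  : Reg → Reg → Cmd               -- store a r:   M[ a ] := r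
  _⨾_    : Cmd → Cmd → Cmd
  ifnz   : Reg → Cmd → Cmd → Cmd
  while  : Reg → Cmd → Cmd
  -- pardo i r c: for all j < r in parallel run c on a copy of the current
  -- registers with i := j.  The issuing thread goes on, with its own
  -- registers, once all of these threads have finished.
  pardo  : Reg → Reg → Cmd → Cmd

------------------------------------------------------------------------
-- Unit-cost operations

bit : ℕ → ℕ → ℕ
bit b x = _/_ x (2 ^ b) {{m^n≢0 2 b}} % 2

bitwise : (Bool → Bool → Bool) → ℕ → ℕ → ℕ → ℕ
bitwise f zero    x y = 0
bitwise f (suc w) x y =
  (if f (x % 2 ≡ᵇ 1) (y % 2 ≡ᵇ 1) then 1 else 0) + 2 * bitwise f w (x / 2) (y / 2)

-- The result on w-bit operands, still to be reduced modulo 2 ^ w.  Division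
-- by zero yields zero.

evalℕ : ℕ → Op → ℕ → ℕ → ℕ
evalℕ w ADD x y       = x + y
evalℕ w SUB x y       = x + (2 ^ w ∸ y)
evalℕ w MUL x y       = x * y
evalℕ w DIV x zero    = 0
evalℕ w DIV x (suc y) = x / suc y
evalℕ w REM x zero    = 0
evalℕ w REM x (suc y) = x % suc y
evalℕ w AND x y       = bitwise _∧_ w x y
evalℕ w OR  x y       = bitwise _∨_ w x y
evalℕ w XOR x y       = bitwise _xor_ w x y
evalℕ w SHL x y       = x * 2 ^ y
evalℕ w SHR x y       = _/_ x (2 ^ y) {{m^n≢0 2 y}}
evalℕ w EQ  x y       = if x ≡ᵇ y then 1 else 0
evalℕ w LT  x y       = if x <ᵇ y then 1 else 0

------------------------------------------------------------------------
-- Work-depth machine with w-bit words: synchronous threads with concurrent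
-- reads and (arbitrary) concurrent writes

module Machine (w : ℕ) where

  Word : Set
  Word = Fin (2 ^ w)

  trunc : ℕ → Word
  trunc x = _mod_ x (2 ^ w) {{m^n≢0 2 w}}

  infixl 6 _⊞_

  _⊞_ : Word → ℕ → Word
  a ⊞ j = trunc (toℕ a + j)

  eval : Op → Word → Word → Word
  eval o x y = trunc (evalℕ w o (toℕ x) (toℕ y))

  Regs Mem : Set
  Regs = Reg → Word
  Mem  = Word → Word

  _[_≔_] : Regs → Reg → Word → Regs
  (ρ [ r ≔ x ]) s = if r ≡ᵇ s then x else ρ s

  data Thread : Set where
    run  : Regs → List Cmd → Thread
    join : List Thread → Regs → List Cmd → Thread

  Writes : Set
  Writes = List (Word × Word)

  finished : Thread → Bool
  finished (run _ [])      = true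
  finished (run _ (_ ∷ _)) = false
  finished (join _ _ _)    = false

  allFinished : List Thread → Bool
  allFinished []       = true
  allFinished (t ∷ ts) = finished t ∧ allFinished ts

  await : List Thread → Regs → List Cmd → Thread
  await ts ρ k = if allFinished ts then run ρ k else join ts ρ k

  -- One operation of one thread.  Sequencing itself is free; every other
  -- command, including the test of a branch or loop and the spawning of
  -- threads, is one operation.

  exec : Mem → Cmd → Regs → List Cmd → Thread × Writes
  exec m skip         ρ k = run ρ k , []
  exec m (lit r a)    ρ k = run (ρ [ r ≔ trunc a ]) k , []
  exec m (op r o s t) ρ k = run (ρ [ r ≔ eval o (ρ s) (ρ t) ]) k , []
  exec m (load r a)   ρ k = run (ρ [ r ≔ m (ρ a) ]) k , []
  exec m (store a r)  ρ k = run ρ k , (ρ a , ρ r) ∷ []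
  exec m (c ⨾ c′)     ρ k = exec m c ρ (c′ ∷ k)
  exec m (ifnz r c c′) ρ k with toℕ (ρ r)
  ... | zero  = run ρ (c′ ∷ k) , []
  ... | suc _ = run ρ (c ∷ k) , []
  exec m (while r c) ρ k with toℕ (ρ r)
  ... | zero  = run ρ k , []
  ... | suc _ = run ρ (c ∷ while r c ∷ k) , []
  exec m (pardo i r c) ρ k =
    await (map (λ j → run (ρ [ i ≔ trunc j ]) (c ∷ [])) (upTo (toℕ (ρ r)))) ρ k , []

  -- One time step: every running thread performs one operation, reading the
  -- memory as it was before the step.  The last component is the number of
  -- operations performed.

  mutual
    step : Mem → Thread → Thread × Writes × ℕ
    step m (run ρ [])      = run ρ [] , [] , 0
    step m (run ρ (c ∷ k)) = let t , ws = exec m c ρ k in t , ws , 1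
    step m (join ts ρ k)   = let ts′ , ws , a = steps m ts in await ts′ ρ k , ws , a

    steps : Mem → List Thread → List Thread × Writes × ℕ
    steps m []       = [] , [] , 0
    steps m (t ∷ ts) =
      let t′  , ws  , a  = step m t
          ts′ , ws′ , a′ = steps m ts
      in t′ ∷ ts′ , ws ++ ws′ , a + a′

  -- An arbitrary one of the values written concurrently to a cell survives.

  Commits : Mem → Writes → Mem → Set
  Commits m ws m′ = ∀ a →
    (a , m′ a) ∈ ws ⊎ (a ∉ map proj₁ ws × m′ a ≡ m a)

  -- There always is an outcome, so quantifying over all m′ with Commits m ws m′
  -- is not vacuous.

  commit : ∀ m ws → ∃ (Commits m ws)
  commit m []             = m , λ a → inj₂ ((λ ()) , refl)
  commit m ((b , x) ∷ ws) = m₂ , ok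
    where
    m₁ = proj₁ (commit m ws)

    m₂ : Mem
    m₂ a with a ≟ᶠ b
    ... | yes _ = x
    ... | no  _ = m₁ a

    ok : Commits m ((b , x) ∷ ws) m₂
    ok a with a ≟ᶠ b
    ... | yes refl = inj₁ (here refl)
    ... | no a≢b with proj₂ (commit m ws) a
    ...   | inj₁ w∈        = inj₁ (there w∈)
    ...   | inj₂ (a∉ , eq) = inj₂ ((λ { (here e) → a≢b e ; (there i) → a∉ i }) , eq)

  -- Terminates Q m t W D: however write conflicts are resolved, t started in
  -- memory m finishes within work W and depth D, and then Q holds of its
  -- registers and the memory.

  data Terminates (Q : Regs → Mem → Set) (m : Mem) : Thread → (W D : ℕ) → Set where
    stop : ∀ {ρ W D} → Q ρ m → Terminates Q m (run ρ []) W D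
    go   : ∀ {t t′ ws a W D} → step m t ≡ (t′ , ws , a) →
           (∀ m′ → Commits m ws m′ → Terminates Q m′ t′ W D) →
           Terminates Q m t (a + W) (suc D)

  -- The arguments are passed in registers 0, 1, 2; all others start as 0.

  args : (x y z : ℕ) → Regs
  args x y z 0 = trunc x
  args x y z 1 = trunc y
  args x y z 2 = trunc z
  args x y z _ = trunc 0

  start : Cmd → (x y z : ℕ) → Thread
  start c x y z = run (args x y z) (c ∷ [])

  -- T as a contiguous stream of k-bit entries starting at address a: bit
  -- j * k + b of the stream, the b'th bit of entry j, is bit r of word q.

  Packed : Mem → Word → ℕ → List ℕ → Set
  Packed m a k T =
    ∀ (j : Fin (length T)) b q r → b < k → r < w → q * w + r ≡ toℕ j * k + b →
    bit r (toℕ (m (a ⊞ q))) ≡ bit b (lookup T j)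

  -- A query must leave the memory unchanged.

  Answers : Mem → Cmd → (x y z C answer : ℕ) → Set
  Answers m c x y z C answer =
    Terminates (λ ρ m′ → toℕ (ρ 0) ≡ answer × (∀ a → m′ a ≡ m a))
      m (start c x y z) C C

------------------------------------------------------------------------
-- Rank and select

count≤ count≡ : ℕ → List ℕ → ℕ
count≤ c T = length (filter (_≤? c) T)
count≡ c T = length (filter (_≟ c) T)

rank : ℕ → List ℕ → ℕ → ℕ
rank c T i = count≤ c (take (suc i) T)

-- The i'th occurrence of c, counting from i = 1, is at position j.

IsSelect : ℕ → (T : List ℕ) → ℕ → Fin (length T) → Set
IsSelect c T i j = lookup T j ≡ c × count≡ c (take (suc (toℕ j)) T) ≡ i

------------------------------------------------------------------------
-- The d-ary wavelet tree; a node is named by its digit prefix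

module WaveletTree (d : ℕ) .{{_ : NonZero d}} {n σ : ℕ} (S : Vec (Fin σ) n) where

  height : ℕ
  height = ⌈log[ d ] σ ⌉

  symbols : List ℕ
  symbols = map toℕ (toList S)

  -- j'th digit of s in base d, most significant first, j = 0, …, height - 1
  digit : ℕ → ℕ → ℕ
  digit s j = _/_ s (d ^ (height ∸ suc j)) {{m^n≢0 d (height ∸ suc j)}} % d

  prefix : ℕ → ℕ → List ℕ
  prefix l s = map (digit s) (upTo l)

  Node : List ℕ → Set
  Node p = length p < height × p ∈ map (prefix (length p)) symbols

  content : List ℕ → List ℕ
  content p =
    map (λ s → digit s (length p))
        (filter (λ s → ≡-dec _≟_ (prefix (length p) s) p) symbols)

------------------------------------------------------------------------
-- Wavelet trees in memory

-- The machine has words of  wordFactor · log n  bits.  The queries take the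
-- address of a node, a symbol and an index, and return their answer in
-- register 0.

record Algorithm : Set where
  field
    wordFactor          : ℕ
    wordFactor>0        : 0 < wordFactor
    build rankQ selectQ : Cmd

  wordSize : ℕ → ℕ
  wordSize n = wordFactor * log₂ n

module _ (A : Algorithm) (C k : ℕ) {n σ : ℕ} (S : Vec (Fin σ) n) where

  private
    instance
      2^k≢0 : NonZero (2 ^ k)
      2^k≢0 = m^n≢0 2 k

  open Algorithm A
  open Machine (wordSize n)
  open WaveletTree (2 ^ k) S

  -- The node p at address v.  Word v holds the length of the sequence and
  -- word v + 1 the address of the sequence.  Unless p is on the last level,
  -- word v + 2 holds the address of a table with, for each digit c, the
  -- address of the child for p extended by c, or 0 if there is none.

  record StoredNode (m : Mem) (addr : List ℕ → Word) (p : List ℕ) : Set where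
    private
      v = addr p
      T = content p
    field
      size     : toℕ (m v) ≡ length T
      entries  : Packed m (m (v ⊞ 1)) k T
      child    : suc (length p) < height → ∀ c → c < 2 ^ k → Node (p ∷ʳ c) →
                 m (m (v ⊞ 2) ⊞ c) ≡ addr (p ∷ʳ c)
      no-child : suc (length p) < height → ∀ c → c < 2 ^ k → ¬ Node (p ∷ʳ c) →
                 toℕ (m (m (v ⊞ 2) ⊞ c)) ≡ 0
      ranks    : ∀ c i → c < 2 ^ k → i < length T →
                 Answers m rankQ (toℕ v) c i C (rank c T i)
      selects  : ∀ c i j → c < 2 ^ k → IsSelect c T i j →
                 Answers m selectQ (toℕ v) c i C (toℕ j)

  record StoredTree (root : Word) (m : Mem) : Set where
    field
      addr     : List ℕ → Word
      isRoot   : Node [] → addr [] ≡ root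
      non-null : ∀ p → Node p → 0 < toℕ (addr p)
      distinct : ∀ p q → Node p → Node q → addr p ≡ addr q → p ≡ q
      nodes    : ∀ p → Node p → StoredNode m addr p

  -- Initially S occupies the cells 0, …, n - 1; nothing is assumed about
  -- the rest of the memory.

  Input : Mem → Set
  Input m = ∀ (i : Fin n) → m (trunc (toℕ i)) ≡ trunc (toℕ (lookupᵛ S i))

  Constructs : (W D : ℕ) → Set
  Constructs W D = ∀ m → Input m →
    Terminates (λ ρ → StoredTree (ρ 0)) m (start build n σ (2 ^ k)) W D

{-# OPTIONS --safe #-}
module Submission where

-- Level l + 1 holds the symbols of level l stably sorted by their (l + 1)'st
-- digit alone.  Hence every node stays an interval [lo, hi) of its level, and
-- its child for digit c is [N c lo, N c hi), where N c x counts the entries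
-- with a digit below c and the entries equal to c before x.  These counts are
-- sums of one count inside a block of d entries, one inside a chunk of d log n
-- entries, and one from a parallel prefix scan over the chunks.  Inside a block
-- the d counters of d bits each share one word, as d² = O(log n); so a level
-- costs O(n) work and O(log n) depth.  The same counts answer rank, and
-- with the inverse of the sorting permutation also select, in every node.
--
-- All threads of a parallel step read below a frontier and write at or above
-- it, with values that depend only on the address; so the schedule and the
-- resolution of concurrent writes do not matter.

open import Defs
open import Data.Bool using (Bool; true; false; T; if_then_else_)
open import Data.Empty using (⊥; ⊥-elim)
open import Data.Fin using (Fin; toℕ; fromℕ<) renaming (zero to fzero; suc to fsuc)
open import Data.Fin.Properties using (toℕ-fromℕ<; toℕ-injective; toℕ<n)
import Data.Integer as ℤ
import Data.Integer.Properties as ℤ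
open import Data.List using (List; []; _∷_; _++_; _∷ʳ_; map; upTo; applyUpTo; filter; length; take; foldl; lookup)
open import Data.List.Membership.Propositional using (_∈_)
open import Data.List.Membership.Propositional.Properties
  using (∈-++⁺ˡ; ∈-++⁺ʳ; ∈-++⁻; ∈-map⁺; ∈-map⁻; ∈-applyUpTo⁺; ∈-applyUpTo⁻; ∈-filter⁺; ∈-filter⁻)
open import Data.List.Properties
  using (≡-dec; map-++; map-applyUpTo; foldl-∷ʳ; length-++; length-applyUpTo;
         lookup-applyUpTo; applyUpTo-∷ʳ; upTo-∷ʳ; filter-all; filter-accept; filter-reject; filter-++; ++-identityʳ)
open import Data.List.Relation.Unary.All using (All; []; _∷_)
open import Data.List.Relation.Unary.All.Properties using (applyUpTo⁺₁)
open import Data.List.Relation.Unary.Any using (here; there)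
open import Data.Maybe using (Maybe; just; nothing)
open import Data.Nat renaming (_/_ to _/ₙ_)
open import Data.Nat.DivMod hiding (_/_)
open import Data.Nat.Induction using (<-rec)
open import Data.Nat.Logarithm
open import Data.Nat.Properties
open import Data.Nat.Tactic.RingSolver using (solve-∀)
open import Data.Product using (Σ; ∃; ∃₂; _×_; _,_; proj₁; proj₂)
open import Data.Rational using (ℚ; mkℚ; 0ℚ; _/_; *<*) renaming (_<_ to _<ℚ_)
open import Data.Sum using (_⊎_; inj₁; inj₂; [_,_])
open import Data.Unit using (tt)
open import Data.Vec using (Vec; toList; []; _∷_) renaming (lookup to lookupᵛ)
open import Function using (_∘_; id)
open import Relation.Binary.Definitions using (tri<; tri≈; tri>)
open import Relation.Binary.PropositionalEquality hiding ([_])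
open import Relation.Nullary using (¬_; yes; no)
open import Relation.Unary using (Decidable)

-- The cost of the scan fixes the chunk size. Every chunk has `d + 1` counters and takes part in
-- `log n` rounds; with chunks of `d log n` entries this amounts to O(n) operations, so a plain
-- doubling scan is good enough. Rounding `n` up to whole chunks adds O(log² n) entries, which is
-- O(n) too. Only counts of digits below a bound are kept: a prefix sum of packed counters is a
-- digit sum in base 2^d, hence a remainder modulo 2^d - 1, and the count of one symbol is a
-- difference of two such counts.
--
-- Overflow is controlled by a single number `u = 2 ^ (κ log n)` with `κ = K + 8`. It exceeds `n`,
-- `2 ^ (d * d)` and the word length, and a word ranges up to `u ^ 20`; so a bound is a small
-- exponent, and absence of overflow is a comparison of numerals. Arrays are spaced `u ^ 8` cells
-- apart, which costs nothing as only touched cells count, and an address is decoded by division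
-- with remainder. The address of a node is computed from its level and the numerical value of its
-- prefix, so nothing has to be allocated.

-- Total division and compiled expressions

infixl 7 _÷_ _﹪_

-- Zero for a zero divisor, as on the machine: these are the values of `DIV` and `REM` without a
-- side condition.
_÷_ _﹪_ : ℕ → ℕ → ℕ
x ÷ zero  = 0
x ÷ suc y = x /ₙ suc y
x ﹪ zero  = 0
x ﹪ suc y = x % suc y

÷≡/ : ∀ x y .{{_ : NonZero y}} → x ÷ y ≡ x /ₙ y
÷≡/ x (suc y) = refl

﹪≡% : ∀ x y .{{_ : NonZero y}} → x ﹪ y ≡ x % y
﹪≡% x (suc y) = refl

÷-≤ : ∀ x y → x ÷ y ≤ x
÷-≤ x zero    = z≤n
÷-≤ x (suc y) = m/n≤m x (suc y)

﹪-≤ : ∀ x y → x ﹪ y ≤ x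
﹪-≤ x zero    = z≤n
﹪-≤ x (suc y) = m%n≤m x (suc y)

𝟙 : Bool → ℕ
𝟙 b = if b then 1 else 0

𝟙≤1 : ∀ b → 𝟙 b ≤ 1
𝟙≤1 true  = s≤s z≤n
𝟙≤1 false = z≤n

-- Straight-line expressions and their compilation; registers from T₀ on are
-- scratch space of the compiled code.

infixl 8 _∸ᵉ_
infix 10 !_ $_ ‵_

data Exp : Set where
  ‵_   : ℕ → Exp
  $_   : Reg → Exp
  bin  : Op → Exp → Exp → Exp
  _∸ᵉ_ : Exp → Exp → Exp
  !_   : Exp → Exp

infixl 8 _+ᵉ_
infixl 9 _*ᵉ_ _/ᵉ_ _%ᵉ_
infixl 7 _≪ᵉ_ _<ᵉ_

_+ᵉ_ _*ᵉ_ _/ᵉ_ _%ᵉ_ _≪ᵉ_ _<ᵉ_ : Exp → Exp → Exp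
_+ᵉ_ = bin ADD
_*ᵉ_ = bin MUL
_/ᵉ_ = bin DIV
_%ᵉ_ = bin REM
_≪ᵉ_ = bin SHL
_<ᵉ_ = bin LT

T₀ : Reg
T₀ = 40

-- The result goes to `t` and no register below `t` changes, which lets operands nest. With no move
-- instruction, a register is copied by adding zero. Truncated subtraction multiplies the wrapped
-- difference by the flag `b < a`, computed before `t` is overwritten.
comp : Reg → Exp → Cmd
comp t (‵ a)       = lit t a
comp t ($ r)       = lit t 0 ⨾ op t ADD r t
comp t (bin o a b) = comp t a ⨾ comp (suc t) b ⨾ op t o t (suc t)
comp t (a ∸ᵉ b)    = comp t a ⨾ comp (suc t) b ⨾ op (2 + t) LT (suc t) t ⨾
                     op t SUB t (suc t) ⨾ op t MUL t (2 + t)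
comp t (! a)       = comp t a ⨾ load t t

cost : Exp → ℕ
cost (‵ a)       = 1
cost ($ r)       = 2
cost (bin o a b) = cost a + (cost b + 1)
cost (a ∸ᵉ b)    = cost a + (cost b + 3)
cost (! a)       = cost a + 1

infix 6 _⇐_ _↦_

_⇐_ : Reg → Exp → Cmd
r ⇐ e = comp T₀ e ⨾ lit (suc T₀) 0 ⨾ op r ADD T₀ (suc T₀)

_↦_ : Exp → Exp → Cmd
a ↦ b = comp T₀ a ⨾ comp (suc T₀) b ⨾ store T₀ (suc T₀)

-- A symbolic register file: known values with bounds on their magnitude,
-- as exponents of a fixed base.

Env : Set
Env = List (Reg × ℕ × ℕ)

lookupE : Reg → Env → Maybe (ℕ × ℕ)
lookupE r []                = nothing
lookupE r ((r′ , vb) ∷ δ) = if r′ ≡ᵇ r then just vb else lookupE r δ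

put : Reg → ℕ → ℕ → Env → Env
put r v β []                = (r , v , β) ∷ []
put r v β ((r′ , vb) ∷ δ) =
  if r′ ≡ᵇ r then (r , v , β) ∷ δ else (r′ , vb) ∷ put r v β δ

≡ᵇ-refl : ∀ r → (r ≡ᵇ r) ≡ true
≡ᵇ-refl zero    = refl
≡ᵇ-refl (suc r) = ≡ᵇ-refl r

≡ᵇ-≢ : ∀ {r s} → r ≢ s → (r ≡ᵇ s) ≡ false
≡ᵇ-≢ {zero}  {zero}  p = ⊥-elim (p refl)
≡ᵇ-≢ {zero}  {suc s} p = refl
≡ᵇ-≢ {suc r} {zero}  p = refl
≡ᵇ-≢ {suc r} {suc s} p = ≡ᵇ-≢ (p ∘ cong suc)

≡ᵇ-true : ∀ r s → (r ≡ᵇ s) ≡ true → r ≡ s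
≡ᵇ-true r s e = ≡ᵇ⇒≡ r s (subst T (sym e) tt)

lookup-put-same : ∀ r v β δ → lookupE r (put r v β δ) ≡ just (v , β)
lookup-put-same r v β [] rewrite ≡ᵇ-refl r = refl
lookup-put-same r v β ((r′ , vb) ∷ δ) with r′ ≡ᵇ r in eq
... | true  rewrite ≡ᵇ-refl r = refl
... | false rewrite eq = lookup-put-same r v β δ

lookup-put-other : ∀ {r s} v β δ → r ≢ s → lookupE s (put r v β δ) ≡ lookupE s δ
lookup-put-other v β [] p rewrite ≡ᵇ-≢ p = refl
lookup-put-other {r} {s} v β ((r′ , vb) ∷ δ) p with r′ ≡ᵇ r in eq
... | true with refl ← ≡ᵇ-true r′ r eq rewrite ≡ᵇ-≢ p = refl
... | false with r′ ≡ᵇ s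
...   | true  = refl
...   | false = lookup-put-other v β δ p

-- Symbolic evaluation, and division with remainder

sumUpTo : (ℕ → ℕ) → ℕ → ℕ
sumUpTo f zero    = 0
sumUpTo f (suc n) = f 0 + sumUpTo (f ∘ suc) n

concatUpTo : (ℕ → List ℕ) → ℕ → List ℕ
concatUpTo f zero    = []
concatUpTo f (suc n) = f 0 ++ concatUpTo (f ∘ suc) n

∈-concatUpTo⁺ : ∀ (f : ℕ → List ℕ) {n i α} → i < n → α ∈ f i → α ∈ concatUpTo f n
∈-concatUpTo⁺ f {suc n} {zero}  _         p = ∈-++⁺ˡ p
∈-concatUpTo⁺ f {suc n} {suc i} (s≤s i<n) p = ∈-++⁺ʳ (f 0) (∈-concatUpTo⁺ (f ∘ suc) i<n p)

∈-concatUpTo⁻ : ∀ (f : ℕ → List ℕ) n {α} → α ∈ concatUpTo f n → ∃ λ i → i < n × α ∈ f i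
∈-concatUpTo⁻ f (suc n) p with ∈-++⁻ (f 0) p
... | inj₁ q = 0 , s≤s z≤n , q
... | inj₂ q with ∈-concatUpTo⁻ (f ∘ suc) n q
...   | i , i<n , r = suc i , s≤s i<n , r

-- Values are bounded by powers of the base u, and machine words are below u ^ E.

E : ℕ
E = 20

-- Load-free expressions are evaluated by computation.

evalE : Env → Exp → Maybe (ℕ × ℕ)
evalE δ (‵ a) = if a <ᵇ 256 then just (a , 1) else nothing
evalE δ ($ r) = if r <ᵇ T₀ then lookupE r δ else nothing
evalE δ (bin o a b) with evalE δ a | evalE δ b
... | just (x , α) | just (y , β) = apply o
  where
  apply : Op → Maybe (ℕ × ℕ)
  apply ADD = if suc (α ⊔ β) ≤ᵇ E then just (x + y , suc (α ⊔ β)) else nothing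
  apply MUL = if α + β ≤ᵇ E then just (x * y , α + β) else nothing
  apply DIV = if α ≤ᵇ E then just (x ÷ y , α) else nothing
  apply REM = if α ≤ᵇ E then just (x ﹪ y , α) else nothing
  apply LT  = just (𝟙 (x <ᵇ y) , 1)
  -- A shift needs a bound on a power of 2, not only on its operands; it gets a rule of its own, as
  -- does a load, which depends on the memory.
  apply _   = nothing
... | _ | _ = nothing
evalE δ (a ∸ᵉ b) with evalE δ a | evalE δ b
... | just (x , α) | just (y , β) =
  if α ≤ᵇ E then (if β ≤ᵇ E then just (x ∸ y , α) else nothing) else nothing
... | _ | _ = nothing
evalE δ (! a) = nothing

÷-﹪ : ∀ x {y} → 0 < y → x ≡ x ÷ y * y + x ﹪ y
÷-﹪ x {suc y} _ = trans (m≡m%n+[m/n]*n x (suc y)) (+-comm (x % suc y) _)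

﹪-< : ∀ x {y} → 0 < y → x ﹪ y < y
﹪-< x {suc y} _ = m%n<n x (suc y)

÷-unique : ∀ q {r y} → r < y → (q * y + r) ÷ y ≡ q
÷-unique q {r} {y@(suc _)} r< = begin
  (q * y + r) /ₙ y       ≡⟨ +-distrib-/ (q * y) r (subst (λ z → z + r % y < y) (sym (m*n%n≡0 q y)) (subst (_< y) (sym (m<n⇒m%n≡m r<)) r<)) ⟩
  q * y /ₙ y + r /ₙ y     ≡⟨ cong₂ _+_ (m*n/n≡m q y) (m<n⇒m/n≡0 r<) ⟩
  q + 0                 ≡⟨ +-identityʳ q ⟩
  q                     ∎
  where open ≡-Reasoning

﹪-unique : ∀ q {r y} → r < y → (q * y + r) ﹪ y ≡ r
﹪-unique q {r} {y@(suc _)} r< =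
  trans (cong (_% y) (+-comm (q * y) r)) (trans ([m+kn]%n≡m%n r q y) (m<n⇒m%n≡m r<))

÷-mono : ∀ {x x′} y → x ≤ x′ → x ÷ y ≤ x′ ÷ y
÷-mono zero    p = z≤n
÷-mono (suc y) p = /-monoˡ-≤ (suc y) p

÷-< : ∀ {x} q {y} → x < q * y → x ÷ y < q
÷-< {x} q {zero}  p with () ← subst (x <_) (*-zeroʳ q) p
÷-< q {suc y} p = m<n*o⇒m/o<n p

÷-*-≤ : ∀ x y → x ÷ y * y ≤ x
÷-*-≤ x zero    = z≤n
÷-*-≤ x (suc y) = m/n*n≤m x (suc y)

<-÷ : ∀ x {y} → 0 < y → x < suc (x ÷ y) * y
<-÷ x {y} 0<y = subst (_< suc (x ÷ y) * y) (sym (÷-﹪ x 0<y))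
  (subst (x ÷ y * y + x ﹪ y <_) (+-comm (x ÷ y * y) y) (+-monoʳ-< (x ÷ y * y) (﹪-< x 0<y)))

≤-÷ : ∀ {q x y} → 0 < y → q * y ≤ x → q ≤ x ÷ y
≤-÷ {q} {x} {y} 0<y p = subst (_≤ x ÷ y) (trans (cong (_÷ y) (sym (+-identityʳ (q * y)))) (÷-unique q 0<y)) (÷-mono y p)

÷-÷ : ∀ x y z → x ÷ y ÷ z ≡ x ÷ (y * z)
÷-÷ x zero    zero    = refl
÷-÷ x zero    (suc z) = 0/n≡0 (suc z)
÷-÷ x (suc y) zero    = cong (x ÷_) (sym (*-zeroʳ y))
÷-÷ x (suc y) (suc z) = m/n/o≡m/[n*o] x (suc y) (suc z)

m*n÷n : ∀ m {n} → 0 < n → m * n ÷ n ≡ m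
m*n÷n m {n} 0<n = trans (cong (_÷ n) (sym (+-identityʳ (m * n)))) (÷-unique m 0<n)

-- A discrete intermediate value theorem that needs no monotonicity: descending from `n`, the first
-- value at most `y` marks the crossing. It serves to invert the stable sort.
crossing : ∀ (f : ℕ → ℕ) n {y} → f 0 ≤ y → y < f n → ∃ λ x → x < n × f x ≤ y × y < f (suc x)
crossing f zero    l r = ⊥-elim (<⇒≱ r l)
crossing f (suc n) {y} l r with f n ≤? y
... | yes p = n , ≤-refl , p , r
... | no p with crossing f n l (≰⇒> p)
...   | x , x<n , q = x , m<n⇒m<1+n x<n , q

monotone : ∀ (f : ℕ → ℕ) → (∀ x → f x ≤ f (suc x)) → ∀ {x y} → x ≤ y → f x ≤ f y
monotone f s {x} {y} x≤y = subst (λ y → f x ≤ f y) (m+[n∸m]≡n x≤y) (go (y ∸ x))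
  where
  go : ∀ k → f x ≤ f (x + k)
  go zero    = ≤-reflexive (cong f (sym (+-identityʳ x)))
  go (suc k) = ≤-trans (go k) (subst (λ z → f (x + k) ≤ f z) (sym (+-suc x k)) (s (x + k)))

<ᵇ-true : ∀ {x y} → x < y → (x <ᵇ y) ≡ true
<ᵇ-true {x} {y} p with x <ᵇ y | <⇒<ᵇ p
... | true | _ = refl

<ᵇ-false : ∀ {x y} → y ≤ x → (x <ᵇ y) ≡ false
<ᵇ-false {x} {y} p with x <ᵇ y in e
... | false = refl
... | true  = ⊥-elim (<⇒≱ (<ᵇ⇒< x y (subst T (sym e) tt)) p)

-- Stable sorting by one digit, and packed counters

-- Counting the symbols dig 0, dig 1, … below c, and those equal to c

module Counting (dig : ℕ → ℕ) where

  G : ℕ → ℕ → ℕ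
  G c zero    = 0
  G c (suc x) = G c x + 𝟙 (dig x <ᵇ c)

  cnt : ℕ → ℕ → ℕ
  cnt c zero    = 0
  cnt c (suc x) = cnt c x + 𝟙 (dig x ≡ᵇ c)

  -- Hence the counts of digits below a bound also give the occurrences of each single symbol, and
  -- no other counters have to be stored.
  G-suc : ∀ c x → G (suc c) x ≡ G c x + cnt c x
  G-suc c zero    = refl
  G-suc c (suc x) = trans (cong₂ _+_ (G-suc c x) (split (dig x) c))
                          (interchange (G c x) (cnt c x) _ _)
    where
    interchange : ∀ a b c d → a + b + (c + d) ≡ a + c + (b + d)
    interchange = solve-∀
    split : ∀ s c → 𝟙 (s <ᵇ suc c) ≡ 𝟙 (s <ᵇ c) + 𝟙 (s ≡ᵇ c)
    split zero    zero    = refl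
    split zero    (suc c) = refl
    split (suc s) zero    = refl
    split (suc s) (suc c) = split s c

  G-≤ : ∀ c x → G c x ≤ x
  G-≤ c zero    = z≤n
  G-≤ c (suc x) = subst (G c x + 𝟙 (dig x <ᵇ c) ≤_) (+-comm x 1) (+-mono-≤ (G-≤ c x) (𝟙≤1 _))

  G-mono : ∀ c {x y} → x ≤ y → G c x ≤ G c y
  G-mono c = monotone (G c) (λ x → m≤m+n (G c x) _)

  cnt-mono : ∀ c {x y} → x ≤ y → cnt c x ≤ cnt c y
  cnt-mono c = monotone (cnt c) (λ x → m≤m+n (cnt c x) _)

  G-monoˡ : ∀ x {c c′} → c ≤ c′ → G c x ≤ G c′ x
  G-monoˡ x = monotone (λ c → G c x) (λ c → subst (G c x ≤_) (sym (G-suc c x)) (m≤m+n _ _))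

  G-0 : ∀ x → G 0 x ≡ 0
  G-0 zero    = refl
  G-0 (suc x) = cong (_+ 0) (G-0 x)

  G-d : ∀ {d} → (∀ x → dig x < d) → ∀ x → G d x ≡ x
  G-d p zero    = refl
  G-d p (suc x) = trans (cong₂ (λ a b → a + 𝟙 b) (G-d p x) (<ᵇ-true (p x))) (+-comm x 1)

  -- The position of the x'th entry in the stable sort of the first n ones,
  -- if it equals c.

  N : ℕ → ℕ → ℕ → ℕ
  N n c x = G c n + cnt c x

  -- The left side is how the program evaluates `N`, from three values of `G`; adding before
  -- subtracting keeps truncated subtraction exact.
  N-alt : ∀ n c x → (G c n + G (suc c) x) ∸ G c x ≡ N n c x
  N-alt n c x = begin
    (G c n + G (suc c) x) ∸ G c x          ≡⟨ cong (λ z → (G c n + z) ∸ G c x) (G-suc c x) ⟩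
    (G c n + (G c x + cnt c x)) ∸ G c x    ≡⟨ cong (_∸ G c x) (swap (G c n) (G c x) (cnt c x)) ⟩
    (G c x + (G c n + cnt c x)) ∸ G c x    ≡⟨ m+n∸m≡n (G c x) _ ⟩
    N n c x                                ∎
    where
    open ≡-Reasoning
    swap : ∀ a b c → a + (b + c) ≡ b + (a + c)
    swap = solve-∀

  N-hit : ∀ n {x c} → dig x ≡ c → N n c (suc x) ≡ suc (N n c x)
  N-hit n {x} {c} refl = trans (cong (λ b → G c n + (cnt c x + 𝟙 b)) (≡ᵇ-refl (dig x))) (lem (G c n) (cnt c x))
    where
    lem : ∀ a b → a + (b + 1) ≡ suc (a + b)
    lem = solve-∀

  N-miss : ∀ n {x c} → dig x ≢ c → N n c (suc x) ≡ N n c x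
  N-miss n {x} {c} p = trans (cong (λ b → G c n + (cnt c x + 𝟙 b)) (≡ᵇ-≢ p)) (cong (G c n +_) (+-identityʳ _))

  N-mono : ∀ n c {x y} → x ≤ y → N n c x ≤ N n c y
  N-mono n c p = +-monoʳ-≤ (G c n) (cnt-mono c p)

  N-end : ∀ n c → N n c n ≡ G (suc c) n
  N-end n c = sym (G-suc c n)

  pos : ℕ → ℕ → ℕ
  pos n x = N n (dig x) x

  pos-<-end : ∀ n {x e} → x < e → pos n x < N n (dig x) e
  pos-<-end n {x} {e} x<e = subst (_≤ N n (dig x) e) (N-hit n {x} refl) (N-mono n (dig x) x<e)

  pos-< : ∀ n {x} → x < n → pos n x < n
  pos-< n {x} x<n = <-≤-trans (pos-<-end n x<n) (subst (_≤ n) (sym (N-end n (dig x))) (G-≤ _ n))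

  pos-separate : ∀ n {x y} → x < n → dig x < dig y → pos n x < pos n y
  pos-separate n {x} {y} x<n l = <-≤-trans (subst (pos n x <_) (N-end n (dig x)) (pos-<-end n x<n))
    (≤-trans (G-monoˡ n l) (m≤m+n _ _))

  pos-injective : ∀ n {x y} → x < n → y < n → pos n x ≡ pos n y → x ≡ y
  pos-injective n {x} {y} x<n y<n e with <-cmp (dig x) (dig y)
  ... | tri< l _ _ = ⊥-elim (<-irrefl e (pos-separate n x<n l))
  ... | tri> _ _ l = ⊥-elim (<-irrefl (sym e) (pos-separate n y<n l))
  ... | tri≈ _ c _ with <-cmp x y
  ...   | tri< l _ _ = ⊥-elim (<-irrefl (trans e (cong (λ c → N n c y) (sym c))) (pos-<-end n l))
  ...   | tri≈ _ q _ = q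
  ...   | tri> _ _ l = ⊥-elim (<-irrefl (trans (sym e) (cong (λ c → N n c x) c)) (pos-<-end n l))

  -- Two crossings locate a preimage: `G c n` passes `y` at a digit `c`, then `N n c` passes it at a
  -- position `x`. Since `N n c` moves only at entries with digit `c`, and then by one, `x` carries
  -- the digit `c` and is sent exactly to `y`.
  pos-surjective : ∀ {d} n → (∀ x → dig x < d) → ∀ {y} → y < n → ∃ λ x → x < n × pos n x ≡ y
  pos-surjective {d} n dig< {y} y<n
    with crossing (λ c → G c n) d (subst (_≤ y) (sym (G-0 n)) z≤n) (subst (y <_) (sym (G-d dig< n)) y<n)
  ... | c , _ , l , r
    with crossing (N n c) n (subst (_≤ y) (sym (+-identityʳ _)) l) (subst (y <_) (sym (N-end n c)) r)
  ... | x , x<n , l′ , r′ with dig x ≟ c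
  ...   | yes refl = x , x<n , ≤-antisym l′ (s≤s⁻¹ (subst (y <_) (N-hit n refl) r′))
  ...   | no p = ⊥-elim (<⇒≱ r′ (subst (_≤ y) (sym (N-miss n p)) l′))

  -- The inverse of pos n, by search

  search : ℕ → ℕ → ℕ → ℕ
  search n y zero = 0
  search n y (suc m) with pos n m ≟ y
  ... | yes _ = m
  ... | no  _ = search n y m

  inv : ℕ → ℕ → ℕ
  inv n y = search n y n

  inv-pos : ∀ n {x} → x < n → inv n (pos n x) ≡ x
  inv-pos n {x} x<n = go n ≤-refl x<n
    where
    go : ∀ m → m ≤ n → x < m → search n (pos n x) m ≡ x
    go (suc m) m<n x<m with pos n m ≟ pos n x
    ... | yes e = pos-injective n m<n x<n e
    ... | no e with x ≟ m
    ...   | yes refl = ⊥-elim (e refl)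
    ...   | no x≢m = go m (<⇒≤ m<n) (≤∧≢⇒< (s≤s⁻¹ x<m) x≢m)

  -- Counters of size B, one for each symbol, packed into a number.  A prefix
  -- of counters is summed up by reduction modulo B - 1.

  packed : ℕ → ℕ → ℕ → ℕ
  packed B s zero    = 0
  packed B s (suc t) = packed B s t + B ^ dig (s + t)

  -- Modulo `b` every power of `suc b` is 1, so the counters below `c` amount to `r * b + g` with
  -- `g` their sum, while the others contribute a multiple of `suc b ^ c`. The inequality says that
  -- each of the `g` low summands is at most `suc b ^ (c - 1)`, multiplied by `suc b` to avoid the
  -- predecessor.
  packed-split : ∀ b c s t → ∃₂ λ q r → ∃ λ g →
    packed (suc b) s t ≡ q * suc b ^ c + (r * b + g) × g + G c s ≡ G c (s + t) ×
    (r * b + g) * suc b ≤ g * suc b ^ c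
  packed-split b c s zero = 0 , 0 , 0 , refl , cong (G c) (sym (+-identityʳ s)) , z≤n
  packed-split b c s (suc t) with packed-split b c s t
  ... | q , r , g , e , eg , l with dig (s + t) <? c
  ...   | yes p with power-mod (dig (s + t))
    where
    power-mod : ∀ i → ∃ λ r → suc b ^ i ≡ r * b + 1
    power-mod zero = 0 , refl
    power-mod (suc i) with power-mod i
    ... | r , e = suc b ^ i + r , trans (cong (λ z → z + b * suc b ^ i) e) (lem r b (suc b ^ i))
      where
      lem : ∀ r b z → r * b + 1 + b * z ≡ (z + r) * b + 1
      lem = solve-∀
  ...     | r′ , e′ = q , r + r′ , suc g ,
      trans (cong₂ _+_ e e′) (lem₁ (q * suc b ^ c) r r′ b g) ,
      trans (cong (λ z → suc z) eg) (sym (trans (cong (G c) (+-suc s t))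
        (trans (cong (λ z → G c (s + t) + 𝟙 z) (<ᵇ-true p)) (+-comm _ 1)))) ,
      (begin
        ((r + r′) * b + suc g) * suc b               ≡⟨ lem₂ r r′ b g ⟩
        (r * b + g) * suc b + suc b * (r′ * b + 1)   ≡⟨ cong (λ z → (r * b + g) * suc b + suc b * z) e′ ⟨
        (r * b + g) * suc b + suc b ^ suc (dig (s + t)) ≤⟨ +-mono-≤ l (^-monoʳ-≤ (suc b) p) ⟩
        g * suc b ^ c + suc b ^ c                    ≡⟨ +-comm (g * suc b ^ c) _ ⟩
        suc g * suc b ^ c                            ∎)
      where
      open ≤-Reasoning
      lem₁ : ∀ x r r′ b g → x + (r * b + g) + (r′ * b + 1) ≡ x + ((r + r′) * b + suc g)
      lem₁ = solve-∀
      lem₂ : ∀ r r′ b g → ((r + r′) * b + suc g) * suc b ≡ (r * b + g) * suc b + suc b * (r′ * b + 1)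
      lem₂ = solve-∀
  packed-split b c s (suc t) | q , r , g , e , eg , l | no p =
    q + suc b ^ (dig (s + t) ∸ c) , r , g ,
    trans (cong₂ _+_ e (trans (cong (suc b ^_) (sym (m∸n+n≡m (≮⇒≥ p)))) (^-distribˡ-+-* (suc b) (dig (s + t) ∸ c) c)))
          (lem q (suc b ^ c) (r * b + g) (suc b ^ (dig (s + t) ∸ c))) ,
    trans eg (sym (trans (cong (G c) (+-suc s t))
      (trans (cong (λ z → G c (s + t) + 𝟙 z) (<ᵇ-false (≮⇒≥ p))) (+-identityʳ _)))) ,
    l
    where
    lem : ∀ q z y w → q * z + y + w * z ≡ (q + w) * z + y
    lem = solve-∀

  -- As `g ≤ t < B - 1`, the low part lies below `B ^ c`, so the first remainder isolates it, and
  -- the second remainder returns `g` itself.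
  packed-count : ∀ B c s t → suc t < B → packed B s t ﹪ B ^ c ﹪ (B ∸ 1) + G c s ≡ G c (s + t)
  packed-count (suc b) c s t (s≤s t<b) with packed-split b c s t
  ... | q , r , g , e , eg , l = trans (cong (_+ G c s) value) eg
    where
    g≤t : g ≤ t
    g≤t = +-cancelʳ-≤ (G c s) g t (subst (_≤ t + G c s) (sym eg) (grow t))
      where
      grow : ∀ t → G c (s + t) ≤ t + G c s
      grow zero    = ≤-reflexive (cong (G c) (+-identityʳ s))
      grow (suc t) = subst (λ z → G c z ≤ suc t + G c s) (sym (+-suc s t))
        (≤-trans (+-mono-≤ (grow t) (𝟙≤1 (dig (s + t) <ᵇ c))) (≤-reflexive (+-comm _ 1)))
    g<b = ≤-<-trans g≤t t<b
    low< : r * b + g < suc b ^ c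
    low< = *-cancelʳ-< (suc b) (r * b + g) (suc b ^ c) (≤-<-trans l
      (subst (g * suc b ^ c <_) (*-comm (suc b) (suc b ^ c)) (*-monoˡ-< (suc b ^ c) {{m^n≢0 (suc b) c}} (m<n⇒m<1+n g<b))))
    value : packed (suc b) s t ﹪ suc b ^ c ﹪ b ≡ g
    value = trans (cong (_﹪ b) (trans (cong (_﹪ suc b ^ c) e) (﹪-unique q low<))) (﹪-unique r g<b)

-- Slices, bit streams and their words

-- Contiguous pieces of a sequence

slice : (ℕ → ℕ) → ℕ → ℕ → List ℕ
slice f o m = applyUpTo (λ t → f (o + t)) m

slice-∷ʳ : ∀ f o m → slice f o (suc m) ≡ slice f o m ∷ʳ f (o + m)
slice-∷ʳ f o m = sym (applyUpTo-∷ʳ (λ t → f (o + t)) m)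

take-applyUpTo : ∀ (f : ℕ → ℕ) {i m} → i ≤ m → take i (applyUpTo f m) ≡ applyUpTo f i
take-applyUpTo f z≤n     = refl
take-applyUpTo f (s≤s p) = cong (f 0 ∷_) (take-applyUpTo (f ∘ suc) p)

filter-∷ʳ-hit : ∀ {P : ℕ → Set} (P? : Decidable P) xs {x} → P x → filter P? (xs ∷ʳ x) ≡ filter P? xs ∷ʳ x
filter-∷ʳ-hit P? xs {x} p = trans (filter-++ P? xs (x ∷ [])) (cong (filter P? xs ++_) (filter-accept P? p))

filter-∷ʳ-miss : ∀ {P : ℕ → Set} (P? : Decidable P) xs {x} → ¬ P x → filter P? (xs ∷ʳ x) ≡ filter P? xs
filter-∷ʳ-miss P? xs {x} p = trans (filter-++ P? xs (x ∷ []))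
  (trans (cong (filter P? xs ++_) (filter-reject P? p)) (++-identityʳ _))

-- Induction on the length: one more entry with digit `c` is moved to the current end `N n c` and
-- advances it by one, any other entry leaves the end alone. Thus the child is contiguous and keeps
-- the original order.
slice-child : ∀ (D a a′ : ℕ → ℕ) n → let open Counting (D ∘ a) in
  (∀ x → x < n → a′ (pos n x) ≡ a x) → ∀ c o m → o + m ≤ n →
  slice a′ (N n c o) (N n c (o + m) ∸ N n c o) ≡ filter (λ s → D s ≟ c) (slice a o m)
slice-child D a a′ n moved c o zero le
  rewrite +-identityʳ o | n∸n≡0 (Counting.N (D ∘ a) n c o) = refl
slice-child D a a′ n moved c o (suc m) le
  with slice-child D a a′ n moved c o m (≤-trans (+-monoʳ-≤ o (n≤1+n m)) le) | D (a (o + m)) ≟ c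
... | ih | yes refl = begin
    slice a′ Y (N n c (o + suc m) ∸ Y)          ≡⟨ cong (λ z → slice a′ Y (N n c z ∸ Y)) (+-suc o m) ⟩
    slice a′ Y (N n c (suc (o + m)) ∸ Y)        ≡⟨ cong (λ z → slice a′ Y (z ∸ Y)) (N-hit n refl) ⟩
    slice a′ Y (suc X ∸ Y)                      ≡⟨ cong (slice a′ Y) (+-∸-assoc 1 Y≤X) ⟩
    slice a′ Y (suc (X ∸ Y))                    ≡⟨ slice-∷ʳ a′ Y (X ∸ Y) ⟩
    slice a′ Y (X ∸ Y) ∷ʳ a′ (Y + (X ∸ Y))      ≡⟨ cong₂ _∷ʳ_ ih (trans (cong a′ (m+[n∸m]≡n Y≤X))
                                                     (moved (o + m) (subst (_≤ n) (+-suc o m) le))) ⟩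
    filter P? (slice a o m) ∷ʳ a (o + m)        ≡⟨ filter-∷ʳ-hit P? (slice a o m) refl ⟨
    filter P? (slice a o m ∷ʳ a (o + m))        ≡⟨ cong (filter P?) (slice-∷ʳ a o m) ⟨
    filter P? (slice a o (suc m))               ∎
  where
  open ≡-Reasoning
  open Counting (D ∘ a)
  P? = λ s → D s ≟ c
  X = N n c (o + m)
  Y = N n c o
  Y≤X : Y ≤ X
  Y≤X = N-mono n c (m≤m+n o m)
... | ih | no p = begin
    slice a′ Y (N n c (o + suc m) ∸ Y)      ≡⟨ cong (λ z → slice a′ Y (N n c z ∸ Y)) (+-suc o m) ⟩
    slice a′ Y (N n c (suc (o + m)) ∸ Y)    ≡⟨ cong (λ z → slice a′ Y (z ∸ Y)) (N-miss n p) ⟩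
    slice a′ Y (N n c (o + m) ∸ Y)          ≡⟨ ih ⟩
    filter P? (slice a o m)                 ≡⟨ filter-∷ʳ-miss P? (slice a o m) p ⟨
    filter P? (slice a o m ∷ʳ a (o + m))    ≡⟨ cong (filter P?) (slice-∷ʳ a o m) ⟨
    filter P? (slice a o (suc m))           ∎
  where
  open ≡-Reasoning
  open Counting (D ∘ a)
  P? = λ s → D s ≟ c
  Y = N n c o

-- Serves both counts of the specification: `H` is `G (suc c)` for `count≤` and `cnt c` for
-- `count≡`.
count-slice : ∀ {P : ℕ → Set} (P? : Decidable P) (f H : ℕ → ℕ) →
  (∀ x → P (f x) → H (suc x) ≡ H x + 1) → (∀ x → ¬ P (f x) → H (suc x) ≡ H x) →
  ∀ o m → length (filter P? (slice f o m)) + H o ≡ H (o + m)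
count-slice P? f H hit miss o zero = cong H (sym (+-identityʳ o))
count-slice P? f H hit miss o (suc m) with count-slice P? f H hit miss o m | P? (f (o + m))
... | ih | yes p = begin
    length (filter P? (slice f o (suc m))) + H o          ≡⟨ cong (λ z → length z + H o)
        (trans (cong (filter P?) (slice-∷ʳ f o m)) (filter-∷ʳ-hit P? (slice f o m) p)) ⟩
    length (filter P? (slice f o m) ∷ʳ f (o + m)) + H o   ≡⟨ cong (_+ H o) (length-++ (filter P? (slice f o m))) ⟩
    length (filter P? (slice f o m)) + 1 + H o            ≡⟨ swap (length (filter P? (slice f o m))) (H o) ⟩
    length (filter P? (slice f o m)) + H o + 1            ≡⟨ cong (_+ 1) ih ⟩
    H (o + m) + 1                                         ≡⟨ hit (o + m) p ⟨
    H (suc (o + m))                                       ≡⟨ cong H (+-suc o m) ⟨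
    H (o + suc m)                                         ∎
  where
  open ≡-Reasoning
  swap : ∀ a b → a + 1 + b ≡ a + b + 1
  swap = solve-∀
... | ih | no p = trans (cong (λ z → length z + H o)
        (trans (cong (filter P?) (slice-∷ʳ f o m)) (filter-∷ʳ-miss P? (slice f o m) p)))
      (trans ih (trans (sym (miss (o + m) p)) (cong H (sym (+-suc o m)))))

module _ (dig : ℕ → ℕ) where
  open Counting dig

  count≤-slice : ∀ c o m → count≤ c (slice dig o m) + G (suc c) o ≡ G (suc c) (o + m)
  count≤-slice c = count-slice (_≤? c) dig (G (suc c))
    (λ x p → cong (λ b → G (suc c) x + 𝟙 b) (<ᵇ-true (s≤s p)))
    (λ x p → trans (cong (λ b → G (suc c) x + 𝟙 b) (<ᵇ-false (≰⇒> p))) (+-identityʳ _))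

  count≡-slice : ∀ c o m → count≡ c (slice dig o m) + cnt c o ≡ cnt c (o + m)
  count≡-slice c = count-slice (_≟ c) dig (cnt c)
    (λ { x refl → cong (λ b → cnt c x + 𝟙 b) (≡ᵇ-refl c) })
    (λ x p → trans (cong (λ b → cnt c x + 𝟙 b) (≡ᵇ-≢ p)) (+-identityʳ _))

-- Bits

tb : ℕ → ℕ → ℕ
tb i x = x ÷ 2 ^ i ﹪ 2

bit≡tb : ∀ i x → bit i x ≡ tb i x
bit≡tb i x = sym (cong (_% 2) (÷≡/ x (2 ^ i) {{m^n≢0 2 i}}))

0<2^ : ∀ i → 0 < 2 ^ i
0<2^ = m^n>0 2

tb-low : ∀ {i k} x z → i < k → tb i (z * 2 ^ k + x) ≡ tb i x
tb-low {i} {k} x z i<k = trans (cong (λ v → v ÷ 2 ^ i ﹪ 2) split) (trans (cong (_﹪ 2) (÷-unique (z * 2 ^ e * 2 + q) (﹪-< x (0<2^ i)))) even)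
  where
  e = k ∸ suc i
  q = x ÷ 2 ^ i
  arith : ∀ z p t q r → z * (p * (2 * t)) + (q * t + r) ≡ (z * p * 2 + q) * t + r
  arith = solve-∀
  split : z * 2 ^ k + x ≡ (z * 2 ^ e * 2 + q) * 2 ^ i + x ﹪ 2 ^ i
  split = trans (cong₂ (λ a b → z * a + b)
                  (trans (cong (2 ^_) (sym (m∸n+n≡m i<k))) (^-distribˡ-+-* 2 e (suc i)))
                  (÷-﹪ x (0<2^ i)))
                (arith z (2 ^ e) (2 ^ i) q (x ﹪ 2 ^ i))
  even : (z * 2 ^ e * 2 + q) ﹪ 2 ≡ q ﹪ 2
  even = trans (cong (_﹪ 2) (trans (cong (z * 2 ^ e * 2 +_) (÷-﹪ q (s≤s z≤n)))
                 (trans (sym (+-assoc (z * 2 ^ e * 2) _ _)) (cong (_+ q ﹪ 2) (sym (*-distribʳ-+ 2 (z * 2 ^ e) (q ÷ 2)))))))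
               (﹪-unique (z * 2 ^ e + q ÷ 2) (﹪-< q (s≤s z≤n)))

tb-mod : ∀ {r w} x → r < w → tb r (x ﹪ 2 ^ w) ≡ tb r x
tb-mod {r} {w} x r<w = sym (trans (cong (tb r) (÷-﹪ x (0<2^ w))) (tb-low (x ﹪ 2 ^ w) (x ÷ 2 ^ w) r<w))

tb-shift : ∀ b r x → tb r (x ÷ 2 ^ b) ≡ tb (b + r) x
tb-shift b r x = cong (_﹪ 2) (trans (÷-÷ x (2 ^ b) (2 ^ r)) (cong (x ÷_) (sym (^-distribˡ-+-* 2 b r))))

-- Concatenation of k-bit entries

stream : ℕ → (ℕ → ℕ) → ℕ → ℕ
stream k f zero    = 0
stream k f (suc m) = stream k (f ∘ suc) m * 2 ^ k + f 0

tb-stream : ∀ {k} (f : ℕ → ℕ) → (∀ j → f j < 2 ^ k) → ∀ {m} j {b} → j < m → b < k →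
            tb (j * k + b) (stream k f m) ≡ tb b (f j)
tb-stream {k} f f< {suc m} zero    _         b<k = tb-low (f 0) (stream k (f ∘ suc) m) b<k
tb-stream {k} f f< {suc m} (suc j) {b} (s≤s j<m) b<k = begin
  tb (k + j * k + b) X              ≡⟨ cong (λ i → tb i X) (+-assoc k (j * k) b) ⟩
  tb (k + (j * k + b)) X            ≡⟨ tb-shift k (j * k + b) X ⟨
  tb (j * k + b) (X ÷ 2 ^ k)        ≡⟨ cong (tb (j * k + b)) (÷-unique (stream k (f ∘ suc) m) (f< 0)) ⟩
  tb (j * k + b) (stream k (f ∘ suc) m) ≡⟨ tb-stream (f ∘ suc) (f< ∘ suc) j j<m b<k ⟩
  tb b (f (suc j))                  ∎
  where
  open ≡-Reasoning
  X = stream k (f ∘ suc) m * 2 ^ k + f 0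

-- Word q of the stream of f 0, …, f (m - 1), with w-bit words

module Words (w k m : ℕ) (f : ℕ → ℕ) (q : ℕ) where

  -- The word starts `offset` bits into entry `first` and takes `number` further entries.
  -- `m ∸ (m ∸ y)` is a minimum in terms of the available operations. An entry that begins exactly
  -- where the word ends may be included; the final remainder removes it.
  first offset number word : ℕ
  first  = q * w ÷ k
  offset = q * w ﹪ k
  number = (m ∸ (m ∸ suc ((q * w + w) ÷ k))) ∸ suc first
  word   = (stream k (λ t → f (first + suc t)) number * 2 ^ (k ∸ offset) + f first ÷ 2 ^ offset) ﹪ 2 ^ w

  private
    end = m ∸ (m ∸ suc ((q * w + w) ÷ k))

    ∸∸-≤ʳ : ∀ x y → x ∸ (x ∸ y) ≤ y
    ∸∸-≤ʳ x y with ≤-total y x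
    ... | inj₁ p = ≤-reflexive (m∸[m∸n]≡n p)
    ... | inj₂ p = ≤-trans (m∸n≤m x (x ∸ y)) p

    ≤-∸∸ : ∀ {z} x y → z ≤ x → z ≤ y → z ≤ x ∸ (x ∸ y)
    ≤-∸∸ {z} x y p r with ≤-total y x
    ... | inj₁ s = subst (z ≤_) (sym (m∸[m∸n]≡n s)) r
    ... | inj₂ s = subst (z ≤_) (sym (cong (x ∸_) (m≤n⇒m∸n≡0 s))) p

  number-≤ : 0 < k → number ≤ w
  number-≤ 0<k = subst (number ≤_) (m+n∸m≡n first w) (∸-monoˡ-≤ (suc first)
    (≤-trans (∸∸-≤ʳ m _) (÷-< (suc (first + w)) (begin-strict
      q * w + w                    <⟨ +-mono-<-≤ (<-÷ (q * w) 0<k) (subst (_≤ w * k) (*-identityʳ w) (*-monoʳ-≤ w 0<k)) ⟩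
      suc first * k + w * k        ≡⟨ *-distribʳ-+ k (suc first) w ⟨
      suc (first + w) * k          ∎))))
    where open ≤-Reasoning

  -- `m ⊓ first` is the entry reached before this word. Over consecutive words the inequality
  -- telescopes, so together they take at most `m` further entries, although a single word may take
  -- about `w / k` of them.
  number-telescopes : number + m ⊓ first ≤ m ⊓ ((q * w + w) ÷ k)
  number-telescopes with suc first ≤? end
  ... | no p = ≤-trans (≤-reflexive (cong (_+ m ⊓ first) (m≤n⇒m∸n≡0 (≰⇒≥ p))))
                       (⊓-monoʳ-≤ m (÷-mono k (m≤m+n (q * w) w)))
  ... | yes p = ⊓-glb (≤-trans bound (≤-trans (n≤1+n _) suc-pred-≤)) (≤-trans bound (s≤s⁻¹ (≤-trans suc-pred-≤′ (∸∸-≤ʳ m _))))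
    where
    pl = pred end
    bound : number + m ⊓ first ≤ pl
    bound = ≤-trans (+-monoʳ-≤ number (m⊓n≤n m first)) (≤-reflexive (s-eq end p))
      where
      s-eq : ∀ l → suc first ≤ l → l ∸ suc first + first ≡ pred l
      s-eq (suc l) (s≤s r) = m∸n+n≡m r
    suc-pred-≤′ : suc pl ≤ end
    suc-pred-≤′ = ≤-reflexive (suc-pred end {{>-nonZero (≤-trans (s≤s z≤n) p)}})
    suc-pred-≤ : suc pl ≤ m
    suc-pred-≤ = ≤-trans suc-pred-≤′ (m∸n≤m m (m ∸ suc ((q * w + w) ÷ k)))

  -- Dropping `offset` bits of the stream that begins with entry `first` gives the word before
  -- truncation, which reduces the claim to `tb-stream`; truncation is invisible below bit `w`.
  tb-word : 0 < k → (∀ j → f j < 2 ^ k) → ∀ {j b r} → j < m → b < k → r < w →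
            q * w + r ≡ j * k + b → tb r word ≡ tb b (f j)
  tb-word 0<k f< {j} {b} {r} j<m b<k r<w e = begin
    tb r word                          ≡⟨ tb-mod _ r<w ⟩
    tb r (H * 2 ^ (k ∸ offset) + f first ÷ 2 ^ offset) ≡⟨ cong (tb r) whole ⟨
    tb r (F ÷ 2 ^ offset)              ≡⟨ tb-shift offset r F ⟩
    tb (offset + r) F                  ≡⟨ cong (λ i → tb i F) position ⟩
    tb ((j ∸ first) * k + b) F         ≡⟨ tb-stream (λ t → f (first + t)) (λ t → f< (first + t)) (j ∸ first) inside b<k ⟩
    tb b (f (first + (j ∸ first)))     ≡⟨ cong (λ i → tb b (f i)) (m+[n∸m]≡n first≤j) ⟩
    tb b (f j)                         ∎
    where
    open ≡-Reasoning
    H = stream k (λ t → f (first + suc t)) number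
    F = stream k (λ t → f (first + t)) (suc number)
    offset<k = ﹪-< (q * w) 0<k
    whole : F ÷ 2 ^ offset ≡ H * 2 ^ (k ∸ offset) + f first ÷ 2 ^ offset
    whole = trans (cong (_÷ 2 ^ offset) (trans (cong₂ (λ p v → H * p + v)
                (trans (cong (2 ^_) (sym (m∸n+n≡m (<⇒≤ offset<k)))) (^-distribˡ-+-* 2 (k ∸ offset) offset))
                (trans (cong f (+-identityʳ first)) (÷-﹪ (f first) (0<2^ offset))))
              (arith H (2 ^ (k ∸ offset)) (2 ^ offset) _ _)))
            (÷-unique _ (﹪-< (f first) (0<2^ offset)))
      where
      arith : ∀ h p t q r → h * (p * t) + (q * t + r) ≡ (h * p + q) * t + r
      arith = solve-∀
    first≤j : first ≤ j
    first≤j = s≤s⁻¹ (*-cancelʳ-< k first (suc j) (≤-<-trans (÷-*-≤ (q * w) k)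
      (≤-<-trans (subst (q * w ≤_) e (m≤m+n (q * w) r)) (subst (j * k + b <_) (+-comm (j * k) k) (+-monoʳ-< (j * k) b<k)))))
    position : offset + r ≡ (j ∸ first) * k + b
    position = +-cancelˡ-≡ (first * k) _ _ (trans (sym (+-assoc (first * k) offset r))
      (trans (cong (_+ r) (sym (÷-﹪ (q * w) 0<k))) (trans e
        (trans (cong (λ z → z * k + b) (sym (m+[n∸m]≡n first≤j))) (arith first (j ∸ first) k b)))))
      where
      arith : ∀ x y k b → (x + y) * k + b ≡ x * k + (y * k + b)
      arith = solve-∀
    j<end : j < end
    j<end = ≤-∸∸ m _ j<m (s≤s (≤-÷ 0<k (≤-trans (subst (j * k ≤_) (sym e) (m≤m+n (j * k) b)) (+-monoʳ-≤ (q * w) (<⇒≤ r<w)))))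
    inside : j ∸ first < suc number
    inside = s≤s (subst (_≤ number) (+-∸-cancel first j) (∸-monoˡ-≤ (suc first) j<end))
      where
      +-∸-cancel : ∀ x y → suc y ∸ suc x ≡ y ∸ x
      +-∸-cancel x y = refl

-- Estimates for logarithms and powers

-- Logarithms

<-⌈log₂⌉ : ∀ n i → i < ⌈log₂ n ⌉ → 2 ^ i < n
<-⌈log₂⌉ n i i< with 2 ^ i <? n
... | yes p = p
... | no p = ⊥-elim (<⇒≱ i< (subst (⌈log₂ n ⌉ ≤_) (⌈log₂2^n⌉≡n i) (⌈log₂⌉-mono-≤ (≮⇒≥ p))))

-- A counterexample `n ≥ 2` would pass to `⌈ n /2⌉`, whose rounded logarithm is one less, and there
-- is none below 2. The conclusion of `bound` is a contradiction in disguise, since its left side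
-- equals `suc ⌈log₂ n ⌉`.
≤-2^⌈log₂⌉ : ∀ n → n ≤ 2 ^ ⌈log₂ n ⌉
≤-2^⌈log₂⌉ n with n ≤? 2 ^ ⌈log₂ n ⌉
... | yes p = p
... | no p = ⊥-elim (<-irrefl refl (<-≤-trans (≤-reflexive (sym (⌈log₂2^n⌉≡n (suc ⌈log₂ n ⌉)))) (bound n (≰⇒> p))))
  where
  bound : ∀ n → 2 ^ ⌈log₂ n ⌉ < n → ⌈log₂ (2 ^ suc ⌈log₂ n ⌉) ⌉ ≤ ⌈log₂ n ⌉
  bound = <-rec _ step
    where
    step : ∀ n → (∀ {m} → m < n → 2 ^ ⌈log₂ m ⌉ < m → ⌈log₂ (2 ^ suc ⌈log₂ m ⌉) ⌉ ≤ ⌈log₂ m ⌉) →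
           2 ^ ⌈log₂ n ⌉ < n → ⌈log₂ (2 ^ suc ⌈log₂ n ⌉) ⌉ ≤ ⌈log₂ n ⌉
    step 1 ih (s≤s ())
    step n@(suc (suc n′)) ih p = ⊥-elim (absurd (ih half< half>))
      where
      1≤log : 1 ≤ ⌈log₂ n ⌉
      1≤log = ⌈log₂⌉-mono-≤ {2} {n} (s≤s (s≤s z≤n))
      half = ⌈ n /2⌉
      half< : half < n
      half< = ⌈n/2⌉<n n′
      twice : ∀ m → m ≤ 2 * ⌈ m /2⌉
      twice zero = z≤n
      twice (suc zero) = s≤s z≤n
      twice (suc (suc m)) = subst (suc (suc m) ≤_) (cong suc (sym (+-suc ⌈ m /2⌉ (⌈ m /2⌉ + 0)))) (s≤s (s≤s (twice m)))
      half> : 2 ^ ⌈log₂ half ⌉ < half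
      half> = *-cancelˡ-< 2 _ _ (<-≤-trans (subst (λ e → 2 ^ e < n)
        (trans (sym (suc-pred ⌈log₂ n ⌉ {{>-nonZero 1≤log}})) (cong suc (trans pred≡ (sym (⌈log₂⌈n/2⌉⌉≡⌈log₂n⌉∸1 n))))) p) (twice n))
        where
        pred≡ : pred ⌈log₂ n ⌉ ≡ ⌈log₂ n ⌉ ∸ 1
        pred≡ = pred[n]≡n∸1′ ⌈log₂ n ⌉
          where
          pred[n]≡n∸1′ : ∀ n → pred n ≡ n ∸ 1
          pred[n]≡n∸1′ zero = refl
          pred[n]≡n∸1′ (suc n) = refl
      absurd : ⌈log₂ (2 ^ suc ⌈log₂ half ⌉) ⌉ ≤ ⌈log₂ half ⌉ → ⊥
      absurd q = <-irrefl refl (subst (_≤ ⌈log₂ half ⌉) (⌈log₂2^n⌉≡n (suc ⌈log₂ half ⌉)) q)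

n<2^n : ∀ n → n < 2 ^ n
n<2^n zero    = s≤s z≤n
n<2^n (suc n) = begin-strict
  suc n           ≤⟨ n<2^n n ⟩
  2 ^ n           <⟨ m<m+n (2 ^ n) (≤-trans (0<2^ n) (m≤m+n (2 ^ n) 0)) ⟩
  2 * 2 ^ n       ∎
  where open ≤-Reasoning

module Log (d : ℕ) (2≤d : 2 ≤ d) where

  private
    instance
      d≢0 : NonZero d
      d≢0 = >-nonZero (≤-trans (s≤s z≤n) 2≤d)

  module _ (m : ℕ) where
    ℓ : ℕ → ℕ
    ℓ j = length (filter (λ e → d ^ e <? m) (upTo j))

    initial-segment : ∀ j → ℓ j ≤ j × (∀ i → i < ℓ j → d ^ i < m) × (ℓ j < j → ¬ d ^ ℓ j < m)
    initial-segment zero = z≤n , (λ _ ()) , λ ()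
    initial-segment (suc j) with initial-segment j | d ^ j <? m
    ... | le , below , stop | yes p = subst R (sym ℓ-suc) (≤-refl , (λ i i≤j → ≤-<-trans (^-monoʳ-≤ d (s≤s⁻¹ i≤j)) p) , λ l → ⊥-elim (<-irrefl refl l))
      where
      R = λ l → l ≤ suc j × (∀ i → i < l → d ^ i < m) × (l < suc j → ¬ d ^ l < m)
      ℓ≡j : ℓ j ≡ j
      ℓ≡j with ℓ j <? j
      ... | yes q = ⊥-elim (stop q (≤-<-trans (^-monoʳ-≤ d (<⇒≤ q)) p))
      ... | no q = ≤-antisym le (≮⇒≥ q)
      ℓ-suc : ℓ (suc j) ≡ suc j
      ℓ-suc = trans (cong (λ xs → length (filter (λ e → d ^ e <? m) xs)) (sym (upTo-∷ʳ j)))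
        (trans (cong length (filter-∷ʳ-hit (λ e → d ^ e <? m) (upTo j) p))
        (trans (length-++ (filter (λ e → d ^ e <? m) (upTo j))) (trans (+-comm (ℓ j) 1) (cong suc ℓ≡j))))
    ... | le , below , stop | no p = subst R (sym ℓ-suc) (m≤n⇒m≤1+n le , below , stop′)
      where
      R = λ l → l ≤ suc j × (∀ i → i < l → d ^ i < m) × (l < suc j → ¬ d ^ l < m)
      ℓ-suc : ℓ (suc j) ≡ ℓ j
      ℓ-suc = trans (cong (λ xs → length (filter (λ e → d ^ e <? m) xs)) (sym (upTo-∷ʳ j)))
        (cong length (filter-∷ʳ-miss (λ e → d ^ e <? m) (upTo j) p))
      stop′ : ℓ j < suc j → ¬ d ^ ℓ j < m
      stop′ _ with ℓ j <? j
      ... | yes q = stop q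
      ... | no q = subst (λ l → ¬ d ^ l < m) (sym (≤-antisym le (≮⇒≥ q))) p

    <-log : ∀ i → i < ⌈log[ d ] m ⌉ → d ^ i < m
    <-log = proj₁ (proj₂ (initial-segment m))

    -- If all exponents below `m` are counted, there is no failing exponent to appeal to; then
    -- `m < 2 ^ m ≤ d ^ m` decides.
    ≤-^log : m ≤ d ^ ⌈log[ d ] m ⌉
    ≤-^log with initial-segment m
    ... | le , _ , stop with ⌈log[ d ] m ⌉ <? m
    ...   | yes q = ≮⇒≥ (stop q)
    ...   | no q = subst (λ l → m ≤ d ^ l) (sym (≤-antisym le (≮⇒≥ q))) (<⇒≤ (<-≤-trans (n<2^n m) (^-monoˡ-≤ m 2≤d)))

*-^-distrib : ∀ p x y → (x * y) ^ p ≡ x ^ p * y ^ p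
*-^-distrib zero    x y = refl
*-^-distrib (suc p) x y = trans (cong (x * y *_) (*-^-distrib p x y)) (lem x y (x ^ p) (y ^ p))
  where
  lem : ∀ x y a b → x * y * (a * b) ≡ x * a * (y * b)
  lem = solve-∀

-- The hypothesis ε < 1/3 makes a word hold d³ bits.

cube-≤ : ∀ ε K d n → 0ℚ <ℚ ε → ε <ℚ ℤ.+ 1 / 3 → 1 ≤ d → d ≤[ K ]·log^[ ε ] n → d * d * d ≤ K * log₂ n
cube-≤ ε@(mkℚ (ℤ.+ p) q-1 _) K d n (*<* 0<ε) (*<* ε<⅓) 1≤d le with d * d * d ≤? K * log₂ n
... | yes r = r
-- Comparing `p`-th powers avoids the real power of the logarithm: `ε < 1/3` becomes `3 * p ≤ q`,
-- and `K ≤ K ^ p` brings `K` under the exponent.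
... | no r = ⊥-elim (<⇒≱ (^-monoˡ-< p (≰⇒> r)) (begin
    (d * d * d) ^ p      ≡⟨ cong (_^ p) (trans (*-assoc d d d) (cong (λ z → d * (d * z)) (sym (*-identityʳ d)))) ⟩
    (d ^ 3) ^ p          ≡⟨ ^-*-assoc d 3 p ⟩
    d ^ (3 * p)          ≤⟨ ^-monoʳ-≤ d {{>-nonZero 1≤d}} 3p≤q ⟩
    d ^ suc q-1          ≤⟨ le ⟩
    K * log₂ n ^ p       ≤⟨ *-monoˡ-≤ (log₂ n ^ p) (K≤ K) ⟩
    K ^ p * log₂ n ^ p   ≡⟨ *-^-distrib p K (log₂ n) ⟨
    (K * log₂ n) ^ p     ∎))
  where
  open ≤-Reasoning
  0<p : 0 < p
  0<p = ℤ.drop‿+<+ (subst₂ ℤ._<_ refl (ℤ.*-identityʳ (ℤ.+ p)) 0<ε)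
  instance
    p≢0 : NonZero p
    p≢0 = >-nonZero 0<p
  3p≤q : 3 * p ≤ suc q-1
  3p≤q = subst (_≤ suc q-1) (*-comm p 3) (<⇒≤ (ℤ.drop‿+<+ (subst₂ ℤ._<_ (sym (ℤ.pos-* p 3)) (ℤ.*-identityˡ (ℤ.+ suc q-1)) ε<⅓)))
  K≤ : ∀ K → K ≤ K ^ p
  K≤ zero    = z≤n
  K≤ (suc K) = ≤-trans (≤-reflexive (sym (*-identityʳ (suc K)))) (^-monoʳ-≤ (suc K) 0<p)
cube-≤ (mkℚ (ℤ.-[1+ p ]) q-1 _) K d n (*<* ()) ε<⅓ 1≤d le

-- With `x = κ log n` this puts the word length below `u`. It fails at 7, one reason for the summand
-- 8 in `κ`.
20x<2^x : ∀ x → 8 ≤ x → 20 * x < 2 ^ x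
20x<2^x x 8≤x = subst (λ x → 20 * x < 2 ^ x) (m+[n∸m]≡n 8≤x) (from (x ∸ 8))
  where
  from : ∀ y → 20 * (8 + y) < 2 ^ (8 + y)
  from zero = ≤ᵇ⇒≤ 161 256 _
  from (suc y) = begin-strict
    20 * (9 + y)                  ≡⟨ lem₁ y ⟩
    20 * (8 + y) + 20             <⟨ +-mono-<-≤ (from y) (≤-trans (≤ᵇ⇒≤ 20 (2 ^ 8) _) (^-monoʳ-≤ 2 (m≤m+n 8 y))) ⟩
    2 ^ (8 + y) + 2 ^ (8 + y)     ≡⟨ lem₂ (2 ^ (8 + y)) ⟩
    2 * 2 ^ (8 + y)               ∎
    where
    open ≤-Reasoning
    lem₁ : ∀ y → 20 * (9 + y) ≡ 20 * (8 + y) + 20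
    lem₁ = solve-∀
    lem₂ : ∀ x → x + x ≡ 2 * x
    lem₂ = solve-∀

square-≤ : ∀ L → suc L * suc L ≤ 4 * 2 ^ L
square-≤ 0 = ≤ᵇ⇒≤ 1 4 _
square-≤ 1 = ≤ᵇ⇒≤ 4 8 _
square-≤ 2 = ≤ᵇ⇒≤ 9 16 _
square-≤ (suc (suc (suc L))) = begin
  (4 + L) * (4 + L)                   ≤⟨ m≤m+n _ (L * L + 4 * L + 2) ⟩
  (4 + L) * (4 + L) + (L * L + 4 * L + 2) ≡⟨ lem₁ L ⟩
  2 * ((3 + L) * (3 + L))             ≤⟨ *-monoʳ-≤ 2 (square-≤ (suc (suc L))) ⟩
  2 * (4 * 2 ^ (2 + L))               ≡⟨ lem₂ (2 ^ (2 + L)) ⟩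
  4 * 2 ^ (3 + L)                     ∎
  where
  open ≤-Reasoning
  lem₁ : ∀ L → (4 + L) * (4 + L) + (L * L + 4 * L + 2) ≡ 2 * ((3 + L) * (3 + L))
  lem₁ = solve-∀
  lem₂ : ∀ x → 2 * (4 * x) ≡ 4 * (2 * x)
  lem₂ = solve-∀

-- The padding of the last chunk is `d log n`, at most a constant times `log² n`; by this bound O(n)
-- work pays for it even when `n` is smaller than a chunk.
log₂²-≤ : ∀ n → 1 ≤ n → log₂ n * log₂ n ≤ 4 * n
log₂²-≤ n 1≤n with ⌈log₂ n ⌉ in eq
... | zero  = ≤-trans (≤ᵇ⇒≤ 1 4 _) (*-monoʳ-≤ 4 1≤n)
... | suc l = ≤-trans (square-≤ l) (*-monoʳ-≤ 4 (<⇒≤ (<-⌈log₂⌉ n l (subst (l <_) (sym eq) ≤-refl))))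

1⊔ : ∀ x → x + (1 ∸ x) ≡ 1 ⊔ x
1⊔ zero    = refl
1⊔ (suc x) = trans (cong (suc x +_) (0∸n≡0 x)) (+-identityʳ (suc x))

-- The program

-- Registers of the main thread:
--   0 n   1 σ   2 d   3 L = log n   4 k = log d   5 word size   6 M
--   7 d L   8 d + 1   9 2^d - 1   10 Q = d^(h-l)   11 B, the base of level l
--   12 Q / d   13 B + 2M   14 B + 4M   15 current scan array   16 S
--   17 distance and 18 rounds left of the scan   19 number of threads
-- Threads have their index in register 20 and use 21, …, 29.
-- Level l occupies the cells from B on, in arrays of M cells each:
--   0 symbols   1 nodes   2 counters within blocks of d   3 block totals
--   4 counters within chunks of d L   5 scans over chunks, S cells per round
--   6 packed digits   7 child tables   8 inverse of the sorting permutation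

‵G ‵N : Exp → Exp → Exp
‵G c x =
  (! ($ 15 +ᵉ ((x /ᵉ $ 7) *ᵉ $ 8 +ᵉ c)) +ᵉ ! ($ 14 +ᵉ ((x /ᵉ $ 2) *ᵉ $ 8 +ᵉ c)))
  +ᵉ (((! ($ 13 +ᵉ x)) %ᵉ (‵ 1 ≪ᵉ (c *ᵉ $ 2))) %ᵉ $ 9)
‵N c x = (‵G c ($ 0) +ᵉ ‵G (c +ᵉ ‵ 1) x) ∸ᵉ ‵G c x

‵dig : Exp → Exp
‵dig x = ((! ($ 11 +ᵉ x)) /ᵉ $ 12) %ᵉ $ 2

countPre countBody countPost countBlocks : Cmd
countPre = 21 ⇐ ‵ 0 ⨾ 22 ⇐ $ 20 *ᵉ $ 2 ⨾ 23 ⇐ $ 2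
countBody =
  ($ 13 +ᵉ $ 22 ↦ $ 21) ⨾
  21 ⇐ $ 21 +ᵉ (‵ 1 ≪ᵉ (‵dig ($ 22) *ᵉ $ 2)) ⨾
  22 ⇐ $ 22 +ᵉ ‵ 1 ⨾
  23 ⇐ $ 23 ∸ᵉ ‵ 1
countPost = ($ 11 +ᵉ $ 6 *ᵉ ‵ 3) +ᵉ $ 20 ↦ $ 21
countBlocks = countPre ⨾ while 23 countBody ⨾ countPost

-- A thread serves one pair of a chunk and a bound and walks over the `log n` blocks of the chunk.
-- Its total goes one row further down, so that after the scan a row counts what precedes its chunk;
-- row 0 is set to zero by the threads of every chunk alike.
chunkPre chunkBody chunkPost countChunks : Cmd
chunkPre = 21 ⇐ $ 20 /ᵉ $ 8 ⨾ 22 ⇐ $ 20 %ᵉ $ 8 ⨾ 23 ⇐ ‵ 0 ⨾ 24 ⇐ $ 21 *ᵉ $ 3 ⨾ 25 ⇐ $ 3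
chunkBody =
  ($ 14 +ᵉ ($ 24 *ᵉ $ 8 +ᵉ $ 22) ↦ $ 23) ⨾
  23 ⇐ $ 23 +ᵉ (((! (($ 11 +ᵉ $ 6 *ᵉ ‵ 3) +ᵉ $ 24)) %ᵉ (‵ 1 ≪ᵉ ($ 22 *ᵉ $ 2))) %ᵉ $ 9) ⨾
  24 ⇐ $ 24 +ᵉ ‵ 1 ⨾
  25 ⇐ $ 25 ∸ᵉ ‵ 1
chunkPost =
  ($ 15 +ᵉ (($ 21 +ᵉ ‵ 1) *ᵉ $ 8 +ᵉ $ 22) ↦ $ 23) ⨾
  ($ 15 +ᵉ $ 22 ↦ ‵ 0)
countChunks = chunkPre ⨾ while 25 chunkBody ⨾ chunkPost

-- A doubling round: each row adds the row `$ 17` places earlier. A comparison used as a factor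
-- replaces the branch, and truncated subtraction keeps the address inside the array if there is no
-- such row. Each round fills a fresh array, so no thread reads what another one writes.
scanRound : Cmd
scanRound =
  ($ 15 +ᵉ $ 16) +ᵉ $ 20 ↦
    ! ($ 15 +ᵉ $ 20) +ᵉ
    ! ($ 15 +ᵉ ($ 20 ∸ᵉ $ 17 *ᵉ $ 8)) *ᵉ ($ 17 <ᵉ (($ 20 /ᵉ $ 8) +ᵉ ‵ 1))

‵rec : Exp → Exp → Exp → Exp
‵rec B π f = B +ᵉ ($ 6 +ᵉ (π *ᵉ ‵ 16 +ᵉ f))

-- Thread `x` produces word `x - lo` of its node, from the last entry down by Horner's rule. A node
-- of `m` entries owns `m` words, enough because `k ≤ w`; so all nodes of a level share one array
-- without overlap.
packPre packBody packPost pack : Cmd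
packPre =
  28 ⇐ (! ($ 11 +ᵉ $ 20)) /ᵉ $ 10 ⨾
  21 ⇐ ! (‵rec ($ 11) ($ 28) (‵ 3)) ⨾
  22 ⇐ ! (‵rec ($ 11) ($ 28) (‵ 0)) ⨾
  23 ⇐ $ 20 ∸ᵉ $ 21 ⨾
  24 ⇐ ($ 23 *ᵉ $ 5) /ᵉ $ 4 ⨾
  25 ⇐ ($ 22 ∸ᵉ ($ 22 ∸ᵉ ((($ 23 *ᵉ $ 5) +ᵉ $ 5) /ᵉ $ 4 +ᵉ ‵ 1))) ∸ᵉ ($ 24 +ᵉ ‵ 1) ⨾
  26 ⇐ ($ 21 +ᵉ $ 24) +ᵉ $ 25 ⨾
  27 ⇐ ‵ 0
packBody =
  27 ⇐ ($ 27 ≪ᵉ $ 4) +ᵉ ‵dig ($ 26) ⨾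
  26 ⇐ $ 26 ∸ᵉ ‵ 1 ⨾
  25 ⇐ $ 25 ∸ᵉ ‵ 1
packPost =
  ($ 11 +ᵉ $ 6 *ᵉ ‵ 6) +ᵉ $ 20 ↦
    ($ 27 ≪ᵉ ($ 4 ∸ᵉ (($ 23 *ᵉ $ 5) %ᵉ $ 4))) +ᵉ (‵dig ($ 26) /ᵉ (‵ 1 ≪ᵉ (($ 23 *ᵉ $ 5) %ᵉ $ 4)))
pack = packPre ⨾ while 25 packBody ⨾ packPost

-- Clearing `n` cells suffices: where a further level exists, prefixes with one more digit have
-- values below `d ^ (l + 1) < σ ≤ n`.
clear : Cmd
clear = ($ 11 +ᵉ $ 6 *ᵉ ‵ 7) +ᵉ $ 20 ↦ ‵ 0

-- The node with prefix value $ 28 of the level at $ 29, on [$ 26, $ 27)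

field! : ℕ → Exp → Cmd
field! f e = ‵rec ($ 29) ($ 28) (‵ f) ↦ e

-- Fields 0 to 2 are those of the required format, 3 and 4 delimit the interval. A query is given
-- nothing but the node, so every node repeats the parameters of its level in the other fields.
writeNode : Cmd
writeNode =
  field! 0 ($ 27 ∸ᵉ $ 26) ⨾
  field! 1 (($ 29 +ᵉ $ 6 *ᵉ ‵ 6) +ᵉ $ 26) ⨾
  field! 2 (($ 29 +ᵉ $ 6 *ᵉ ‵ 7) +ᵉ $ 28 *ᵉ $ 2) ⨾
  field! 3 ($ 26) ⨾
  field! 4 ($ 27) ⨾
  field! 5 ($ 2) ⨾
  field! 6 ($ 7) ⨾
  field! 7 ($ 29 +ᵉ $ 6 *ᵉ ‵ 2) ⨾
  field! 8 ($ 29 +ᵉ $ 6 *ᵉ ‵ 4) ⨾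
  field! 9 (($ 29 +ᵉ $ 6 *ᵉ ‵ 5) +ᵉ $ 3 *ᵉ $ 16) ⨾
  field! 10 ($ 29 +ᵉ $ 6 *ᵉ ‵ 8) ⨾
  field! 11 ($ 0)

-- Every symbol writes the record of the child it moves to. So exactly the nonempty children are
-- created, possibly by many threads, all of which write the same record.
scatterPre scatterPost scatter : Cmd
scatterPre =
  21 ⇐ ! ($ 11 +ᵉ $ 20) ⨾
  22 ⇐ ($ 21 /ᵉ $ 12) %ᵉ $ 2 ⨾
  23 ⇐ ! (‵rec ($ 11) ($ 21 /ᵉ $ 10) (‵ 3)) ⨾
  24 ⇐ ! (‵rec ($ 11) ($ 21 /ᵉ $ 10) (‵ 4)) ⨾
  25 ⇐ ‵N ($ 22) ($ 20) ⨾
  26 ⇐ ‵N ($ 22) ($ 23) ⨾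
  27 ⇐ ‵N ($ 22) ($ 24) ⨾
  28 ⇐ $ 21 /ᵉ $ 12 ⨾
  29 ⇐ $ 11 +ᵉ $ 6 *ᵉ ‵ 16
scatterPost =
  (($ 11 +ᵉ $ 6 *ᵉ ‵ 8) +ᵉ $ 25 ↦ $ 20) ⨾
  ($ 29 +ᵉ $ 25 ↦ $ 21) ⨾
  (($ 11 +ᵉ $ 6 *ᵉ ‵ 7) +ᵉ $ 28 ↦ ‵rec ($ 29) ($ 28) (‵ 0)) ⨾
  writeNode
scatter = scatterPre ⨾ scatterPost

level : Cmd
level =
  12 ⇐ $ 10 /ᵉ $ 2 ⨾
  13 ⇐ $ 11 +ᵉ $ 6 *ᵉ ‵ 2 ⨾
  14 ⇐ $ 11 +ᵉ $ 6 *ᵉ ‵ 4 ⨾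
  15 ⇐ $ 11 +ᵉ $ 6 *ᵉ ‵ 5 ⨾
  17 ⇐ ‵ 1 ⨾
  18 ⇐ $ 3 ⨾
  19 ⇐ ($ 0 /ᵉ $ 7 +ᵉ ‵ 1) *ᵉ $ 3 ⨾
  pardo 20 19 countBlocks ⨾
  19 ⇐ ($ 0 /ᵉ $ 7 +ᵉ ‵ 1) *ᵉ $ 8 ⨾
  pardo 20 19 countChunks ⨾
  19 ⇐ ($ 0 /ᵉ $ 7 +ᵉ ‵ 2) *ᵉ $ 8 ⨾
  while 18 (
    pardo 20 19 scanRound ⨾
    15 ⇐ $ 15 +ᵉ $ 16 ⨾
    17 ⇐ $ 17 *ᵉ ‵ 2 ⨾
    18 ⇐ $ 18 ∸ᵉ ‵ 1) ⨾
  pardo 20 0 pack ⨾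
  pardo 20 0 clear ⨾
  pardo 20 0 scatter ⨾
  10 ⇐ $ 12 ⨾
  11 ⇐ $ 11 +ᵉ $ 6 *ᵉ ‵ 16 ⨾
  37 ⇐ ‵ 1 <ᵉ $ 10

-- The powers of $ 34 below $ 35: $ 33 is their number and $ 32 the next one.

powers : Cmd
powers =
  32 ⇐ ‵ 1 ⨾ 33 ⇐ ‵ 0 ⨾ 36 ⇐ $ 32 <ᵉ $ 35 ⨾
  while 36 (32 ⇐ $ 32 *ᵉ $ 34 ⨾ 33 ⇐ $ 33 +ᵉ ‵ 1 ⨾ 36 ⇐ $ 32 <ᵉ $ 35)

initial : Cmd
initial =
  ($ 11 +ᵉ $ 20 ↦ ! ($ 20)) ⨾
  26 ⇐ ‵ 0 ⨾ 27 ⇐ $ 0 ⨾ 28 ⇐ ‵ 0 ⨾ 29 ⇐ $ 11 ⨾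
  writeNode

-- Registers 6 and 16 become `u ^ 8` and `u ^ 6` for `u = 2 ^ (κ log n)`, the spacing of arrays and
-- of the rounds of a scan.
prepare : ℕ → ℕ → Cmd
prepare κ wf =
  34 ⇐ ‵ 2 ⨾ 35 ⇐ $ 0 ⨾ powers ⨾
  3 ⇐ $ 33 +ᵉ (‵ 1 ∸ᵉ $ 33) ⨾
  35 ⇐ $ 2 ⨾ powers ⨾
  4 ⇐ $ 33 ⨾
  34 ⇐ $ 2 ⨾ 35 ⇐ $ 1 ⨾ powers ⨾
  10 ⇐ $ 32 ⨾
  5 ⇐ ‵ wf *ᵉ $ 3 ⨾
  6 ⇐ ‵ 1 ≪ᵉ ($ 3 *ᵉ ‵ κ *ᵉ ‵ 8) ⨾
  16 ⇐ ‵ 1 ≪ᵉ ($ 3 *ᵉ ‵ κ *ᵉ ‵ 6) ⨾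
  7 ⇐ $ 2 *ᵉ $ 3 ⨾
  8 ⇐ $ 2 +ᵉ ‵ 1 ⨾
  9 ⇐ (‵ 1 ≪ᵉ $ 2) ∸ᵉ ‵ 1 ⨾
  11 ⇐ $ 6 ⨾
  37 ⇐ ‵ 1 <ᵉ $ 10 ⨾
  30 ⇐ $ 11 +ᵉ $ 6

opaque
  construct : ℕ → ℕ → Cmd
  construct κ wf =
    prepare κ wf ⨾
    pardo 20 0 initial ⨾
    while 37 level ⨾
    0 ⇐ $ 30

-- The queries load the parameters of the level from the node.

loadLevel : Cmd
loadLevel =
  20 ⇐ $ 0 ⨾ 21 ⇐ $ 1 ⨾ 22 ⇐ $ 2 ⨾
  23 ⇐ ! ($ 20 +ᵉ ‵ 3) ⨾
  2 ⇐ ! ($ 20 +ᵉ ‵ 5) ⨾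
  7 ⇐ ! ($ 20 +ᵉ ‵ 6) ⨾
  8 ⇐ $ 2 +ᵉ ‵ 1 ⨾
  9 ⇐ (‵ 1 ≪ᵉ $ 2) ∸ᵉ ‵ 1 ⨾
  13 ⇐ ! ($ 20 +ᵉ ‵ 7) ⨾
  14 ⇐ ! ($ 20 +ᵉ ‵ 8) ⨾
  15 ⇐ ! ($ 20 +ᵉ ‵ 9) ⨾
  0 ⇐ ! ($ 20 +ᵉ ‵ 11)

rankQuery selectQuery : Cmd
rankQuery =
  loadLevel ⨾
  0 ⇐ ‵G ($ 21 +ᵉ ‵ 1) (($ 23 +ᵉ $ 22) +ᵉ ‵ 1) ∸ᵉ ‵G ($ 21 +ᵉ ‵ 1) ($ 23)
selectQuery =
  loadLevel ⨾
  24 ⇐ ! ($ 20 +ᵉ ‵ 10) ⨾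
  0 ⇐ ! ($ 24 +ᵉ ((‵N ($ 21) ($ 23) +ᵉ $ 22) ∸ᵉ ‵ 1)) ∸ᵉ $ 23

-- Operation counts

-- Counts the operations of straight-line code, the only code it is applied to. On the program texts
-- below it computes to numerals.
seqCost : Cmd → ℕ
seqCost (c ⨾ c′) = seqCost c + seqCost c′
seqCost _        = 1

costBlocks costChunks costRound restRound costPack costScatter costInit endCost : ℕ
costBlocks  = seqCost countPre + suc (seqCost countBody) + suc (seqCost countPost)
costChunks  = seqCost chunkPre + suc (seqCost chunkBody) + suc (seqCost chunkPost)
costRound   = seqCost scanRound
restRound   = seqCost (15 ⇐ $ 15 +ᵉ $ 16 ⨾ 17 ⇐ $ 17 *ᵉ ‵ 2 ⨾ 18 ⇐ $ 18 ∸ᵉ ‵ 1)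
costPack    = seqCost packPre + suc (seqCost packBody) + suc (seqCost packPost)
costScatter = seqCost scatter
costInit    = seqCost initial
endCost     = seqCost (0 ⇐ $ 30)

pre mid₁ mid₂ post : ℕ
pre  = seqCost (12 ⇐ $ 10 /ᵉ $ 2 ⨾ 13 ⇐ $ 11 +ᵉ $ 6 *ᵉ ‵ 2 ⨾ 14 ⇐ $ 11 +ᵉ $ 6 *ᵉ ‵ 4 ⨾ 15 ⇐ $ 11 +ᵉ $ 6 *ᵉ ‵ 5 ⨾
                17 ⇐ ‵ 1 ⨾ 18 ⇐ $ 3 ⨾ 19 ⇐ ($ 0 /ᵉ $ 7 +ᵉ ‵ 1) *ᵉ $ 3)
mid₁ = seqCost (19 ⇐ ($ 0 /ᵉ $ 7 +ᵉ ‵ 1) *ᵉ $ 8)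
mid₂ = seqCost (19 ⇐ ($ 0 /ᵉ $ 7 +ᵉ ‵ 2) *ᵉ $ 8)
post = seqCost (10 ⇐ $ 12 ⨾ 11 ⇐ $ 11 +ᵉ $ 6 *ᵉ ‵ 16 ⨾ 37 ⇐ ‵ 1 <ᵉ $ 10)

powersPre powersStep : ℕ
powersPre  = seqCost (32 ⇐ ‵ 1 ⨾ 33 ⇐ ‵ 0 ⨾ 36 ⇐ $ 32 <ᵉ $ 35)
powersStep = suc (seqCost (32 ⇐ $ 32 *ᵉ $ 34 ⨾ 33 ⇐ $ 33 +ᵉ ‵ 1 ⨾ 36 ⇐ $ 32 <ᵉ $ 35))

prep₁ prep₂ prep₃ prep₄ : ℕ
prep₁ = seqCost (34 ⇐ ‵ 2 ⨾ 35 ⇐ $ 0)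
prep₂ = seqCost (3 ⇐ $ 33 +ᵉ (‵ 1 ∸ᵉ $ 33) ⨾ 35 ⇐ $ 2)
prep₃ = seqCost (4 ⇐ $ 33 ⨾ 34 ⇐ $ 2 ⨾ 35 ⇐ $ 1)
prep₄ = seqCost (
  10 ⇐ $ 32 ⨾
  -- Zeros stand for `wf` and `κ`, as the value of a literal does not affect the count.
  5 ⇐ ‵ 0 *ᵉ $ 3 ⨾
  6 ⇐ ‵ 1 ≪ᵉ ($ 3 *ᵉ ‵ 0 *ᵉ ‵ 8) ⨾
  16 ⇐ ‵ 1 ≪ᵉ ($ 3 *ᵉ ‵ 0 *ᵉ ‵ 6) ⨾
  7 ⇐ $ 2 *ᵉ $ 3 ⨾
  8 ⇐ $ 2 +ᵉ ‵ 1 ⨾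
  9 ⇐ (‵ 1 ≪ᵉ $ 2) ∸ᵉ ‵ 1 ⨾
  11 ⇐ $ 6 ⨾
  37 ⇐ ‵ 1 <ᵉ $ 10 ⨾
  30 ⇐ $ 11 +ᵉ $ 6)

record Params (w u : ℕ) : Set where
  field
    n k : ℕ

  d : ℕ
  d = 2 ^ k

  L : ℕ
  L = log₂ n

  field
    M S : ℕ
    1≤n     : 1 ≤ n
    n<u     : n < u
    2≤d     : 2 ≤ d
    d<u     : d < u
    1≤L     : 1 ≤ L
    L<u     : L < u
    1≤k     : 1 ≤ k
    w<u     : w < u
    k≤w     : k ≤ w
    n≤2^L   : n ≤ 2 ^ L
    2^L<u   : 2 ^ L < u
    -- Room for `d` counters of `d` bits each.
    2^dd<u  : 2 ^ (d * d) < u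
    M≡u^8   : M ≡ u ^ 8
    S≡u^6   : S ≡ u ^ 6

-- Sums, addresses and shifted words

sumUpTo-const : ∀ c n → sumUpTo (λ _ → c) n ≡ n * c
sumUpTo-const c zero    = refl
sumUpTo-const c (suc n) = cong (c +_) (sumUpTo-const c n)

linear : ∀ p q r c → p + q + r ≤ c → ∀ {x} → 1 ≤ x → p + (x * q + r) ≤ c * x
linear p q r c le {x} 1≤x = begin
  p + (x * q + r)              ≡⟨ cong₂ (λ a b → a + (x * q + b)) (sym (*-identityʳ p)) (sym (*-identityʳ r)) ⟩
  p * 1 + (x * q + r * 1)      ≤⟨ +-mono-≤ (*-monoʳ-≤ p 1≤x) (+-monoʳ-≤ (x * q) (*-monoʳ-≤ r 1≤x)) ⟩
  p * x + (x * q + r * x)      ≡⟨ lem p q r x ⟩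
  (p + q + r) * x              ≤⟨ *-monoˡ-≤ x le ⟩
  c * x                        ∎
  where
  open ≤-Reasoning
  lem : ∀ p q r x → p * x + (x * q + r * x) ≡ (p + q + r) * x
  lem = solve-∀

≤-num : ∀ {m n} {_ : T (m ≤ᵇ n)} → m ≤ n
≤-num {m} {n} {p} = ≤ᵇ⇒≤ m n p

∸-suc : ∀ m i → m ∸ i ∸ 1 ≡ m ∸ suc i
∸-suc m i = trans (∸-+-assoc m i 1) (cong (m ∸_) (+-comm i 1))

-- Decoding of the addresses B + M * t + i with i < M

decode : ℕ → ℕ → (ℕ → ℕ → ℕ) → ℕ → ℕ
decode B M V α = V ((α ∸ B) ÷ M) ((α ∸ B) ﹪ M)

decode-≡ : ∀ B M V t {i} → i < M → decode B M V (B + M * t + i) ≡ V t i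
decode-≡ B M V t {i} i<M = cong₂ V
  (trans (cong (_÷ M) e) (÷-unique t i<M)) (trans (cong (_﹪ M) e) (﹪-unique t i<M))
  where
  e : B + M * t + i ∸ B ≡ t * M + i
  e = trans (cong (_∸ B) (+-assoc B (M * t) i)) (trans (m+n∸m≡n B _) (cong (_+ i) (*-comm M t)))

stream-cong : ∀ k {f g : ℕ → ℕ} m → (∀ t → f t ≡ g t) → stream k f m ≡ stream k g m
stream-cong k zero    e = refl
stream-cong k (suc m) e = cong₂ (λ x y → x * 2 ^ k + y) (stream-cong k m (e ∘ suc)) (e 0)

-- Shifting left by y and filling in z, on w-bit words

mod-shift : ∀ {w y z} A → y ≤ w → z < 2 ^ y → (A ﹪ 2 ^ w) * 2 ^ y ﹪ 2 ^ w + z ≡ (A * 2 ^ y + z) ﹪ 2 ^ w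
mod-shift {w} {y} {z} A y≤w z< = begin
  R * 2 ^ y ﹪ 2 ^ w + z         ≡⟨ cong (λ x → x ﹪ 2 ^ w + z) R-split ⟩
  (R ÷ T₁ * 2 ^ w + r * 2 ^ y) ﹪ 2 ^ w + z  ≡⟨ cong (_+ z) (﹪-unique (R ÷ T₁) (≤-<-trans (m≤m+n _ z) small)) ⟩
  r * 2 ^ y + z                  ≡⟨ ﹪-unique (A ÷ 2 ^ w * 2 ^ y + R ÷ T₁) small ⟨
  ((A ÷ 2 ^ w * 2 ^ y + R ÷ T₁) * 2 ^ w + (r * 2 ^ y + z)) ﹪ 2 ^ w ≡⟨ cong (_﹪ 2 ^ w) A-split ⟨
  (A * 2 ^ y + z) ﹪ 2 ^ w       ∎
  where
  open ≡-Reasoning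
  T₁ = 2 ^ (w ∸ y)
  R = A ﹪ 2 ^ w
  r = R ﹪ T₁
  2^w≡ : 2 ^ w ≡ T₁ * 2 ^ y
  2^w≡ = trans (cong (2 ^_) (sym (m∸n+n≡m y≤w))) (^-distribˡ-+-* 2 (w ∸ y) y)
  small : r * 2 ^ y + z < 2 ^ w
  small = subst (r * 2 ^ y + z <_) (sym 2^w≡) (<-≤-trans (+-monoʳ-< (r * 2 ^ y) z<)
    (subst (_≤ T₁ * 2 ^ y) (+-comm (2 ^ y) (r * 2 ^ y)) (*-monoˡ-≤ (2 ^ y) (﹪-< R (0<2^ (w ∸ y))))))
  R-split : R * 2 ^ y ≡ R ÷ T₁ * 2 ^ w + r * 2 ^ y
  R-split = trans (cong (_* 2 ^ y) (÷-﹪ R (0<2^ (w ∸ y))))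
    (trans (lem (R ÷ T₁) T₁ r (2 ^ y)) (cong (λ x → R ÷ T₁ * x + r * 2 ^ y) (sym 2^w≡)))
    where
    lem : ∀ q t r p → (q * t + r) * p ≡ q * (t * p) + r * p
    lem = solve-∀
  A-split : A * 2 ^ y + z ≡ (A ÷ 2 ^ w * 2 ^ y + R ÷ T₁) * 2 ^ w + (r * 2 ^ y + z)
  A-split = trans (cong (λ x → x * 2 ^ y + z) (÷-﹪ A (0<2^ w)))
    (trans (lem₁ (A ÷ 2 ^ w) (2 ^ w) R (2 ^ y) z)
    (trans (cong (λ x → A ÷ 2 ^ w * 2 ^ y * 2 ^ w + x + z) R-split) (lem₂ (A ÷ 2 ^ w * 2 ^ y) (R ÷ T₁) (2 ^ w) (r * 2 ^ y) z)))
    where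
    lem₁ : ∀ q t r p z → (q * t + r) * p + z ≡ q * p * t + r * p + z
    lem₁ = solve-∀
    lem₂ : ∀ x y t r z → x * t + (y * t + r) + z ≡ (x + y) * t + (r + z)
    lem₂ = solve-∀

sum-telescope : ∀ (f Φ : ℕ → ℕ) n → (∀ y → y < n → f y + Φ y ≤ Φ (suc y)) → sumUpTo f n + Φ 0 ≤ Φ n
sum-telescope f Φ zero    h = ≤-refl
sum-telescope f Φ (suc n) h = begin
  f 0 + sumUpTo (f ∘ suc) n + Φ 0   ≡⟨ lem (f 0) (sumUpTo (f ∘ suc) n) (Φ 0) ⟩
  sumUpTo (f ∘ suc) n + (f 0 + Φ 0) ≤⟨ +-monoʳ-≤ _ (h 0 (s≤s z≤n)) ⟩
  sumUpTo (f ∘ suc) n + Φ 1         ≤⟨ sum-telescope (f ∘ suc) (Φ ∘ suc) n (λ y y< → h (suc y) (s≤s y<)) ⟩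
  Φ (suc n)                         ∎
  where
  open ≤-Reasoning
  lem : ∀ a b c → a + b + c ≡ b + (a + c)
  lem = solve-∀

sumUpTo-affine : ∀ p q r (f : ℕ → ℕ) n → sumUpTo (λ y → p + (f y * q + r)) n ≡ n * (p + r) + sumUpTo f n * q
sumUpTo-affine p q r f zero    = refl
sumUpTo-affine p q r f (suc n) = trans (cong (p + (f 0 * q + r) +_) (sumUpTo-affine p q r (f ∘ suc) n))
  (lem p q r (f 0) n (sumUpTo (f ∘ suc) n))
  where
  lem : ∀ p q r x n s → p + (x * q + r) + (n * (p + r) + s * q) ≡ p + r + n * (p + r) + (x + s) * q
  lem = solve-∀

-- Levels as sorted sequences

filter-∘ : ∀ {P P′ P″ : ℕ → Set} (P? : Decidable P) (P′? : Decidable P′) (P″? : Decidable P″) →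
  (∀ {x} → P x → P′ x → P″ x) → (∀ {x} → P″ x → P x) → (∀ {x} → P″ x → P′ x) →
  ∀ xs → filter P′? (filter P? xs) ≡ filter P″? xs
filter-∘ P? P′? P″? f g h [] = refl
filter-∘ P? P′? P″? f g h (x ∷ xs) with filter-∘ P? P′? P″? f g h xs | P? x | P′? x
... | ih | yes p | yes q = trans (filter-accept P′? q) (trans (cong (x ∷_) ih) (sym (filter-accept P″? (f p q))))
... | ih | yes p | no ¬q = trans (filter-reject P′? ¬q) (trans ih (sym (filter-reject P″? (¬q ∘ h))))
... | ih | no ¬p | _ = trans ih (sym (filter-reject P″? (¬p ∘ g)))

-- The quotient by `Q` and the next digit determine the quotient by `Q′`, and conversely: filtering
-- by a digit lengthens the prefix by one.
filter-filter : ∀ Q Q′ d xs → 0 < d → Q ≡ Q′ * d → ∀ s →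
  filter (λ x → (x ÷ Q′) ﹪ d ≟ (s ÷ Q′) ﹪ d) (filter (λ x → x ÷ Q ≟ s ÷ Q) xs) ≡ filter (λ x → x ÷ Q′ ≟ s ÷ Q′) xs
filter-filter Q Q′ d xs 0<d Q≡ s = filter-∘ _ _ _
  (λ {x} p q → trans (÷-﹪ (x ÷ Q′) 0<d) (trans (cong₂ (λ a b → a * d + b)
    (trans (parent x) (trans p (sym (parent s)))) q) (sym (÷-﹪ (s ÷ Q′) 0<d))))
  (λ {x} r → trans (sym (parent x)) (trans (cong (_÷ d) r) (parent s)))
  (cong (_﹪ d)) xs
  where
  parent : ∀ x → x ÷ Q′ ÷ d ≡ x ÷ Q
  parent x = trans (÷-÷ x Q′ d) (cong (x ÷_) (sym Q≡))

-- The sequence a is a permutation of syms in which the symbols with prefix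
-- value π = s ÷ Q are the entries from lo π to hi π, in the original order.

record Content (n : ℕ) (syms : List ℕ) (a lo hi : ℕ → ℕ) (Q : ℕ) : Set where
  field
    a∈     : ∀ x → x < n → a x ∈ syms
    lo≤    : ∀ x → x < n → lo (a x ÷ Q) ≤ x
    <hi    : ∀ x → x < n → x < hi (a x ÷ Q)
    hi≤n   : ∀ s → s ∈ syms → hi (s ÷ Q) ≤ n
    slices : ∀ s → s ∈ syms → slice a (lo (s ÷ Q)) (hi (s ÷ Q) ∸ lo (s ÷ Q)) ≡ filter (λ x → x ÷ Q ≟ s ÷ Q) syms

  onto : ∀ s → s ∈ syms → ∃ λ x → x < n × a x ≡ s
  onto s s∈ with ∈-applyUpTo⁻ (λ t → a (lo (s ÷ Q) + t)) (subst (s ∈_) (sym (slices s s∈)) (∈-filter⁺ (λ x → x ÷ Q ≟ s ÷ Q) s∈ refl))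
  ... | t , t< , e = lo (s ÷ Q) + t , <-≤-trans inside (hi≤n s s∈) , sym e
    where
    inside : lo (s ÷ Q) + t < hi (s ÷ Q)
    inside = subst (_< hi (s ÷ Q)) (+-comm t _) (m<n∸o⇒m+o<n {t} {hi (s ÷ Q)} {lo (s ÷ Q)} t<)
      where
      m<n∸o⇒m+o<n : ∀ {m n o} → m < n ∸ o → m + o < n
      m<n∸o⇒m+o<n {m} {n} {o} p = subst (suc (m + o) ≤_) (m∸n+n≡m (<⇒≤ (m∸n≢0⇒n<m {n} {o} λ z → <⇒≱ (subst (m <_) z p) z≤n))) (+-monoˡ-≤ o p)

  lo≤hi : ∀ s → s ∈ syms → lo (s ÷ Q) ≤ hi (s ÷ Q)
  lo≤hi s s∈ with onto s s∈
  ... | x , x<n , refl = ≤-trans (lo≤ x x<n) (<⇒≤ (<hi x x<n))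

  member : ∀ s y → s ∈ syms → lo (s ÷ Q) ≤ y → y < hi (s ÷ Q) → a y ÷ Q ≡ s ÷ Q
  member s y s∈ l r = proj₂ (∈-filter⁻ (λ x → x ÷ Q ≟ s ÷ Q) {xs = syms} (subst (a y ∈_) (slices s s∈)
    (subst (λ z → a z ∈ slice a (lo (s ÷ Q)) (hi (s ÷ Q) ∸ lo (s ÷ Q))) (m+[n∸m]≡n l)
      (∈-applyUpTo⁺ (λ t → a (lo (s ÷ Q) + t)) (∸-monoˡ-< r l)))))

-- Every new position is `pos n x` for some old `x`, and monotonicity of `N` carries the interval
-- around `x` to the one around `pos n x`. The order inside the intervals is `slice-child` followed
-- by `filter-filter`.
content-step : ∀ n syms {a a′ lo hi lo′ hi′ : ℕ → ℕ} {Q Q′ d} → Content n syms a lo hi Q → 0 < d → Q ≡ Q′ * d →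
  let open Counting (λ x → (a x ÷ Q′) ﹪ d) in
  (∀ x → x < n → a′ (pos n x) ≡ a x) →
  (∀ π → lo′ π ≡ N n (π ﹪ d) (lo (π ÷ d))) → (∀ π → hi′ π ≡ N n (π ﹪ d) (hi (π ÷ d))) →
  Content n syms a′ lo′ hi′ Q′
content-step n syms {a} {a′} {lo} {hi} {lo′} {hi′} {Q} {Q′} {d} C 0<d Q≡ moved lo≡ hi≡ = record
  { a∈ = λ y y<n → let x , x<n , e , m = back y y<n in subst (_∈ syms) (sym m) (a∈ x x<n)
  ; lo≤ = λ y y<n → let x , x<n , e , m = back y y<n in
      subst₂ _≤_ (sym (trans (cong (λ s → lo′ (s ÷ Q′)) m) (lo′≡ (a x)))) e (N-mono n (dig x) (lo≤ x x<n))
  ; <hi = λ y y<n → let x , x<n , e , m = back y y<n in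
      subst₂ _<_ e (sym (trans (cong (λ s → hi′ (s ÷ Q′)) m) (hi′≡ (a x)))) (pos-<-end n (<hi x x<n))
  ; hi≤n = λ s s∈ → subst (_≤ n) (sym (hi′≡ s)) (≤-trans (N-mono n (D s) (hi≤n s s∈)) (subst (_≤ n) (sym (N-end n (D s))) (G-≤ _ n)))
  ; slices = λ s s∈ → begin
      slice a′ (lo′ (s ÷ Q′)) (hi′ (s ÷ Q′) ∸ lo′ (s ÷ Q′))
        ≡⟨ cong₂ (λ l h → slice a′ l (h ∸ l)) (lo′≡ s) (hi′≡ s) ⟩
      slice a′ (N n (D s) (lo (s ÷ Q))) (N n (D s) (hi (s ÷ Q)) ∸ N n (D s) (lo (s ÷ Q)))
        ≡⟨ cong (λ h → slice a′ (N n (D s) (lo (s ÷ Q))) (N n (D s) h ∸ N n (D s) (lo (s ÷ Q)))) (m+[n∸m]≡n (lo≤hi s s∈)) ⟨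
      slice a′ (N n (D s) (lo (s ÷ Q))) (N n (D s) (lo (s ÷ Q) + (hi (s ÷ Q) ∸ lo (s ÷ Q))) ∸ N n (D s) (lo (s ÷ Q)))
        ≡⟨ slice-child D a a′ n moved (D s) (lo (s ÷ Q)) (hi (s ÷ Q) ∸ lo (s ÷ Q))
             (subst (_≤ n) (sym (m+[n∸m]≡n (lo≤hi s s∈))) (hi≤n s s∈)) ⟩
      filter (λ x → D x ≟ D s) (slice a (lo (s ÷ Q)) (hi (s ÷ Q) ∸ lo (s ÷ Q)))
        ≡⟨ cong (filter (λ x → D x ≟ D s)) (slices s s∈) ⟩
      filter (λ x → D x ≟ D s) (filter (λ x → x ÷ Q ≟ s ÷ Q) syms)
        ≡⟨ filter-filter Q Q′ d syms 0<d Q≡ s ⟩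
      filter (λ x → x ÷ Q′ ≟ s ÷ Q′) syms ∎ }
  where
  open Content C
  open Counting (λ x → (a x ÷ Q′) ﹪ d)
  open ≡-Reasoning
  D : ℕ → ℕ
  D s = (s ÷ Q′) ﹪ d
  dig : ℕ → ℕ
  dig x = D (a x)
  parent : ∀ x → x ÷ Q′ ÷ d ≡ x ÷ Q
  parent x = trans (÷-÷ x Q′ d) (cong (x ÷_) (sym Q≡))
  lo′≡ : ∀ s → lo′ (s ÷ Q′) ≡ N n (D s) (lo (s ÷ Q))
  lo′≡ s = trans (lo≡ (s ÷ Q′)) (cong (λ π → N n (D s) (lo π)) (parent s))
  hi′≡ : ∀ s → hi′ (s ÷ Q′) ≡ N n (D s) (hi (s ÷ Q))
  hi′≡ s = trans (hi≡ (s ÷ Q′)) (cong (λ π → N n (D s) (hi π)) (parent s))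
  back : ∀ y → y < n → ∃ λ x → x < n × pos n x ≡ y × a′ y ≡ a x
  back y y<n with pos-surjective n (λ x → ﹪-< (a x ÷ Q′) 0<d) y<n
  ... | x , x<n , refl = x , x<n , refl , moved x x<n

lookup-++ : ∀ r {x} δ δ′ → lookupE r δ ≡ just x → lookupE r (δ ++ δ′) ≡ just x
lookup-++ r ((r′ , _) ∷ δ) δ′ e with r′ ≡ᵇ r
... | true  = e
... | false = lookup-++ r δ δ′ e

applyUpTo-cong : ∀ {f g : ℕ → ℕ} n → (∀ x → x < n → f x ≡ g x) → applyUpTo f n ≡ applyUpTo g n
applyUpTo-cong zero    e = refl
applyUpTo-cong (suc n) e = cong₂ _∷_ (e 0 (s≤s z≤n)) (applyUpTo-cong n (λ x x< → e (suc x) (s≤s x<)))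

lookup-All : ∀ δ δ′ → All (λ { (r , vb) → lookupE r δ ≡ just vb }) δ′ →
             ∀ r {vb} → lookupE r δ′ ≡ just vb → lookupE r δ ≡ just vb
lookup-All δ ((r′ , _) ∷ δ′) (e ∷ es) r l with r′ ≡ᵇ r in q
lookup-All δ ((r′ , _) ∷ δ′) (e ∷ es) r refl | true with refl ← ≡ᵇ-true r′ r q = e
... | false = lookup-All δ δ′ es r l

÷-small : ∀ {x y} → x < y → x ÷ y ≡ 0
÷-small {x} {y} p = n≤0⇒n≡0 (s≤s⁻¹ (÷-< 1 (subst (x <_) (sym (*-identityˡ y)) p)))

-- Asymptotic bounds and their constants

-- Bounds `c * z` for a fixed `z`, composed along the shape of a cost expression so that the
-- constant is assembled alongside. `z` will be `n` or `log n`, alone or times the number of levels.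
module Scaled (z : ℕ) (1≤z : 1 ≤ z) where

  infix 4 _≲_
  record _≲_ (x c : ℕ) : Set where
    constructor by
    field bounded : x ≤ c * z

  open _≲_ public

  const : ∀ c → c ≲ c
  const c = by (subst (_≤ c * z) (*-identityʳ c) (*-monoʳ-≤ c 1≤z))

  infixl 6 _⊹_
  _⊹_ : ∀ {x y c c′} → x ≲ c → y ≲ c′ → x + y ≲ c + c′
  _⊹_ {c = c} {c′} (by p) (by q) = by (≤-trans (+-mono-≤ p q) (≤-reflexive (sym (*-distribʳ-+ z c c′))))

  times : ∀ a {x c} → x ≲ c → a * x ≲ a * c
  times a {x} {c} (by p) = by (≤-trans (*-monoʳ-≤ a p) (≤-reflexive (sym (*-assoc a c z))))

  exact : ∀ c → z * c ≲ c
  exact c = by (≤-reflexive (*-comm z c))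

  via : ∀ {x y c} → x ≤ y → y ≲ c → x ≲ c
  via p (by q) = by (≤-trans p q)

double : ∀ r c L {d} → 1 ≤ d → r * (d + 1) * (c * L) ≤ c * (2 * (r * (d * L)))
double r c L {d} 1≤d = begin
  r * (d + 1) * (c * L)     ≤⟨ *-monoˡ-≤ (c * L) (*-monoʳ-≤ r (+-monoʳ-≤ d 1≤d)) ⟩
  r * (d + d) * (c * L)     ≡⟨ lem r d c L ⟩
  c * (2 * (r * (d * L)))   ∎
  where
  open ≤-Reasoning
  lem : ∀ r d c L → r * (d + d) * (c * L) ≡ c * (2 * (r * (d * L)))
  lem = solve-∀

-- Each constant mirrors the cost expression it bounds, with `n` or `log n` divided out. The terms
-- `1 + r * (4 * κ)` come from `r` extra chunks or rows, each of which adds at most `4 * κ * n`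
-- entries.
module Constants (K : ℕ) where
  κ wf : ℕ
  κ  = K + 8
  wf = κ * E

  levelWork levelDepth prepConst buildWork buildDepth : ℕ
  levelWork  = pre + costBlocks * (1 + 1 * (4 * κ)) + mid₁ + costChunks * (2 * (1 + 1 * (4 * κ))) + mid₂ +
               ((2 + restRound) * 4 + costRound * (2 * (1 + 2 * (4 * κ)))) + costPack + seqCost clear + costScatter + post + 6
  levelDepth = pre + costBlocks * κ + mid₁ + costChunks * 1 + mid₂ + suc (suc (costRound + restRound)) + costPack * wf +
               seqCost clear + costScatter + post + 6
  prepConst  = prep₁ + prep₂ + prep₃ + prep₄ + 3 * suc powersPre + powersStep * (1 + κ + 1)
  buildWork  = prepConst * 4 + (1 + costInit + (1 + levelWork + (1 + endCost)))
  buildDepth = prepConst + (1 + costInit + (1 + levelDepth + (1 + endCost)))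

filter-cong : ∀ {X : Set} {P Q : X → Set} (P? : Decidable P) (Q? : Decidable Q) xs →
  (∀ {x} → x ∈ xs → P x → Q x) → (∀ {x} → x ∈ xs → Q x → P x) → filter P? xs ≡ filter Q? xs
filter-cong P? Q? [] f g = refl
filter-cong P? Q? (x ∷ xs) f g with filter-cong P? Q? xs (f ∘ there) (g ∘ there) | P? x
... | ih | yes p = trans (cong (x ∷_) ih) (sym (filter-accept Q? (f (here refl) p)))
... | ih | no ¬p = trans ih (sym (filter-reject Q? (¬p ∘ g (here refl))))

toList-applyUpTo : ∀ {n σ} (S : Vec (Fin σ) n) (f : ℕ → ℕ) → (∀ i → f (toℕ i) ≡ toℕ (lookupᵛ S i)) →
  map toℕ (toList S) ≡ applyUpTo f n
toList-applyUpTo []      f e = refl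
toList-applyUpTo (s ∷ S) f e = cong₂ _∷_ (sym (e fzero)) (toList-applyUpTo S (f ∘ suc) (e ∘ fsuc))

algorithm : ℕ → Algorithm
algorithm K = record
  { wordFactor = (K + 8) * E
  ; wordFactor>0 = *-mono-≤ (≤-trans (s≤s z≤n) (m≤n+m 8 K)) (s≤s z≤n)
  ; build = construct (K + 8) ((K + 8) * E) ; rankQ = rankQuery ; selectQ = selectQuery }

rankCost selectCost : ℕ
rankCost   = seqCost rankQuery + 0
selectCost = seqCost selectQuery + 0

opaque
  -- A single number has to serve the work, the depth and both kinds of query.
  constant : ℕ → ℕ
  constant K = Constants.buildWork K + Constants.buildDepth K + (rankCost + selectCost)

module _ (K : ℕ) where
  open Constants K using (buildWork; buildDepth)

  opaque
    unfolding constant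

    buildWork≤ : buildWork ≤ constant K
    buildWork≤ = ≤-trans (m≤m+n buildWork buildDepth) (m≤m+n (buildWork + buildDepth) (rankCost + selectCost))

    buildDepth≤ : buildDepth ≤ constant K
    buildDepth≤ = ≤-trans (m≤n+m buildDepth buildWork) (m≤m+n (buildWork + buildDepth) (rankCost + selectCost))

    rank≤ : rankCost ≤ constant K
    rank≤ = ≤-trans (m≤m+n rankCost selectCost) (m≤n+m (rankCost + selectCost) (buildWork + buildDepth))

    select≤ : selectCost ≤ constant K
    select≤ = ≤-trans (m≤n+m selectCost rankCost) (m≤n+m (rankCost + selectCost) (buildWork + buildDepth))

module _ (w k : ℕ) {n σ : ℕ} (S₀ : Vec (Fin σ) n) where

  open Machine w

  private
    instance
      2^k≢0′ : NonZero (2 ^ k)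
      2^k≢0′ = m^n≢0 2 k

  open WaveletTree (2 ^ k) S₀

  -- StoredNode and StoredTree for an abstract word size, so that the
  -- verification never meets the actual one.

  record IsNode (m : Mem) (addr : List ℕ → Word) (p : List ℕ) : Set where
    private
      v = addr p
      T′ = content p
    field
      size     : toℕ (m v) ≡ length T′
      entries  : Packed m (m (v ⊞ 1)) k T′
      child    : suc (length p) < height → ∀ c → c < 2 ^ k → Node (p ∷ʳ c) →
                 m (m (v ⊞ 2) ⊞ c) ≡ addr (p ∷ʳ c)
      no-child : suc (length p) < height → ∀ c → c < 2 ^ k → ¬ Node (p ∷ʳ c) →
                 toℕ (m (m (v ⊞ 2) ⊞ c)) ≡ 0
      ranks    : ∀ c i → c < 2 ^ k → i < length T′ →
                 Answers m rankQuery (toℕ v) c i rankCost (rank c T′ i)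
      selects  : ∀ c i j → c < 2 ^ k → IsSelect c T′ i j →
                 Answers m selectQuery (toℕ v) c i selectCost (toℕ j)

  record IsTree (root : Word) (m : Mem) : Set where
    field
      addr     : List ℕ → Word
      isRoot   : Node [] → addr [] ≡ root
      non-null : ∀ p → Node p → 0 < toℕ (addr p)
      distinct : ∀ p q → Node p → Node q → addr p ≡ addr q → p ≡ q
      nodes    : ∀ p → Node p → IsNode m addr p

-- Symbolic execution of a single thread

module Verification (w u : ℕ) (256≤u : 256 ≤ u) (2^w≡u^E : 2 ^ w ≡ u ^ E) where
  open Machine w

  2≤u : 2 ≤ u
  2≤u = ≤-trans (s≤s (s≤s z≤n)) 256≤u

  instance
    2^w≢0 : NonZero (2 ^ w)
    2^w≢0 = m^n≢0 2 w

    u≢0 : NonZero u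
    u≢0 = >-nonZero (≤-trans (s≤s z≤n) 2≤u)

  toℕ-trunc : ∀ x → toℕ (trunc x) ≡ x % 2 ^ w
  toℕ-trunc x = toℕ-fromℕ< (m%n<n x (2 ^ w))

  toℕ-trunc-< : ∀ {x} → x < 2 ^ w → toℕ (trunc x) ≡ x
  toℕ-trunc-< {x} p = trans (toℕ-trunc x) (m<n⇒m%n≡m p)

  trunc-toℕ : ∀ a → trunc (toℕ a) ≡ a
  trunc-toℕ a = toℕ-injective (toℕ-trunc-< (toℕ<n a))

  val : Mem → ℕ → ℕ
  val m α = toℕ (m (trunc α))

  below : ∀ {v} β {p : T (β ≤ᵇ E)} → v < u ^ β → v < 2 ^ w
  below β {p} v< = subst (_ <_) (sym 2^w≡u^E) (<-≤-trans v< (^-monoʳ-≤ u (≤ᵇ⇒≤ β E p)))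

  upd-same : ∀ ρ r x → (ρ [ r ≔ x ]) r ≡ x
  upd-same ρ r x rewrite ≡ᵇ-refl r = refl

  upd-other : ∀ ρ {r s} x → r ≢ s → (ρ [ r ≔ x ]) s ≡ ρ s
  upd-other ρ x p rewrite ≡ᵇ-≢ p = refl

  bound-+ : ∀ {x y} α β → x < u ^ α → y < u ^ β → x + y < u ^ suc (α ⊔ β)
  bound-+ {x} {y} α β x< y< = begin-strict
    x + y               <⟨ +-mono-< (<-≤-trans x< (^-monoʳ-≤ u (m≤m⊔n α β)))
                                    (<-≤-trans y< (^-monoʳ-≤ u (m≤n⊔m α β))) ⟩
    P + P               ≡⟨ cong (P +_) (+-identityʳ P) ⟨
    2 * P               ≤⟨ *-monoˡ-≤ P 2≤u ⟩
    u ^ suc (α ⊔ β)     ∎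
    where open ≤-Reasoning
          P = u ^ (α ⊔ β)

  bound-* : ∀ {x y} α β → x < u ^ α → y < u ^ β → x * y < u ^ (α + β)
  bound-* {x} {y} α β x< y< = begin-strict
    x * y           <⟨ *-mono-< x< y< ⟩
    u ^ α * u ^ β   ≡⟨ ^-distribˡ-+-* u α β ⟨
    u ^ (α + β)     ∎
    where open ≤-Reasoning

  bound-bit : ∀ {x} → x ≤ 1 → x < u ^ 1
  bound-bit {x} p = subst (x <_) (sym (*-identityʳ u)) (≤-<-trans p 2≤u)

  evalℕ-DIV : ∀ x y → evalℕ w DIV x y ≡ x ÷ y
  evalℕ-DIV x zero    = refl
  evalℕ-DIV x (suc y) = refl

  evalℕ-REM : ∀ x y → evalℕ w REM x y ≡ x ﹪ y
  evalℕ-REM x zero    = refl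
  evalℕ-REM x (suc y) = refl

  -- For `y < x` the wrapped difference is exact; otherwise the flag turns it into zero, which is
  -- the truncated value.
  ∸-value : ∀ x y → x < 2 ^ w → y < 2 ^ w →
            ((x + (2 ^ w ∸ y)) % 2 ^ w) * 𝟙 (y <ᵇ x) ≡ x ∸ y
  ∸-value x y x< y< with y <ᵇ x in eq
  ... | true = trans (*-identityʳ _) (begin
      (x + (2 ^ w ∸ y)) % 2 ^ w             ≡⟨ cong (λ z → (z + (2 ^ w ∸ y)) % 2 ^ w) (sym (m∸n+n≡m y≤x)) ⟩
      (x ∸ y + y + (2 ^ w ∸ y)) % 2 ^ w     ≡⟨ cong (_% 2 ^ w) (trans (+-assoc (x ∸ y) y _)
                                                (cong (x ∸ y +_) (m+[n∸m]≡n (<⇒≤ y<)))) ⟩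
      (x ∸ y + 2 ^ w) % 2 ^ w               ≡⟨ [m+n]%n≡m%n (x ∸ y) (2 ^ w) ⟩
      (x ∸ y) % 2 ^ w                       ≡⟨ m<n⇒m%n≡m (≤-<-trans (m∸n≤m x y) x<) ⟩
      x ∸ y                                 ∎)
    where
    open ≡-Reasoning
    y≤x = <⇒≤ (<ᵇ⇒< y x (subst T (sym eq) tt))
  ... | false = trans (*-zeroʳ ((x + (2 ^ w ∸ y)) % 2 ^ w))
    (sym (m≤n⇒m∸n≡0 {x} {y} (≮⇒≥ λ y<x → subst T eq (<⇒<ᵇ {y} {x} y<x))))

  up : ∀ {v} α β {_ : T (α ≤ᵇ β)} → v < u ^ α → v < u ^ β
  up α β {p} v< = <-≤-trans v< (^-monoʳ-≤ u (≤ᵇ⇒≤ α β p))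

  infix 4 _⊨_

  -- Only registers below `T₀` are described, since evaluating an expression overwrites others.
  -- Keeping a bound with each value allows overflow to be excluded for values that are not
  -- numerals.
  _⊨_ : Regs → Env → Set
  ρ ⊨ δ = ∀ r {v β} → r < T₀ → lookupE r δ ≡ just (v , β) → toℕ (ρ r) ≡ v × v < u ^ β

  ⊨-put : ∀ {ρ δ} ρ′ r {v β} → ρ ⊨ δ → toℕ (ρ′ r) ≡ v → v < u ^ β →
          (∀ s → s < T₀ → r ≢ s → ρ′ s ≡ ρ s) → ρ′ ⊨ put r v β δ
  ⊨-put {ρ} {δ} ρ′ r {v} {β} sat e bd fr s s< l with r ≟ s
  ... | yes refl with refl ← trans (sym (lookup-put-same r v β δ)) l = e , bd
  ... | no r≢s with sat s s< (trans (sym (lookup-put-other v β δ r≢s)) l)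
  ...   | e′ , bd′ = trans (cong toℕ (fr s s< r≢s)) e′ , bd′

  ⊨-frame : ∀ {ρ ρ′ δ t} → ρ ⊨ δ → T₀ ≤ t → (∀ r → r < t → ρ′ r ≡ ρ r) → ρ′ ⊨ δ
  ⊨-frame sat le fr r r< l with sat r r< l
  ... | e , b = trans (cong toℕ (fr r (<-≤-trans r< le))) e , b

  module _ (m₀ : Mem) (φ : ℕ) where

    Agree : Mem → Set
    Agree m = ∀ a → toℕ a < φ → m a ≡ m₀ a

    -- Each step is required in every memory that agrees with `m₀` below `φ`; so the execution stays
    -- valid while other threads write from `φ` on.
    data Steps : Regs → List Cmd → Regs → List Cmd → ℕ → Set where
      one  : ∀ {ρ K ρ′ K′} →
             (∀ m → Agree m → step m (run ρ K) ≡ (run ρ′ K′ , [] , 1)) →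
             Steps ρ K ρ′ K′ 1
      next : ∀ {ρ K ρ′ K′ ρ″ K″ n} →
             (∀ m → Agree m → step m (run ρ K) ≡ (run ρ′ K′ , [] , 1)) →
             Steps ρ′ K′ ρ″ K″ n → Steps ρ K ρ″ K″ (suc n)

    -- e evaluates to v < u ^ β in every register file described by δ.

    record Ev (δ : Env) (e : Exp) (v β : ℕ) : Set where
      field
        bd   : ∀ {ρ} → ρ ⊨ δ → v < u ^ β
        runs : ∀ {ρ} t k → ρ ⊨ δ → T₀ ≤ t →
               Σ Regs λ ρ′ → Steps ρ (comp t e ∷ k) ρ′ k (cost e) ×
                 toℕ (ρ′ t) ≡ v × (∀ r → r < t → ρ′ r ≡ ρ r)

  open Ev public

  module _ {m₀ : Mem} {φ : ℕ} where

    _⊕_ : ∀ {ρ K ρ′ K′ ρ″ K″ n n′} →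
          Steps m₀ φ ρ K ρ′ K′ n → Steps m₀ φ ρ′ K′ ρ″ K″ n′ → Steps m₀ φ ρ K ρ″ K″ (n + n′)
    one s    ⊕ S = next s S
    next s R ⊕ S = next s (R ⊕ S)

    infixr 5 _⊕_

    seqS : ∀ {c c′ k ρ ρ′ K′ n} →
           Steps m₀ φ ρ (c ∷ c′ ∷ k) ρ′ K′ n → Steps m₀ φ ρ ((c ⨾ c′) ∷ k) ρ′ K′ n
    seqS (one s)    = one s
    seqS (next s S) = next s S

    ev-≡ : ∀ {δ e v v′ β} → v ≡ v′ → Ev m₀ φ δ e v β → Ev m₀ φ δ e v′ β
    ev-≡ refl p = p

    ev-bd : ∀ {δ e v β β′} → v < u ^ β′ → Ev m₀ φ δ e v β → Ev m₀ φ δ e v β′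
    ev-bd b p = record { bd = λ _ → b ; runs = runs p }

    ev-up : ∀ {δ e v α} β {_ : T (α ≤ᵇ β)} → Ev m₀ φ δ e v α → Ev m₀ φ δ e v β
    ev-up {α = α} β {p} A = record { bd = λ sat → up α β {p} (bd A sat) ; runs = runs A }

    ev-lit : ∀ {δ a} → a < u → Ev m₀ φ δ (‵ a) a 1
    ev-lit {a = a} a<u = record
      { bd = λ _ → a<u¹
      ; runs = λ {ρ} t k sat le → (ρ [ t ≔ trunc a ]) , one (λ _ _ → refl) ,
          trans (cong toℕ (upd-same ρ t _)) (toℕ-trunc-< (below 1 a<u¹)) ,
          (λ r r<t → upd-other ρ _ (>⇒≢ r<t)) }
      where
      a<u¹ : a < u ^ 1
      a<u¹ = subst (a <_) (sym (*-identityʳ u)) a<u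

    ev-var : ∀ {δ r v β} → T (r <ᵇ T₀) → lookupE r δ ≡ just (v , β) → Ev m₀ φ δ ($ r) v β
    ev-var {δ} {r} {v} {β} r< l = record { bd = λ sat → proj₂ (sat r r<T₀ l) ; runs = ex }
      where
      r<T₀ = <ᵇ⇒< r T₀ r<
      ex : ∀ {ρ} t k → ρ ⊨ δ → T₀ ≤ t →
           Σ Regs λ ρ′ → Steps m₀ φ ρ (comp t ($ r) ∷ k) ρ′ k 2 ×
             toℕ (ρ′ t) ≡ v × (∀ s → s < t → ρ′ s ≡ ρ s)
      ex {ρ} t k sat le = ρ₂ , next (λ _ _ → refl) (one (λ _ _ → refl)) , value ,
        λ s s<t → trans (upd-other ρ₁ _ (>⇒≢ s<t)) (upd-other ρ _ (>⇒≢ s<t))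
        where
        ρ₁ = ρ [ t ≔ trunc 0 ]
        ρ₂ = ρ₁ [ t ≔ eval ADD (ρ₁ r) (ρ₁ t) ]
        value : toℕ (ρ₂ t) ≡ v
        value rewrite upd-same ρ₁ t (eval ADD (ρ₁ r) (ρ₁ t)) | upd-same ρ t (trunc 0)
          | upd-other ρ (trunc 0) (>⇒≢ (<-≤-trans r<T₀ le))
          | toℕ-trunc-< {0} (m^n>0 2 w) | +-identityʳ (toℕ (ρ r)) | trunc-toℕ (ρ r)
          = proj₁ (sat r r<T₀ l)

    ev-op-mod : ∀ {δ a b x y v α β γ} o → evalℕ w o x y % 2 ^ w ≡ v → v < u ^ γ →
            Ev m₀ φ δ a x α → Ev m₀ φ δ b y β → Ev m₀ φ δ (bin o a b) v γ
    ev-op-mod {δ} {a} {b} {x} {y} {v} {γ = γ} o eq v<′ A B = record { bd = λ _ → v<′ ; runs = ex }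
      where
      ex : ∀ {ρ} t k → ρ ⊨ δ → T₀ ≤ t →
           Σ Regs λ ρ′ → Steps m₀ φ ρ (comp t (bin o a b) ∷ k) ρ′ k (cost a + (cost b + 1)) ×
             toℕ (ρ′ t) ≡ v × (∀ s → s < t → ρ′ s ≡ ρ s)
      ex {ρ} t k sat le =
        let ρ₁ , S₁ , e₁ , f₁ = runs A t ((comp (suc t) b ⨾ op t o t (suc t)) ∷ k) sat le
            ρ₂ , S₂ , e₂ , f₂ = runs B (suc t) (op t o t (suc t) ∷ k) (⊨-frame {δ = δ} sat le f₁) (m≤n⇒m≤1+n le)
            z = eval o (ρ₂ t) (ρ₂ (suc t))
        in ρ₂ [ t ≔ z ] ,
           seqS (S₁ ⊕ seqS (S₂ ⊕ one (λ _ _ → refl))) ,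
           trans (cong toℕ (upd-same ρ₂ t z))
             (trans (toℕ-trunc _) (trans (cong (_% 2 ^ w)
                      (cong₂ (evalℕ w o) (trans (cong toℕ (f₂ t ≤-refl)) e₁) e₂)) eq)) ,
           λ s s<t → trans (upd-other ρ₂ _ (>⇒≢ s<t))
             (trans (f₂ s (m≤n⇒m≤1+n s<t)) (f₁ s s<t))

    ev-op : ∀ {δ a b x y v α β γ} o → evalℕ w o x y ≡ v → v < u ^ γ → v < 2 ^ w →
            Ev m₀ φ δ a x α → Ev m₀ φ δ b y β → Ev m₀ φ δ (bin o a b) v γ
    ev-op {γ = γ} o refl v<′ v< = ev-op-mod {γ = γ} o (m<n⇒m%n≡m v<) v<′

    ev-+ : ∀ {δ a b x y α β} {p : T (suc (α ⊔ β) ≤ᵇ E)} →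
           Ev m₀ φ δ a x α → Ev m₀ φ δ b y β → Ev m₀ φ δ (a +ᵉ b) (x + y) (suc (α ⊔ β))
    ev-+ {α = α} {β} {p} A B = record
      { bd = λ sat → bound-+ α β (bd A sat) (bd B sat)
      ; runs = λ t k sat → let v< = bound-+ α β (bd A sat) (bd B sat)
               in runs (ev-op {γ = suc (α ⊔ β)} ADD refl v< (below (suc (α ⊔ β)) {p} v<) A B) t k sat }

    ev-* : ∀ {δ a b x y α β} {p : T (α + β ≤ᵇ E)} →
           Ev m₀ φ δ a x α → Ev m₀ φ δ b y β → Ev m₀ φ δ (a *ᵉ b) (x * y) (α + β)
    ev-* {α = α} {β} {p} A B = record
      { bd = λ sat → bound-* α β (bd A sat) (bd B sat)
      ; runs = λ t k sat → let v< = bound-* α β (bd A sat) (bd B sat)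
               in runs (ev-op {γ = α + β} MUL refl v< (below (α + β) {p} v<) A B) t k sat }

    ev-/ : ∀ {δ a b x y α β} {p : T (α ≤ᵇ E)} →
           Ev m₀ φ δ a x α → Ev m₀ φ δ b y β → Ev m₀ φ δ (a /ᵉ b) (x ÷ y) α
    ev-/ {x = x} {y} {α} {p = p} A B = record
      { bd = λ sat → ≤-<-trans (÷-≤ x y) (bd A sat)
      ; runs = λ t k sat → let v< = ≤-<-trans (÷-≤ x y) (bd A sat)
               in runs (ev-op {γ = α} DIV (evalℕ-DIV x y) v< (below α {p} v<) A B) t k sat }

    ev-% : ∀ {δ a b x y α β} {p : T (α ≤ᵇ E)} →
           Ev m₀ φ δ a x α → Ev m₀ φ δ b y β → Ev m₀ φ δ (a %ᵉ b) (x ﹪ y) α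
    ev-% {x = x} {y} {α} {p = p} A B = record
      { bd = λ sat → ≤-<-trans (﹪-≤ x y) (bd A sat)
      ; runs = λ t k sat → let v< = ≤-<-trans (﹪-≤ x y) (bd A sat)
               in runs (ev-op {γ = α} REM (evalℕ-REM x y) v< (below α {p} v<) A B) t k sat }

    ev-< : ∀ {δ a b x y α β} → Ev m₀ φ δ a x α → Ev m₀ φ δ b y β → Ev m₀ φ δ (a <ᵉ b) (𝟙 (x <ᵇ y)) 1
    ev-< {x = x} {y} A B = ev-op {γ = 1} LT refl v< (below 1 v<) A B
      where v< = bound-bit (𝟙≤1 (x <ᵇ y))

    ev-≪ : ∀ {δ a b x y v α β γ} {p : T (γ ≤ᵇ E)} → x * 2 ^ y ≡ v → v < u ^ γ →
           Ev m₀ φ δ a x α → Ev m₀ φ δ b y β → Ev m₀ φ δ (a ≪ᵉ b) v γ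
    ev-≪ {γ = γ} {p} eq v< A B = ev-op {γ = γ} SHL eq v< (below γ {p} v<) A B

    -- Packing shifts high bits out of the word on purpose, so the wrapped value is the intended
    -- one.
    ev-≪-mod : ∀ {δ a b x y α β} → Ev m₀ φ δ a x α → Ev m₀ φ δ b y β → Ev m₀ φ δ (a ≪ᵉ b) (x * 2 ^ y % 2 ^ w) E
    ev-≪-mod {x = x} {y} = ev-op-mod {γ = E} SHL refl (subst (x * 2 ^ y % 2 ^ w <_) 2^w≡u^E (m%n<n (x * 2 ^ y) (2 ^ w)))

    ev-! : ∀ {δ a x v α β} → Ev m₀ φ δ a x α → x < φ → val m₀ x ≡ v → v < u ^ β → Ev m₀ φ δ (! a) v β
    ev-! {δ} {a} {x} {v} {α} {β} A x<φ eq v< = record { bd = λ _ → v< ; runs = ex }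
      where
      ex : ∀ {ρ} t k → ρ ⊨ δ → T₀ ≤ t →
           Σ Regs λ ρ′ → Steps m₀ φ ρ (comp t (! a) ∷ k) ρ′ k (cost a + 1) ×
             toℕ (ρ′ t) ≡ v × (∀ s → s < t → ρ′ s ≡ ρ s)
      ex {ρ} t k sat le =
        let ρ₁ , S₁ , e₁ , f₁ = runs A t (load t t ∷ k) sat le
            ag = λ m ag → cong (λ z → run (ρ₁ [ t ≔ z ]) k , [] , 1)
                   (ag (ρ₁ t) (subst (_< φ) (sym e₁) x<φ))
        in ρ₁ [ t ≔ m₀ (ρ₁ t) ] , seqS (S₁ ⊕ one ag) ,
           trans (cong toℕ (trans (upd-same ρ₁ t _)
             (cong m₀ (trans (sym (trunc-toℕ (ρ₁ t))) (cong trunc e₁))))) eq ,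
           λ s s<t → trans (upd-other ρ₁ _ (>⇒≢ s<t)) (f₁ s s<t)

    ev-∸ : ∀ {δ a b x y α β} {p : T (α ≤ᵇ E)} {q : T (β ≤ᵇ E)} →
           Ev m₀ φ δ a x α → Ev m₀ φ δ b y β → Ev m₀ φ δ (a ∸ᵉ b) (x ∸ y) α
    ev-∸ {δ} {a} {b} {x} {y} {α} {β} {p} {q} A B = record
      { bd = λ sat → ≤-<-trans (m∸n≤m x y) (bd A sat) ; runs = ex }
      where
      ex : ∀ {ρ} t k → ρ ⊨ δ → T₀ ≤ t →
           Σ Regs λ ρ′ → Steps m₀ φ ρ (comp t (a ∸ᵉ b) ∷ k) ρ′ k (cost a + (cost b + 3)) ×
             toℕ (ρ′ t) ≡ x ∸ y × (∀ s → s < t → ρ′ s ≡ ρ s)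
      ex {ρ} t k sat le =
        let ρ₁ , S₁ , e₁ , f₁ = runs A t ((comp (suc t) b ⨾ op (2 + t) LT (suc t) t ⨾
                                   op t SUB t (suc t) ⨾ op t MUL t (2 + t)) ∷ k) sat le
            ρ₂ , S₂ , e₂ , f₂ = runs B (suc t) ((op (2 + t) LT (suc t) t ⨾
                                   op t SUB t (suc t) ⨾ op t MUL t (2 + t)) ∷ k) (⊨-frame {δ = δ} sat le f₁) (m≤n⇒m≤1+n le)
            ρ₃ = ρ₂ [ 2 + t ≔ eval LT (ρ₂ (suc t)) (ρ₂ t) ]
            ρ₄ = ρ₃ [ t ≔ eval SUB (ρ₃ t) (ρ₃ (suc t)) ]
            x< = below α {p} (bd A sat)
            y< = below β {q} (bd B sat)
            t≢2+t : 2 + t ≢ t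
            t≢2+t = >⇒≢ (m<n⇒m<1+n (n<1+n t))
            xe : toℕ (ρ₂ t) ≡ x
            xe = trans (cong toℕ (f₂ t ≤-refl)) e₁
            l : toℕ (ρ₄ (2 + t)) ≡ 𝟙 (y <ᵇ x)
            l = trans (cong toℕ (trans (upd-other ρ₃ _ (t≢2+t ∘ sym)) (upd-same ρ₂ (2 + t) _)))
                  (trans (toℕ-trunc-< (below 1 (bound-bit (𝟙≤1 (toℕ (ρ₂ (suc t)) <ᵇ toℕ (ρ₂ t))))))
                         (cong₂ (λ p q → 𝟙 (p <ᵇ q)) e₂ xe))
            s : toℕ (ρ₄ t) ≡ (x + (2 ^ w ∸ y)) % 2 ^ w
            s = trans (cong toℕ (upd-same ρ₃ t _)) (trans (toℕ-trunc _) (cong₂ (λ p q → (p + (2 ^ w ∸ q)) % 2 ^ w)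
                  (trans (cong toℕ (upd-other ρ₂ _ t≢2+t)) xe)
                  (trans (cong toℕ (upd-other ρ₂ _ (>⇒≢ (n<1+n (suc t))))) e₂)))
        in ρ₄ [ t ≔ eval MUL (ρ₄ t) (ρ₄ (2 + t)) ] ,
           seqS (S₁ ⊕ seqS (S₂ ⊕ next (λ _ _ → refl) (next (λ _ _ → refl) (one (λ _ _ → refl))))) ,
           trans (cong toℕ (upd-same ρ₄ t _))
             (trans (cong (λ z → toℕ (trunc z)) (trans (cong₂ _*_ s l) (∸-value x y x< y<)))
                    (toℕ-trunc-< (≤-<-trans (m∸n≤m x y) x<))) ,
           λ r r<t → trans (upd-other ρ₄ _ (>⇒≢ r<t)) (trans (upd-other ρ₃ _ (>⇒≢ r<t))
             (trans (upd-other ρ₂ _ (>⇒≢ (m<n⇒m<1+n (m<n⇒m<1+n r<t))))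
             (trans (f₂ r (m≤n⇒m≤1+n r<t)) (f₁ r r<t))))

    -- Soundness of `evalE`. A successful evaluation includes the comparisons of exponents that
    -- exclude overflow, so a proof by `refl` settles an expression without loads and shifts.
    auto : ∀ {δ} e {v β} → evalE δ e ≡ just (v , β) → Ev m₀ φ δ e v β
    auto (‵ a) eq with a <ᵇ 256 in q
    auto (‵ a) refl | true = ev-lit (<-≤-trans (<ᵇ⇒< a 256 (subst T (sym q) tt)) 256≤u)
    auto ($ r) eq with r <ᵇ T₀ in q
    ... | true = ev-var (subst T (sym q) tt) eq
    auto {δ} (bin o a b) eq with evalE δ a in p | evalE δ b in q
    auto {δ} (bin ADD a b) eq | just (x , α) | just (y , β) with suc (α ⊔ β) ≤ᵇ E in r
    auto {δ} (bin ADD a b) refl | just (x , α) | just (y , β) | true =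
      ev-+ {p = subst T (sym r) tt} (auto a p) (auto b q)
    auto {δ} (bin MUL a b) eq | just (x , α) | just (y , β) with α + β ≤ᵇ E in r
    auto {δ} (bin MUL a b) refl | just (x , α) | just (y , β) | true =
      ev-* {p = subst T (sym r) tt} (auto a p) (auto b q)
    auto {δ} (bin DIV a b) eq | just (x , α) | just (y , β) with α ≤ᵇ E in r
    auto {δ} (bin DIV a b) refl | just (x , α) | just (y , β) | true =
      ev-/ {p = subst T (sym r) tt} (auto a p) (auto b q)
    auto {δ} (bin REM a b) eq | just (x , α) | just (y , β) with α ≤ᵇ E in r
    auto {δ} (bin REM a b) refl | just (x , α) | just (y , β) | true =
      ev-% {p = subst T (sym r) tt} (auto a p) (auto b q)
    auto {δ} (bin LT a b) refl | just (x , α) | just (y , β) =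
      ev-< (auto a p) (auto b q)
    auto {δ} (bin SUB a b) () | just (x , α) | just (y , β)
    auto {δ} (a ∸ᵉ b) eq with evalE δ a in p | evalE δ b in q
    ... | just (x , α) | just (y , β) with α ≤ᵇ E in r | β ≤ᵇ E in s
    auto {δ} (a ∸ᵉ b) refl | just (x , α) | just (y , β) | true | true =
      ev-∸ {p = subst T (sym r) tt} {q = subst T (sym s) tt} (auto a p) (auto b q)

    assign-steps : ∀ {δ e v β ρ} r k → Ev m₀ φ δ e v β → ρ ⊨ δ →
      Σ Regs λ ρ′ → Steps m₀ φ ρ ((r ⇐ e) ∷ k) ρ′ k (cost e + 2) × ρ′ ⊨ put r v β δ
    assign-steps {δ} {e} {v} {β} r k A sat =
      let ρ₁ , S₁ , e₁ , f₁ = runs A T₀ ((lit (suc T₀) 0 ⨾ op r ADD T₀ (suc T₀)) ∷ k) sat ≤-refl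
          ρ₂ = ρ₁ [ suc T₀ ≔ trunc 0 ]
          z  = eval ADD (ρ₂ T₀) (ρ₂ (suc T₀))
          eq = trans (cong toℕ (upd-same ρ₂ r z))
                 (trans (cong (λ x → toℕ (trunc (toℕ (ρ₁ T₀) + x))) (toℕ-trunc-< {0} (m^n>0 2 w)))
                 (trans (cong (λ x → toℕ (trunc x)) (+-identityʳ (toℕ (ρ₁ T₀))))
                 (trans (cong toℕ (trunc-toℕ (ρ₁ T₀))) e₁)))
      in ρ₂ [ r ≔ z ] ,
         seqS (S₁ ⊕ next (λ _ _ → refl) (one (λ _ _ → refl))) ,
         ⊨-put {δ = δ} (ρ₂ [ r ≔ z ]) r sat eq (bd A sat)
           (λ s s< r≢s → trans (upd-other ρ₂ _ r≢s)
             (trans (upd-other ρ₁ _ (>⇒≢ (m<n⇒m<1+n s<))) (f₁ s s<)))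

  relax : ∀ {Q Q′ : Regs → Mem → Set} {m t W D W′ D′} → (∀ {ρ m} → Q ρ m → Q′ ρ m) → W ≤ W′ → D ≤ D′ →
          Terminates Q m t W D → Terminates Q′ m t W′ D′
  relax f _ _ (stop q) = stop (f q)
  relax {D′ = suc D′} f W≤ (s≤s D≤) (go {a = a} {W = W} e g) =
    subst (λ V → Terminates _ _ _ V _) (m+[n∸m]≡n (≤-trans (m≤m+n a W) W≤))
      (go e λ m′ c → relax f (m+n≤o⇒n≤o∸m a W≤) D≤ (g m′ c))
    where
    m+n≤o⇒n≤o∸m : ∀ m {n o} → m + n ≤ o → n ≤ o ∸ m
    m+n≤o⇒n≤o∸m m {n} p = subst (_≤ _ ∸ m) (m+n∸m≡n m n) (∸-monoˡ-≤ m p)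

  weaken : ∀ {Q m t W D W′ D′} → W ≤ W′ → D ≤ D′ → Terminates Q m t W D → Terminates Q m t W′ D′
  weaken = relax id

  -- Parallel threads

  module Threads (m₀ : Mem) (φ : ℕ) (ν : ℕ → ℕ) where

    private
      Agr = Agree m₀ φ

    -- A thread that reads only below the frontier φ, writes only from φ on,
    -- and writes to each address the value prescribed by ν, is insensitive to
    -- other such threads.  It performs s operations and writes to the
    -- addresses as.

    data Thr : Regs → List Cmd → List ℕ → ℕ → Set where
      done : ∀ {ρ} → Thr ρ [] [] 0
      tick : ∀ {ρ K ρ′ K′ as s} →
             (∀ m → Agr m → step m (run ρ K) ≡ (run ρ′ K′ , [] , 1)) →
             Thr ρ′ K′ as s → Thr ρ K as (suc s)
      emit : ∀ {ρ K ρ′ K′ as s a x} →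
             (∀ m → Agr m → step m (run ρ K) ≡ (run ρ′ K′ , (a , x) ∷ [] , 1)) →
             φ ≤ toℕ a → toℕ x ≡ ν (toℕ a) →
             Thr ρ′ K′ as s → Thr ρ K (toℕ a ∷ as) (suc s)

    Thr-seq : ∀ {c c′ k ρ as s} → Thr ρ (c ∷ c′ ∷ k) as s → Thr ρ ((c ⨾ c′) ∷ k) as s
    Thr-seq (tick e t)     = tick e t
    Thr-seq (emit e p q t) = emit e p q t

    Thr-steps : ∀ {ρ K ρ′ K′ n as s} → Steps m₀ φ ρ K ρ′ K′ n → Thr ρ′ K′ as s → Thr ρ K as (n + s)
    Thr-steps (one e)    t = tick e t
    Thr-steps (next e S) t = tick e (Thr-steps S t)

    Thr-addr< : ∀ {ρ K as s α} → Thr ρ K as s → α ∈ as → α < 2 ^ w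
    Thr-addr< (tick _ t) p = Thr-addr< t p
    Thr-addr< (emit {a = a} _ _ _ t) (here refl) = toℕ<n a
    Thr-addr< (emit _ _ _ t) (there p) = Thr-addr< t p

    data Thrs (D : ℕ) : List Thread → List ℕ → ℕ → Set where
      []   : Thrs D [] [] 0
      cons : ∀ {ρ K as s ts as′ W} → Thr ρ K as s → s ≤ D → Thrs D ts as′ W →
             Thrs D (run ρ K ∷ ts) (as ++ as′) (s + W)

    Good : List ℕ → Writes → Set
    Good as ws = ∀ {a x} → (a , x) ∈ ws → φ ≤ toℕ a × toℕ x ≡ ν (toℕ a) × toℕ a ∈ as

    -- `kept` says that an outstanding address stays outstanding unless this very step writes it.
    record Step (D : ℕ) (m : Mem) (ts : List Thread) (as : List ℕ) (W : ℕ) : Set where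
      field
        {ts′} : List Thread
        {ws}  : Writes
        {as′} : List ℕ
        {a W′} : ℕ
        eq    : steps m ts ≡ (ts′ , ws , a)
        rest  : Thrs D ts′ as′ W′
        work  : W ≡ a + W′
        good  : Good as ws
        kept  : ∀ {α} → α ∈ as → (∃ λ b → b ∈ map proj₁ ws × toℕ b ≡ α) ⊎ α ∈ as′
        fewer : ∀ {α} → α ∈ as′ → α ∈ as

    step-one : ∀ {m ρ K as s D} → Agr m → Thr ρ K as s → s ≤ suc D →
      Σ Regs λ ρ′ → Σ (List Cmd) λ K′ → Σ Writes λ ws → Σ ℕ λ a → Σ (List ℕ) λ as′ → Σ ℕ λ s′ →
      step m (run ρ K) ≡ (run ρ′ K′ , ws , a) × Thr ρ′ K′ as′ s′ × s′ ≤ D × s ≡ a + s′ × Good as ws ×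
      (∀ {α} → α ∈ as → (∃ λ b → b ∈ map proj₁ ws × toℕ b ≡ α) ⊎ α ∈ as′) × (∀ {α} → α ∈ as′ → α ∈ as)
    step-one ag (done {ρ}) _ = ρ , [] , [] , 0 , [] , 0 , refl , done , z≤n , refl , (λ ()) , (λ ()) , λ ()
    step-one ag (tick e t) (s≤s s≤) = _ , _ , _ , _ , _ , _ , e _ ag , t , s≤ , refl , (λ ()) , inj₂ , id
    step-one ag (emit {a = a} e p q t) (s≤s s≤) = _ , _ , _ , _ , _ , _ , e _ ag , t , s≤ , refl ,
      (λ { (here refl) → p , q , here refl }) ,
      (λ { (here refl) → inj₁ (a , here refl , refl) ; (there i) → inj₂ i }) , there

    step-all : ∀ {D m ts as W} → Agr m → Thrs (suc D) ts as W → Step D m ts as W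
    step-all ag [] = record { eq = refl ; rest = [] ; work = refl ; good = λ () ; kept = λ () ; fewer = λ () }
    step-all {m = m} ag (cons {ρ = ρ} {K} {as} {s} {ts} {as₁} {W} t s≤ th)
      with step-one {m} ag t s≤ | step-all {m = m} ag th
    ... | ρ′ , K′ , ws , a , as′ , s′ , e , t′ , s′≤ , sw , g , kp , fw | S = record
      { eq    = trans (cong (comb (steps m ts)) e)
                      (cong (comb′ (run ρ′ K′ , ws , a)) (Step.eq S))
      ; rest  = cons t′ s′≤ (Step.rest S)
      ; work  = trans (cong₂ _+_ sw (Step.work S)) (+-interchange a s′ (Step.a S) (Step.W′ S))
      ; good  = λ i → good′ (∈-++⁻ ws i)
      ; kept  = λ i → kept′ (∈-++⁻ as i)
      ; fewer = λ i → fewer′ (∈-++⁻ as′ i) }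
      where
      comb : List Thread × Writes × ℕ → Thread × Writes × ℕ → List Thread × Writes × ℕ
      comb (ts′ , ws′ , a′) (t′ , ws , a) = t′ ∷ ts′ , ws ++ ws′ , a + a′
      comb′ : Thread × Writes × ℕ → List Thread × Writes × ℕ → List Thread × Writes × ℕ
      comb′ t r = comb r t
      +-interchange : ∀ a b c d → (a + b) + (c + d) ≡ (a + c) + (b + d)
      +-interchange a b c d = trans (+-assoc a b (c + d)) (trans (cong (a +_)
        (trans (sym (+-assoc b c d)) (trans (cong (_+ d) (+-comm b c)) (+-assoc c b d)))) (sym (+-assoc a c (b + d))))
      good′ : ∀ {b x} → (b , x) ∈ ws ⊎ (b , x) ∈ Step.ws S → φ ≤ toℕ b × toℕ x ≡ ν (toℕ b) × toℕ b ∈ as ++ as₁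
      good′ (inj₁ i) = let p , q , r = g i in p , q , ∈-++⁺ˡ r
      good′ (inj₂ i) = let p , q , r = Step.good S i in p , q , ∈-++⁺ʳ as r
      map-++⁺ : ∀ {b} (ws ws′ : Writes) → b ∈ map proj₁ ws ⊎ b ∈ map proj₁ ws′ → b ∈ map proj₁ (ws ++ ws′)
      map-++⁺ [] ws′ (inj₂ i) = i
      map-++⁺ (_ ∷ ws) ws′ (inj₁ (here e)) = here e
      map-++⁺ (_ ∷ ws) ws′ (inj₁ (there i)) = there (map-++⁺ ws ws′ (inj₁ i))
      map-++⁺ (_ ∷ ws) ws′ (inj₂ i) = there (map-++⁺ ws ws′ (inj₂ i))
      kept′ : ∀ {α} → α ∈ as ⊎ α ∈ as₁ →
              (∃ λ b → b ∈ map proj₁ (ws ++ Step.ws S) × toℕ b ≡ α) ⊎ α ∈ as′ ++ Step.as′ S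
      kept′ (inj₁ i) with kp i
      ... | inj₁ (b , j , e) = inj₁ (b , map-++⁺ ws _ (inj₁ j) , e)
      ... | inj₂ j = inj₂ (∈-++⁺ˡ j)
      kept′ (inj₂ i) with Step.kept S i
      ... | inj₁ (b , j , e) = inj₁ (b , map-++⁺ ws _ (inj₂ j) , e)
      ... | inj₂ j = inj₂ (∈-++⁺ʳ as′ j)
      fewer′ : ∀ {α} → α ∈ as′ ⊎ α ∈ Step.as′ S → α ∈ as ++ as₁
      fewer′ (inj₁ i) = ∈-++⁺ˡ (fw i)
      fewer′ (inj₂ i) = ∈-++⁺ʳ as (Step.fewer S i)

    Thr-finished : ∀ {ρ as s} → Thr ρ [] as s → as ≡ [] × s ≡ 0
    Thr-finished done = refl , refl
    Thr-finished (tick e _) with () ← e m₀ (λ _ _ → refl)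
    Thr-finished (emit e _ _ _) with () ← e m₀ (λ _ _ → refl)

    Thrs-finished : ∀ {D ts as W} → Thrs D ts as W → allFinished ts ≡ true → as ≡ [] × W ≡ 0
    Thrs-finished [] _ = refl , refl
    Thrs-finished (cons {K = []} t _ th) f with Thr-finished t | Thrs-finished th f
    ... | refl , refl | refl , refl = refl , refl

    Thrs-0 : ∀ {ts as W} → Thrs 0 ts as W → allFinished ts ≡ true
    Thrs-0 [] = refl
    Thrs-0 (cons done z≤n th) = Thrs-0 th

    -- The invariant between parallel steps. All writes to an address carry the value given by `ν`,
    -- so a commit either leaves a cell alone or stores that value, whichever write it selects, and
    -- later writes to the cell change nothing.
    record Progress (as₀ as : List ℕ) (m : Mem) : Set where
      field
        old-or-new : ∀ a → m a ≡ m₀ a ⊎ (toℕ a ∈ as₀ × φ ≤ toℕ a × toℕ (m a) ≡ ν (toℕ a))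
        written    : ∀ a → toℕ a ∈ as₀ → toℕ (m a) ≡ ν (toℕ a) ⊎ toℕ a ∈ as
        pending    : ∀ {α} → α ∈ as → α ∈ as₀

    progress-agree : ∀ {as₀ as m} → Progress as₀ as m → Agr m
    progress-agree P a a< with Progress.old-or-new P a
    ... | inj₁ e = e
    ... | inj₂ (_ , φ≤ , _) = ⊥-elim (<⇒≱ a< φ≤)

    -- Induction on `D`, which bounds the remaining operations of each thread; at 0 all threads have
    -- finished.
    joins : ∀ {Q ρ k W₀ D₀} as₀ →
            (∀ m → Progress as₀ [] m → Terminates Q m (run ρ k) W₀ D₀) →
            ∀ D {ts as W} m → Progress as₀ as m → Thrs D ts as W →
            Terminates Q m (await ts ρ k) (W + W₀) (D + D₀)
    joins {D₀ = D₀} as₀ cont D {ts} m P th with allFinished ts in f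
    ... | true with Thrs-finished th f
    ...   | refl , refl = weaken ≤-refl (m≤n+m D₀ D) (cont m P)
    joins as₀ cont zero m P th | false with () ← trans (sym f) (Thrs-0 th)
    joins {Q} {ρ} {k} {W₀} {D₀} as₀ cont (suc D) {ts} {as} {W} m P th | false =
      subst (λ V → Terminates Q m (join ts ρ k) V (suc (D + D₀)))
        (trans (sym (+-assoc a W′ W₀)) (cong (_+ W₀) (sym work)))
        (go (cong (λ { (ts′ , ws , a) → await ts′ ρ k , ws , a }) eq)
          λ m′ c → joins as₀ cont D m′ (P′ m′ c) rest)
      where
      open Step (step-all {m = m} (progress-agree P) th)
      open Progress
      P′ : ∀ m′ → Commits m ws m′ → Progress as₀ as′ m′
      P′ m′ c .old-or-new a with c a
      ... | inj₁ i = let p , q , r = good i in inj₂ (pending P r , p , q)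
      ... | inj₂ (_ , e) with P .old-or-new a
      ...   | inj₁ o = inj₁ (trans e o)
      ...   | inj₂ (p , q , r) = inj₂ (p , q , trans (cong toℕ e) r)
      P′ m′ c .written a a∈ with c a
      ... | inj₁ i = inj₁ (proj₁ (proj₂ (good i)))
      ... | inj₂ (a∉ , e) with P .written a a∈
      ...   | inj₁ o = inj₁ (trans (cong toℕ e) o)
      ...   | inj₂ i with kept i
      ...     | inj₁ (b , j , q) with refl ← toℕ-injective q = ⊥-elim (a∉ j)
      ...     | inj₂ j = inj₂ j
      P′ m′ c .pending i = pending P (fewer i)

    -- `new` speaks of the cells that are written. `either` allows a cell that no thread wrote to be
    -- recognised as unchanged, as needed for absent children.
    record After (as : ℕ → List ℕ) (N : ℕ) (m : Mem) : Set where
      field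
        below-φ : ∀ {α} → α < φ → val m α ≡ val m₀ α
        new     : ∀ {α j} → j < N → α ∈ as j → val m α ≡ ν α
        either  : ∀ {α} → α < 2 ^ w →
                  val m α ≡ val m₀ α ⊎ ((∃ λ j → j < N × α ∈ as j) × val m α ≡ ν α)

    spawn : ∀ {D ρ i c} N (f : ℕ → ℕ) {as : ℕ → List ℕ} {s : ℕ → ℕ} →
            (∀ j → j < N → Σ ℕ λ s′ → s′ ≤ s j × s′ ≤ D × Thr (ρ [ i ≔ trunc (f j) ]) (c ∷ []) (as j) s′) →
            Σ ℕ λ W → W ≤ sumUpTo s N ×
            Thrs D (map (λ j → run (ρ [ i ≔ trunc j ]) (c ∷ [])) (applyUpTo f N)) (concatUpTo as N) W
    spawn zero    f t = 0 , z≤n , []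
    spawn {ρ = ρ} {i} (suc N) f t =
      let s′ , s′≤ , s′≤D , t₀ = t 0 (s≤s z≤n)
          W , W≤ , th = spawn {ρ = ρ} {i} N (f ∘ suc) (λ j j< → t (suc j) (s≤s j<))
      in s′ + W , +-mono-≤ s′≤ W≤ , cons t₀ s′≤D th

    pardo-terminates : ∀ {Q ρ i r c k W₀ D₀} D {as s} →
      (∀ j → j < toℕ (ρ r) → Σ ℕ λ s′ → s′ ≤ s j × s′ ≤ D × Thr (ρ [ i ≔ trunc j ]) (c ∷ []) (as j) s′) →
      (∀ m → After as (toℕ (ρ r)) m → Terminates Q m (run ρ k) W₀ D₀) →
      ∀ m → (∀ a → m a ≡ m₀ a) →
      Terminates Q m (run ρ (pardo i r c ∷ k)) (suc (sumUpTo s (toℕ (ρ r)) + W₀)) (suc (D + D₀))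
    pardo-terminates {Q} {ρ} {i} {r} {c} {k} {W₀} {D₀} D {as} {s} t cont m m≐ =
      go refl λ m′ co → weaken (+-monoˡ-≤ W₀ W≤) ≤-refl
        (joins as₀ (λ m P → cont m (after m P)) D m′ (start-progress m′ co) threads)
      where
      N = toℕ (ρ r)
      as₀ = concatUpTo as N
      sp = spawn {ρ = ρ} {i} N id t
      W≤ = proj₁ (proj₂ sp)
      threads = proj₂ (proj₂ sp)
      start-progress : ∀ m′ → Commits m [] m′ → Progress as₀ as₀ m′
      start-progress m′ co = record
        { old-or-new = λ a → inj₁ (trans (same a) (m≐ a)) ; written = λ _ → inj₂ ; pending = id }
        where
        same : ∀ a → m′ a ≡ m a
        same a with co a
        ... | inj₁ ()
        ... | inj₂ (_ , e) = e
      after : ∀ m → Progress as₀ [] m → After as N m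
      after m P = record
        { below-φ = λ {α} α< → cong toℕ (progress-agree P (trunc α)
            (≤-<-trans (subst (_≤ α) (sym (toℕ-trunc α)) (m%n≤m α (2 ^ w))) α<))
        ; new = new ; either = either }
        where
        open Progress P
        new : ∀ {α j} → j < N → α ∈ as j → val m α ≡ ν α
        new {α} {j} j<N α∈ with α< ← Thr-addr< (proj₂ (proj₂ (proj₂ (t j j<N)))) α∈
          with written (trunc α) (subst (_∈ as₀) (sym (toℕ-trunc-< α<)) (∈-concatUpTo⁺ as j<N α∈))
        ... | inj₁ e = trans e (cong ν (toℕ-trunc-< α<))
        either : ∀ {α} → α < 2 ^ w → val m α ≡ val m₀ α ⊎ ((∃ λ j → j < N × α ∈ as j) × val m α ≡ ν α)
        either {α} α< with old-or-new (trunc α)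
        ... | inj₁ e = inj₁ (cong toℕ e)
        ... | inj₂ (i , _ , e) = inj₂ (∈-concatUpTo⁻ as N (subst (_∈ as₀) (toℕ-trunc-< α<) i) ,
                                       trans e (cong ν (toℕ-trunc-< α<)))

    -- Symbolic execution of threads

    record ThrE (δ : Env) (K : List Cmd) (as : List ℕ) (s : ℕ) : Set where
      constructor thr
      field execute : ∀ {ρ} → ρ ⊨ δ → Thr ρ K as s

  open Threads
  open ThrE

  while-suc : ∀ {m ρ r c k v} → toℕ (ρ r) ≡ suc v →
              step m (run ρ (while r c ∷ k)) ≡ (run ρ (c ∷ while r c ∷ k) , [] , 1)
  while-suc e rewrite e = refl

  while-zero : ∀ {m ρ r c k} → toℕ (ρ r) ≡ 0 →
               step m (run ρ (while r c ∷ k)) ≡ (run ρ k , [] , 1)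
  while-zero e rewrite e = refl

  ++-assoc′ : ∀ (xs ys zs : List ℕ) → (xs ++ ys) ++ zs ≡ xs ++ ys ++ zs
  ++-assoc′ []       ys zs = refl
  ++-assoc′ (x ∷ xs) ys zs = cong (x ∷_) (++-assoc′ xs ys zs)
  concat-cong : ∀ {f g : ℕ → List ℕ} M → (∀ j → f j ≡ g j) → concatUpTo f M ≡ concatUpTo g M
  concat-cong zero    e = refl
  concat-cong (suc M) e = cong₂ _++_ (e 0) (concat-cong M (e ∘ suc))

  module _ {m₀ : Mem} {φ : ℕ} {ν : ℕ → ℕ} where

    t-asg : ∀ {δ e v β r K as s} → Ev m₀ φ δ e v β → ThrE m₀ φ ν (put r v β δ) K as s →
            ThrE m₀ φ ν δ ((r ⇐ e) ∷ K) as ((cost e + 2) + s)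
    t-asg {r = r} {K} A t = thr λ sat →
      let ρ′ , S , sat′ = assign-steps r K A sat in Thr-steps m₀ φ ν S (execute t sat′)

    t-seq : ∀ {δ c c′ K as s} → ThrE m₀ φ ν δ (c ∷ c′ ∷ K) as s → ThrE m₀ φ ν δ ((c ⨾ c′) ∷ K) as s
    t-seq t = thr λ sat → Thr-seq m₀ φ ν (execute t sat)

    t-done : ∀ {δ} → ThrE m₀ φ ν δ [] [] 0
    t-done = thr λ _ → done

    t-st : ∀ {δ a b α x β γ K as s} → Ev m₀ φ δ a α β → Ev m₀ φ δ b x γ → φ ≤ α → x ≡ ν α →
           ThrE m₀ φ ν δ K as s → ThrE m₀ φ ν δ ((a ↦ b) ∷ K) (α ∷ as) ((cost a + cost b) + suc s)
    t-st {δ} {a} {b} {K = K} {as} A B φ≤ x≡ t = thr λ sat →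
      let ρ₁ , S₁ , e₁ , f₁ = runs A T₀ ((comp (suc T₀) b ⨾ store T₀ (suc T₀)) ∷ K) sat ≤-refl
          ρ₂ , S₂ , e₂ , f₂ = runs B (suc T₀) (store T₀ (suc T₀) ∷ K) (⊨-frame {δ = δ} sat ≤-refl f₁) (n≤1+n T₀)
          eα = trans (cong toℕ (f₂ T₀ ≤-refl)) e₁
          sat₂ = ⊨-frame {δ = δ} (⊨-frame {δ = δ} sat ≤-refl f₁) (n≤1+n T₀) f₂
      in Thr-steps m₀ φ ν (seqS (S₁ ⊕ seqS S₂))
           (subst (λ α → Thr m₀ φ ν ρ₂ (store T₀ (suc T₀) ∷ K) (α ∷ as) _) eα
             (emit (λ _ _ → refl) (subst (φ ≤_) (sym eα) φ≤)
               (trans e₂ (trans x≡ (cong ν (sym eα)))) (execute t sat₂)))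

    t-while : ∀ {r c K as s β} {r< : T (r <ᵇ T₀)} N (env : ℕ → Env) (f : ℕ → List ℕ) b →
      (∀ i → lookupE r (env i) ≡ just (N ∸ i , β)) →
      (∀ i → i < N → ∀ {K as s} → ThrE m₀ φ ν (env (suc i)) K as s → ThrE m₀ φ ν (env i) (c ∷ K) (f i ++ as) (b + s)) →
      ThrE m₀ φ ν (env N) K as s → ThrE m₀ φ ν (env 0) (while r c ∷ K) (concatUpTo f N ++ as) (N * suc b + suc s)
    t-while {r} {c} {K} {as} {s} {r< = r<} N env f b cnt body cont = thr λ {ρ} sat →
      subst (λ z → Thr m₀ φ ν ρ (while r c ∷ K) (z ++ as) _) (concat-cong N (λ j → cong f (+-identityʳ j)))
        (execute (loop N 0 (+-identityʳ N)) sat)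
      where
      loop : ∀ M i → M + i ≡ N → ThrE m₀ φ ν (env i) (while r c ∷ K)
             (concatUpTo (λ j → f (j + i)) M ++ as) (M * suc b + suc s)
      loop zero i refl = thr λ sat →
        tick (λ m _ → while-zero {m} (trans (proj₁ (sat r (<ᵇ⇒< r T₀ r<) (cnt i))) (n∸n≡0 N))) (execute cont sat)
      loop (suc M) i eq = thr λ {ρ} sat →
        subst₂ (Thr m₀ φ ν ρ (while r c ∷ K)) (sym (trans (cong (λ z → (f i ++ z) ++ as) shift) (++-assoc′ (f i) (concatUpTo (λ j → f (j + suc i)) M) as)))
               (cong suc (sym (+-assoc b (M * suc b) (suc s))))
          (tick (λ m _ → while-suc {m} (trans (proj₁ (sat r (<ᵇ⇒< r T₀ r<) (cnt i)))
                  (trans (cong (_∸ i) (sym eq)) (m+n∸n≡m (suc M) i))))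
            (execute (body i (subst (i <_) eq (s≤s (m≤n+m i M))) (loop M (suc i) (trans (+-suc M i) eq))) sat))
        where
        shift : concatUpTo (λ j → f (suc j + i)) M ≡ concatUpTo (λ j → f (j + suc i)) M
        shift = concat-cong M (λ j → cong f (sym (+-suc j i)))

  -- Symbolic execution of the main thread

  infix 4 _≐_

  _≐_ : Mem → Mem → Set
  m′ ≐ m = ∀ a → m′ a ≡ m a

  ⊨-All : ∀ {ρ : Regs} δ → All (λ { (r , v , β) → toℕ (ρ r) ≡ v × v < u ^ β }) δ →
          ∀ r {v β} → lookupE r δ ≡ just (v , β) → toℕ (ρ r) ≡ v × v < u ^ β
  ⊨-All ((r′ , _) ∷ δ) (e ∷ es) r eq with r′ ≡ᵇ r in q
  ⊨-All ((r′ , _) ∷ δ) (e ∷ es) r refl | true with refl ← ≡ᵇ-true r′ r q = e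
  ... | false = ⊨-All δ es r eq

  -- A commit determines the next memory only pointwise, hence the quantification over all memories
  -- pointwise equal to `m`.
  record Main (Q : Regs → Mem → Set) (m : Mem) (δ : Env) (K : List Cmd) (W D : ℕ) : Set where
    constructor main
    field terminates : ∀ {m′ ρ} → m′ ≐ m → ρ ⊨ δ → Terminates Q m′ (run ρ K) W D

  open Main

  steps-terminate : ∀ {Q m φ ρ K ρ′ K′ n W D} → Steps m φ ρ K ρ′ K′ n →
    (∀ m′ → m′ ≐ m → Terminates Q m′ (run ρ′ K′) W D) →
    ∀ m′ → m′ ≐ m → Terminates Q m′ (run ρ K) (n + W) (n + D)
  steps-terminate {Q} {m} S t m′ e = walk S m′ e
    where
    same : ∀ {m′ m″} → m′ ≐ m → Commits m′ [] m″ → m″ ≐ m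
    same e c a with c a
    ... | inj₂ (_ , q) = trans q (e a)
    walk : ∀ {ρ K n} → Steps m _ ρ K _ _ n → ∀ m′ → m′ ≐ m → Terminates Q m′ (run ρ K) (n + _) (n + _)
    walk (one s)    m′ e = go (s m′ (λ a _ → e a)) λ m″ c → t m″ (same e c)
    walk (next s S) m′ e = go (s m′ (λ a _ → e a)) λ m″ c → walk S m″ (same e c)

  m-weaken : ∀ {Q m δ K W D W′ D′} → W ≤ W′ → D ≤ D′ → Main Q m δ K W D → Main Q m δ K W′ D′
  m-weaken p q t = main λ e sat → weaken p q (terminates t e sat)

  m-asg : ∀ {Q m δ e v β r K W D} φ → Ev m φ δ e v β → Main Q m (put r v β δ) K W D →
          Main Q m δ ((r ⇐ e) ∷ K) ((cost e + 2) + W) ((cost e + 2) + D)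
  m-asg {m = m} {r = r} {K} φ A t = main λ {m′} e sat →
    let ρ′ , S , sat′ = assign-steps r K A sat
    in steps-terminate S (λ m″ e → terminates t e sat′) m′ e

  m-seq : ∀ {Q m δ c c′ K W D} → Main Q m δ (c ∷ c′ ∷ K) W D → Main Q m δ ((c ⨾ c′) ∷ K) W D
  m-seq t = main λ e sat → seq (terminates t e sat)
    where
    seq : ∀ {Q m c c′ ρ K W D} → Terminates Q m (run ρ (c ∷ c′ ∷ K)) W D →
          Terminates Q m (run ρ ((c ⨾ c′) ∷ K)) W D
    seq (go s f) = go s f

  m-stop : ∀ {Q m δ W D} → (∀ m′ ρ → m′ ≐ m → ρ ⊨ δ → Q ρ m′) → Main Q m δ [] W D
  m-stop q = main λ e sat → stop (q _ _ e sat)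

  m-forget : ∀ {Q m δ δ′ K W D} → (∀ r {v β} → lookupE r δ′ ≡ just (v , β) → lookupE r δ ≡ just (v , β)) →
             Main Q m δ′ K W D → Main Q m δ K W D
  m-forget sub t = main λ e sat → terminates t e (λ r r< l → sat r r< (sub r l))

  -- The loop register `x i` need only be nonzero before each of the `N` rounds and zero after them,
  -- which covers a countdown as well as a comparison flag.
  m-while : ∀ {Q r c K W D β} {r< : T (r <ᵇ T₀)} N (env : ℕ → Env) (x : ℕ → ℕ) (J : ℕ → Mem → Set) b h →
    (∀ i → lookupE r (env i) ≡ just (x i , β)) → (∀ i → i < N → ∃ λ v → x i ≡ suc v) → x N ≡ 0 →
    (∀ i m → i < N → J i m → ∀ {K W D} → (∀ m′ → J (suc i) m′ → Main Q m′ (env (suc i)) K W D) →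
       Main Q m (env i) (c ∷ K) (b + W) (h + D)) →
    (∀ m → J N m → Main Q m (env N) K W D) →
    ∀ m → J 0 m → Main Q m (env 0) (while r c ∷ K) (N * suc b + suc W) (N * suc h + suc D)
  m-while {Q} {r} {c} {K} {W} {D} {r< = r<} N env x J b h l nz z body cont = loop N 0 (+-identityʳ N)
    where
    loop : ∀ M i → M + i ≡ N → ∀ m → J i m →
           Main Q m (env i) (while r c ∷ K) (M * suc b + suc W) (M * suc h + suc D)
    loop zero i refl m j = main λ e sat →
      steps-terminate {m = m} {φ = 0} (one λ m′ _ → while-zero {m′} (trans (proj₁ (sat r (<ᵇ⇒< r T₀ r<) (l i))) z))
        (λ m″ e′ → terminates (cont m j) e′ sat) _ e
    loop (suc M) i eq m j = main λ e sat →
      steps-terminate {m = m} {φ = 0} (one λ m′ _ → while-suc {m′} (trans (proj₁ (sat r (<ᵇ⇒< r T₀ r<) (l i))) (proj₂ (nz i i<N))))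
        (λ m″ e′ → terminates (m-weaken (≤-reflexive (sym (+-assoc b (M * suc b) (suc W))))
                            (≤-reflexive (sym (+-assoc h (M * suc h) (suc D))))
                     (body i m i<N j (λ m′ j′ → loop M (suc i) (trans (+-suc M i) eq) m′ j′))) e′ sat) _ e
      where i<N = subst (i <_) eq (s≤s (m≤n+m i M))

  m-par : ∀ {Q m δ i r c K W D N β} {r< : T (r <ᵇ T₀)} φ ν → lookupE r δ ≡ just (N , β) → (as : ℕ → List ℕ) (s : ℕ → ℕ) (h : ℕ) →
    (∀ j → j < N → Σ ℕ λ s′ → s′ ≤ s j × s′ ≤ h × ThrE m φ ν (put i j β δ) (c ∷ []) (as j) s′) →
    (∀ m′ → After m φ ν as N m′ → Main Q m′ δ K W D) →
    Main Q m δ (pardo i r c ∷ K) (suc (sumUpTo s N + W)) (suc (h + D))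
  m-par {m = m} {δ} {i} {r} {c} {N = N} {r< = r<} φ ν l as s h t cont = main go′
   where
   go′ : ∀ {m′ ρ} → m′ ≐ m → ρ ⊨ δ → Terminates _ m′ (run ρ _) _ _
   go′ {m′} {ρ} e sat with refl ← proj₁ (sat r (<ᵇ⇒< r T₀ r<) l) =
    pardo-terminates m φ ν h thread (λ m″ af → terminates (cont m″ af) (λ _ → refl) sat) m′ e
    where
    thread : ∀ j → j < N → Σ ℕ λ s′ → s′ ≤ s j × s′ ≤ h × Thr m φ ν (ρ [ i ≔ trunc j ]) (c ∷ []) (as j) s′
    thread j j<N =
      let s′ , p , q , th = t j j<N
          N< = proj₂ (sat r (<ᵇ⇒< r T₀ r<) l)
      in s′ , p , q , ThrE.execute th (⊨-put {δ = δ} (ρ [ i ≔ trunc j ]) i sat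
           (trans (cong toℕ (upd-same ρ i _)) (toℕ-trunc-< (<-trans j<N (toℕ<n (ρ r)))))
           (<-trans j<N N<) (λ s _ i≢s → upd-other ρ _ i≢s))

  -- The memory layout of a level

  module Program (P : Params w u) where
    open Params P

    one< : ∀ {v} → v < u → v < u ^ 1
    one< {v} = subst (v <_) (sym (*-identityʳ u))

    lit< : ∀ a {_ : T (a <ᵇ 256)} → a < u ^ 1
    lit< a {p} = one< (<-≤-trans (<ᵇ⇒< a 256 p) 256≤u)

    0<d : 0 < d
    0<d = ≤-trans (s≤s z≤n) 2≤d

    0<D : 0 < d * L
    0<D = *-mono-≤ 0<d 1≤L

    val-bound : ∀ m α → val m α < u ^ 20
    val-bound m α = subst (val m α <_) 2^w≡u^E (toℕ<n (m (trunc α)))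

    n< : n < u ^ 1
    n< = one< n<u

    d< : d < u ^ 1
    d< = one< d<u

    L< : L < u ^ 1
    L< = one< L<u

    chunks : ℕ
    chunks = n ÷ (d * L) + 1

    chunks< : chunks < u ^ 2
    chunks< = bound-+ 1 1 (≤-<-trans (÷-≤ n (d * L)) n<) (lit< 1)

    <M : ∀ {i} α {_ : T (α ≤ᵇ 8)} → i < u ^ α → i < M
    <M {i} α {p} i< = subst (i <_) (sym M≡u^8) (up α 8 {p} i<)

    record Same (φ : ℕ) (m m′ : Mem) : Set where
      constructor same-by
      field eq : ∀ α → α < φ → val m′ α ≡ val m α

    ev-num : ∀ {m φ δ} a {_ : T (a <ᵇ 256)} → Ev m φ δ (‵ a) a 1
    ev-num a {p} = ev-lit (<-≤-trans (<ᵇ⇒< a 256 p) 256≤u)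

    -- The contents of a node on [o, h) with prefix value π, on the level at B

    field-of : (B π o h f : ℕ) → ℕ
    field-of B π o h 0 = h ∸ o
    field-of B π o h 1 = B + M * 6 + o
    field-of B π o h 2 = B + M * 7 + π * d
    field-of B π o h 3 = o
    field-of B π o h 4 = h
    field-of B π o h 5 = d
    field-of B π o h 6 = d * L
    field-of B π o h 7 = B + M * 2
    field-of B π o h 8 = B + M * 4
    field-of B π o h 9 = B + M * 5 + L * S
    field-of B π o h 10 = B + M * 8
    field-of B π o h _ = n

    -- Records have stride 16, of which 12 cells are used. Prefix values are below `u`, so the
    -- records of a level fit into one array of `M` cells, indexed directly.
    cell : (B π f : ℕ) → ℕ
    cell B π f = B + (M + (π * 16 + f))

    HasNode : Mem → (B π o h : ℕ) → Set
    HasNode m B π o h = ∀ f → f < 12 → val m (cell B π f) ≡ field-of B π o h f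

    cells : (B π : ℕ) → List ℕ
    cells B π = applyUpTo (cell B π) 12

    record NodeRegs (m : Mem) (φ : ℕ) (δ : Env) (B π o h : ℕ) : Set where
      field
        r0  : Ev m φ δ ($ 0) n 1
        r2  : Ev m φ δ ($ 2) d 1
        r3  : Ev m φ δ ($ 3) L 1
        r6  : Ev m φ δ ($ 6) M 9
        r7  : Ev m φ δ ($ 7) (d * L) 2
        r16 : Ev m φ δ ($ 16) S 7
        r26 : Ev m φ δ ($ 26) o 1
        r27 : Ev m φ δ ($ 27) h 1
        r28 : Ev m φ δ ($ 28) π 1
        r29 : Ev m φ δ ($ 29) B 13

    module _ {m : Mem} {φ : ℕ} {ν : ℕ → ℕ} where

      writeNode-ok : ∀ {δ B π o h K as s} → NodeRegs m φ δ B π o h → φ ≤ B →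
        (∀ f → f < 12 → ν (cell B π f) ≡ field-of B π o h f) →
        ThrE m φ ν δ K as s → ThrE m φ ν δ (writeNode ∷ K) (cells B π ++ as) (seqCost writeNode + s)
      writeNode-ok {δ} {B} {π} {o} {h} R φ≤B ν≡ th =
        t-seq (put-field 0 (ev-∸ r27 r26) (t-seq (put-field 1 (ev-+ (ev-+ r29 (ev-* r6 (ev-num 6))) r26)
        (t-seq (put-field 2 (ev-+ (ev-+ r29 (ev-* r6 (ev-num 7))) (ev-* r28 r2)) (t-seq (put-field 3 r26
        (t-seq (put-field 4 r27 (t-seq (put-field 5 r2 (t-seq (put-field 6 r7
        (t-seq (put-field 7 (ev-+ r29 (ev-* r6 (ev-num 2))) (t-seq (put-field 8 (ev-+ r29 (ev-* r6 (ev-num 4)))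
        (t-seq (put-field 9 (ev-+ (ev-+ r29 (ev-* r6 (ev-num 5))) (ev-* r3 r16))
        (t-seq (put-field 10 (ev-+ r29 (ev-* r6 (ev-num 8)))
        (put-field 11 r0 th))))))))))))))))))))))
        where
        open NodeRegs R
        put-field : ∀ f {_ : T (f <ᵇ 12)} {_ : T (f <ᵇ 256)} {e β K as s} → Ev m φ δ e (field-of B π o h f) β →
          ThrE m φ ν δ K as s → ThrE m φ ν δ (field! f e ∷ K) (cell B π f ∷ as)
            ((cost (‵rec ($ 29) ($ 28) (‵ f)) + cost e) + suc s)
        put-field f {p} {q} A t = t-st (ev-+ r29 (ev-+ r6 (ev-+ (ev-* r28 (ev-num 16)) (ev-num f {q})))) A
          (≤-trans φ≤B (m≤m+n B _)) (sym (ν≡ f (<ᵇ⇒< f 12 p))) t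

    module _ {m : Mem} {φ : ℕ} where

      -- After the shift the low `y` bits are zero, so adding `z < 2 ^ y` cannot carry out of the
      -- word.
      ev-fill : ∀ {δ ea ey ez A y z α β γ} → y ≤ w → z < 2 ^ y → Ev m φ δ ea (A ﹪ 2 ^ w) α → Ev m φ δ ey y β → Ev m φ δ ez z γ →
                Ev m φ δ ((ea ≪ᵉ ey) +ᵉ ez) ((A * 2 ^ y + z) ﹪ 2 ^ w) 20
      ev-fill {A = A} {y} {z} y≤w z< EA EY EZ =
        ev-op {γ = 20} ADD (trans (cong (_+ z) (sym (﹪≡% ((A ﹪ 2 ^ w) * 2 ^ y) (2 ^ w)))) (mod-shift A y≤w z<))
          (subst ((A * 2 ^ y + z) ﹪ 2 ^ w <_) 2^w≡u^E v<) v< (ev-≪-mod EA EY) EZ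
        where
        v< : (A * 2 ^ y + z) ﹪ 2 ^ w < 2 ^ w
        v< = ﹪-< _ (0<2^ w)

    base-env : (σ root Q B : ℕ) → Env
    base-env σ root Q B =
      (0 , n , 1) ∷ (1 , σ , 1) ∷ (2 , d , 1) ∷ (3 , L , 1) ∷ (4 , k , 1) ∷ (5 , w , 1) ∷
      (6 , M , 9) ∷ (16 , S , 7) ∷ (7 , d * L , 2) ∷ (8 , d + 1 , 2) ∷ (9 , 2 ^ d ∸ 1 , 1) ∷
      (30 , root , 13) ∷ (10 , Q , 2) ∷ (11 , B , 12) ∷ (37 , 𝟙 (1 <ᵇ Q) , 1) ∷ []

    reassoc : ∀ p b q c r s k z t f W →
      p + suc (b + (q + suc (c + (r + (s + suc (suc (k + suc (z + suc (t + (f + W))))))))))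
        ≡ (p + b + q + c + r + s + k + z + t + f + 6) + W
    reassoc = solve-∀

    M< : M < u ^ 9
    M< = subst (_< u ^ 9) (sym M≡u^8) (^-monoʳ-< u 2≤u (n<1+n 8))

    S< : S < u ^ 7
    S< = subst (_< u ^ 7) (sym S≡u^6) (^-monoʳ-< u 2≤u (n<1+n 6))

    workL depthL : ℕ
    workL  = pre + chunks * L * (costBlocks * d) + mid₁ + chunks * (d + 1) * (costChunks * L) + mid₂ +
             L * suc (suc ((n ÷ (d * L) + 2) * (d + 1) * costRound + restRound)) + n * costPack + n * seqCost clear + n * costScatter + post + 6
    depthL = pre + costBlocks * d + mid₁ + costChunks * L + mid₂ +
             L * suc (suc (costRound + restRound)) + costPack * w + seqCost clear + costScatter + post + 6

    module Level (a : ℕ → ℕ) (B Q Q′ : ℕ) (B<u : B < u ^ 12) (Q<u : Q < u ^ 2)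
                 (Q≡ : Q ≡ Q′ * d) (0<Q′ : 0 < Q′) (σ root : ℕ) (lo hi : ℕ → ℕ) where

      dig : ℕ → ℕ
      dig x = (a x ÷ Q′) ﹪ d

      dig<d : ∀ x → dig x < d
      dig<d x = ﹪-< (a x ÷ Q′) 0<d

      dig< : ∀ x → dig x < u ^ 1
      dig< x = <-trans (dig<d x) d<

      open Counting dig public

      env : (XT p t c : ℕ) → Env
      env XT p t c =
        (0 , n , 1) ∷ (1 , σ , 1) ∷ (2 , d , 1) ∷ (3 , L , 1) ∷ (4 , k , 1) ∷ (5 , w , 1) ∷
        (6 , M , 9) ∷ (16 , S , 7) ∷ (7 , d * L , 2) ∷ (8 , d + 1 , 2) ∷ (9 , 2 ^ d ∸ 1 , 1) ∷
        (30 , root , 13) ∷ (10 , Q , 2) ∷ (11 , B , 12) ∷ (37 , 𝟙 (1 <ᵇ Q) , 1) ∷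
        (12 , Q′ , 2) ∷ (13 , B + M * 2 , 13) ∷ (14 , B + M * 4 , 13) ∷ (15 , XT , 14) ∷
        (17 , p , 1) ∷ (18 , t , 1) ∷ (19 , c , 5) ∷ []

      -- Covers all `M` cells because the last blocks reach beyond `n`: whatever the memory holds
      -- there is counted like a symbol. Such entries never enter `G c x` for `x ≤ n`.
      Symbols : Mem → Set
      Symbols m = ∀ x → x < M → val m (B + x) ≡ a x

      packed-bound : ∀ s {t} → t ≤ d → packed (2 ^ d) s t < u ^ 2
      packed-bound s {t} t≤d = ≤-<-trans (le t) (bound-* 1 1 (≤-<-trans t≤d d<) (one< 2^dd<u))
        where
        le : ∀ t → packed (2 ^ d) s t ≤ t * 2 ^ (d * d)
        le zero    = z≤n
        le (suc t) = subst (packed (2 ^ d) s t + (2 ^ d) ^ dig (s + t) ≤_) (+-comm (t * 2 ^ (d * d)) _)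
          (+-mono-≤ (le t) (≤-trans (^-monoʳ-≤ (2 ^ d) {{m^n≢0 2 d}} (<⇒≤ (dig<d (s + t)))) (≤-reflexive (^-*-assoc 2 d d))))

      shift-eq : ∀ c → 1 * 2 ^ (c * d) ≡ (2 ^ d) ^ c
      shift-eq c = trans (*-identityˡ _) (trans (cong (2 ^_) (*-comm c d)) (sym (^-*-assoc 2 d c)))

      shift-bound : ∀ {c} → c ≤ d → (2 ^ d) ^ c < u ^ 1
      shift-bound {c} c≤d = one< (≤-<-trans (≤-trans (^-monoʳ-≤ (2 ^ d) {{m^n≢0 2 d}} c≤d) (≤-reflexive (^-*-assoc 2 d d))) 2^dd<u)

      Loc Blk : Mem → Set
      Loc m = ∀ b t → b < chunks * L → t < d → val m (B + M * 2 + (b * d + t)) ≡ packed (2 ^ d) (b * d) t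
      Blk m = ∀ b → b < chunks * L → val m (B + M * 3 + b) ≡ packed (2 ^ d) (b * d) d

      blocks< : chunks * L < u ^ 3
      blocks< = bound-* 2 1 chunks< L<

      a<φ : ∀ {i} t → i < M → B + i < B + M * suc t
      a<φ t i< = +-monoʳ-< B (<-≤-trans i< (subst (M ≤_) (sym (*-suc M t)) (m≤m+n M _)))

      e D : ℕ
      e = d + 1
      D = d * L

      e< : e < u ^ 2
      e< = bound-+ 1 1 d< (lit< 1)

      D< : D < u ^ 2
      D< = bound-* 1 1 d< L<

      0<e : 0 < e
      0<e = subst (0 <_) (+-comm 1 d) (s≤s z≤n)

      ≤d : ∀ {c} → c < e → c ≤ d
      ≤d {c} p = s≤s⁻¹ (subst (c <_) (+-comm d 1) p)

      <e : ∀ {c} → c ≤ d → c < e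
      <e {c} p = subst (c <_) (+-comm 1 d) (s≤s p)

      -- The counters of a full block sum to `d`, for which `packed-count` asks this much room;
      -- `d = 2` is the tight case.
      suc-d<2^d : suc d < 2 ^ d
      suc-d<2^d = from 2≤d
        where
        from : ∀ {d} → 2 ≤ d → suc d < 2 ^ d
        from {suc zero} (s≤s ())
        from {suc (suc zero)} _ = ≤-num
        from {suc (suc (suc d))} _ = begin-strict
          4 + d                 <⟨ n<1+n (4 + d) ⟩
          5 + d                 ≤⟨ m≤m+n (5 + d) (d + 1) ⟩
          5 + d + (d + 1)       ≡⟨ lem d ⟩
          2 * (3 + d)           ≤⟨ *-monoʳ-≤ 2 (<⇒≤ (from {suc (suc d)} (s≤s (s≤s z≤n)))) ⟩
          2 * 2 ^ (2 + d)       ∎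
          where
          open ≤-Reasoning
          lem : ∀ d → 5 + d + (d + 1) ≡ 2 * (3 + d)
          lem = solve-∀

      block-count : ∀ c s t → t ≤ d → packed (2 ^ d) s t ﹪ (2 ^ d) ^ c ﹪ (2 ^ d ∸ 1) + G c s ≡ G c (s + t)
      block-count c s t t≤d = packed-count (2 ^ d) c s t (≤-<-trans (s≤s t≤d) suc-d<2^d)

      -- The index encodes a block `j ÷ e` and a bound `j ﹪ e`; the count runs from the start of the
      -- chunk to the start of the block.
      midSpec : ℕ → ℕ
      midSpec j = G (j ﹪ e) (j ÷ e * d) ∸ G (j ﹪ e) (j ÷ e ÷ L * D)

      -- After `t` rounds a row covers the `2 ^ t` chunks before it, or all of them if there are
      -- fewer, which truncated subtraction expresses.
      scanSpec : ℕ → ℕ → ℕ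
      scanSpec t j = G (j ﹪ e) (j ÷ e * D) ∸ G (j ﹪ e) ((j ÷ e ∸ 2 ^ t) * D)

      rows : ℕ
      rows = n ÷ (d * L) + 2

      rows< : rows < u ^ 2
      rows< = bound-+ 1 1 (≤-<-trans (÷-≤ n (d * L)) n<) (lit< 2)

      Mid : Mem → Set
      Mid m = ∀ j → j < chunks * L * e → val m (B + M * 4 + j) ≡ midSpec j

      Scan : ℕ → ℕ → Mem → Set
      Scan t XT m = ∀ j → j < rows * e → val m (XT + j) ≡ scanSpec t j

      pair< : ∀ {b m c} → b < m → c < e → b * e + c < m * e
      pair< {b} {m} {c} b<m c<e = begin-strict
        b * e + c     <⟨ +-monoʳ-< (b * e) c<e ⟩
        b * e + e     ≡⟨ +-comm (b * e) e ⟩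
        suc b * e     ≤⟨ *-monoˡ-≤ e b<m ⟩
        m * e         ∎
        where open ≤-Reasoning

      XT : ℕ → ℕ
      XT t = B + M * 5 + t * S

      XT< : ∀ {t} → t ≤ L → XT t < u ^ 14
      XT< t≤L = bound-+ 13 8 (bound-+ 12 10 B<u (bound-* 9 1 M< (lit< 5))) (bound-* 1 7 (≤-<-trans t≤L L<) S<)

      scanSpec< : ∀ t {j} → j < rows * e → scanSpec t j < u ^ 4
      scanSpec< t {j} j< = ≤-<-trans (≤-trans (m∸n≤m (G (j ﹪ e) (j ÷ e * D)) (G (j ﹪ e) ((j ÷ e ∸ 2 ^ t) * D))) (G-≤ (j ﹪ e) (j ÷ e * D)))
        (bound-* 2 2 (<-trans (÷-< rows j<) rows<) D<)

      row<S : ∀ {j} → j < rows * e → j < S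
      row<S {j} j< = subst (j <_) (sym S≡u^6) (up 4 6 (<-trans j< (bound-* 2 2 rows< e<)))

      record Counted (m : Mem) : Set where
        field
          loc  : Loc m
          mid  : Mid m
          scan : Scan L (XT L) m

      record LevelRegs (m : Mem) (φ : ℕ) (δ : Env) : Set where
        field
          r0  : Ev m φ δ ($ 0) n 1
          r2  : Ev m φ δ ($ 2) d 1
          r7  : Ev m φ δ ($ 7) (d * L) 2
          r8  : Ev m φ δ ($ 8) (d + 1) 2
          r9  : Ev m φ δ ($ 9) (2 ^ d ∸ 1) 1
          r13 : Ev m φ δ ($ 13) (B + M * 2) 13
          r14 : Ev m φ δ ($ 14) (B + M * 4) 13
          r15 : Ev m φ δ ($ 15) (XT L) 14

      module _ {m : Mem} {φ : ℕ} (φ≥ : B + M * 6 ≤ φ) (cm : Counted m) where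
        open Counted cm

        array< : ∀ t {i} → T (t <ᵇ 6) → i < M → B + M * t + i < φ
        array< t {i} t<6 i<M = <-≤-trans (subst (_< B + M * 6) (sym (+-assoc B (M * t) i))
          (+-monoʳ-< B (<-≤-trans (+-monoʳ-< (M * t) i<M)
            (subst (_≤ M * 6) (trans (*-suc M t) (+-comm M (M * t))) (*-monoʳ-≤ M (<ᵇ⇒< t 6 t<6)))))) φ≥

        -- With `i` the chunk and `b` the block of `x`, the summands are `G c (i * D)`, the increase
        -- up to `b * d`, and the increase inside the block; they telescope. The total is at most
        -- `n`, which restores the exponent 1.
        ev-G : ∀ {δ ec ex c x} → LevelRegs m φ δ → Ev m φ δ ec c 1 → Ev m φ δ ex x 1 → c ≤ d → x ≤ n →
               Ev m φ δ (‵G ec ex) (G c x) 1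
        ev-G {δ} {ec} {ex} {c} {x} R C X c≤d x≤n = ev-bd (≤-<-trans (≤-trans (G-≤ c x) x≤n) n<) (ev-≡ sum-≡
          (ev-+ (ev-+ (ev-! {β = 1} (ev-+ r15 (ev-+ (ev-* (ev-/ X r7) r8) C)) scan<φ scan-≡ (G< (≤-trans iD≤bd bd≤x)))
                      (ev-! {β = 1} (ev-+ r14 (ev-+ (ev-* (ev-/ X r2) r8) C)) (array< 4 _ (<M 4 idx<)) mid-≡
                        (≤-<-trans (m∸n≤m (G c (b * d)) (G c (i * D))) (G< bd≤x))))
                (ev-% (ev-% (ev-! {β = 2} (ev-+ r13 X) (array< 2 _ (<M 1 (≤-<-trans x≤n n<))) loc-≡ (packed-bound (b * d) (<⇒≤ t<d)))
                  (ev-≪ {γ = 1} (shift-eq c) (shift-bound c≤d) (ev-lit 2≤u) (ev-* C r2))) r9)))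
          where
          open LevelRegs R
          i = x ÷ D
          b = x ÷ d
          t = x ﹪ d
          t<d = ﹪-< x 0<d
          c<e = <e c≤d
          bd≤x : b * d ≤ x
          bd≤x = ÷-*-≤ x d
          i≡ : b ÷ L ≡ i
          i≡ = ÷-÷ x d L
          iD≤bd : i * D ≤ b * d
          iD≤bd = subst (λ i → i * D ≤ b * d) i≡ (≤-trans (≤-reflexive (lem (b ÷ L) d L)) (*-monoˡ-≤ d (÷-*-≤ b L)))
            where
            lem : ∀ i d L → i * (d * L) ≡ i * L * d
            lem = solve-∀
          G< : ∀ {y} → y ≤ x → G c y < u ^ 1
          G< {y} y≤x = ≤-<-trans (≤-trans (G-≤ c y) (≤-trans y≤x x≤n)) n<
          b<N : b < chunks * L
          b<N = ÷-< (chunks * L) (≤-<-trans x≤n (subst (n <_) (trans (cong (_* D) (+-comm 1 (n ÷ D))) (lem chunks d L)) (<-÷ n 0<D)))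
            where
            lem : ∀ c d L → c * (d * L) ≡ c * L * d
            lem = solve-∀
          i<rows : i < rows
          i<rows = ≤-<-trans (÷-mono D x≤n) (m<m+n (n ÷ D) (s≤s z≤n))
          idx< : b * e + c < u ^ 4
          idx< = bound-+ 3 1 (bound-* 1 2 (≤-<-trans (÷-≤ x d) (≤-<-trans x≤n n<)) e<) (≤-<-trans c≤d d<)
          scan<φ : XT L + (i * e + c) < φ
          scan<φ = subst (_< φ) (sym (+-assoc (B + M * 5) (L * S) _)) (array< 5 _ (<-≤-trans
            (+-monoʳ-< (L * S) (row<S (pair< i<rows c<e)))
            (subst₂ _≤_ (+-comm S (L * S)) (sym M≡u^8) (≤-trans (*-mono-≤ L<u (≤-reflexive S≡u^6)) (^-monoʳ-≤ u (n≤1+n 7))))))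
          -- After `L` rounds `2 ^ L` is at least `n`, hence at least `i`, and the count subtracted
          -- in `scanSpec` is that of an empty range.
          scan-≡ : val m (XT L + (i * e + c)) ≡ G c (i * D)
          scan-≡ = trans (scan _ (pair< i<rows c<e))
            (trans (cong₂ (λ i c → G c (i * D) ∸ G c ((i ∸ 2 ^ L) * D)) (÷-unique i c<e) (﹪-unique i c<e))
                   (cong (λ z → G c (i * D) ∸ G c (z * D)) (m≤n⇒m∸n≡0 (≤-trans (÷-≤ x D) (≤-trans x≤n n≤2^L)))))
          mid-≡ : val m (B + M * 4 + (b * e + c)) ≡ G c (b * d) ∸ G c (i * D)
          mid-≡ = trans (mid _ (pair< b<N c<e))
            (trans (cong₂ (λ b c → G c (b * d) ∸ G c (b ÷ L * D)) (÷-unique b c<e) (﹪-unique b c<e))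
                   (cong (λ i → G c (b * d) ∸ G c (i * D)) i≡))
          loc-≡ : val m (B + M * 2 + x) ≡ packed (2 ^ d) (b * d) t
          loc-≡ = trans (cong (λ x → val m (B + M * 2 + x)) (÷-﹪ x 0<d)) (loc b t b<N t<d)
          sum-≡ : G c (i * D) + (G c (b * d) ∸ G c (i * D)) + packed (2 ^ d) (b * d) t ﹪ (2 ^ d) ^ c ﹪ (2 ^ d ∸ 1) ≡ G c x
          sum-≡ = trans (cong (_+ packed (2 ^ d) (b * d) t ﹪ (2 ^ d) ^ c ﹪ (2 ^ d ∸ 1)) (m+[n∸m]≡n (G-mono c iD≤bd)))
            (trans (+-comm (G c (b * d)) _) (trans (block-count c (b * d) t (<⇒≤ t<d)) (cong (G c) (sym (÷-﹪ x 0<d)))))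

        N-≤ : ∀ c {x} → x ≤ n → N n c x ≤ n
        N-≤ c {x} x≤n = ≤-trans (N-mono n c x≤n) (subst (_≤ n) (sym (N-end n c)) (G-≤ (suc c) n))

        ev-suc : ∀ {δ ec c} → Ev m φ δ ec c 1 → c < d → Ev m φ δ (ec +ᵉ ‵ 1) (suc c) 1
        ev-suc {c = c} C c<d = ev-bd (≤-<-trans c<d d<) (ev-≡ (+-comm c 1) (ev-+ C (ev-lit 2≤u)))

        ev-N : ∀ {δ ec ex c x} → LevelRegs m φ δ → Ev m φ δ ec c 1 → Ev m φ δ ex x 1 → c < d → x ≤ n →
               Ev m φ δ (‵N ec ex) (N n c x) 1
        ev-N {c = c} {x} R C X c<d x≤n = ev-bd (≤-<-trans (N-≤ c x≤n) n<) (ev-≡ (N-alt n c x)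
          (ev-∸ (ev-+ (ev-G R C (LevelRegs.r0 R) (<⇒≤ c<d) ≤-refl) (ev-G R (ev-suc C c<d) X c<d x≤n))
                (ev-G R C X (<⇒≤ c<d) x≤n)))

      π : ℕ → ℕ
      π x = a x ÷ Q

      record Nodes (m : Mem) : Set where
        field
          lo≤    : ∀ x → x < n → lo (π x) ≤ x
          <hi    : ∀ x → x < n → x < hi (π x)
          hi≤n   : ∀ x → x < n → hi (π x) ≤ n
          a<u    : ∀ x → x < n → a x < u
          node   : ∀ x → x < n → HasNode m B (π x) (lo (π x)) (hi (π x))
          member : ∀ x y → x < n → lo (π x) ≤ y → y < hi (π x) → π y ≡ π x

      module _ {m : Mem} {φ : ℕ} (φ≥ : B + M ≤ φ) (sym-m : Symbols m) where

        ev-dig : ∀ {δ e y} → Ev m φ δ ($ 11) B 12 → Ev m φ δ ($ 12) Q′ 2 → Ev m φ δ ($ 2) d 1 → Ev m φ δ e y 5 → y < M → Ev m φ δ (‵dig e) (dig y) 1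
        ev-dig {y = y} r11 r12 r2 Y y<M = ev-bd (dig< y) (ev-% (ev-/ (ev-! {β = 20} (ev-+ r11 Y)
          (<-≤-trans (+-monoʳ-< B y<M) φ≥) (sym-m y y<M)
          (subst (_< u ^ 20) (sym-m y y<M) (val-bound m (B + y)))) r12) r2)

      module Node-word (x : ℕ) = Words w k (hi (π x) ∸ lo (π x)) (λ j → dig (lo (π x) + j)) (x ∸ lo (π x))

      word : ℕ → ℕ
      word x = Node-word.word x

      Packs : Mem → Set
      Packs m = ∀ x → x < n → val m (B + M * 6 + x) ≡ word x

      dig<2^k : ∀ x → dig x < 2 ^ k
      dig<2^k = dig<d

      1≤w : 1 ≤ w
      1≤w = ≤-trans 1≤k k≤w

      cell-base : ∀ f x → cell (B + M * 16) x f ≡ B + M * 17 + (x * 16 + f)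
      cell-base f x = lem B M (x * 16 + f)
        where
        lem : ∀ B M z → B + M * 16 + (M + z) ≡ B + M * 17 + z
        lem = solve-∀

      B′ : ℕ
      B′ = B + M * 16

      lo′ hi′ : ℕ → ℕ
      lo′ π′ = N n (π′ ﹪ d) (lo (π′ ÷ d))
      hi′ π′ = N n (π′ ﹪ d) (hi (π′ ÷ d))

      π′ : ℕ → ℕ
      π′ x = a x ÷ Q′

      parent : ∀ x → π′ x ÷ d ≡ π x
      parent x = trans (÷-÷ (a x) Q′ d) (cong (a x ÷_) (sym Q≡))

      level-regs : ∀ {m φ δ} → lookupE 0 δ ≡ just (n , 1) → lookupE 2 δ ≡ just (d , 1) → lookupE 7 δ ≡ just (d * L , 2) →
        lookupE 8 δ ≡ just (d + 1 , 2) → lookupE 9 δ ≡ just (2 ^ d ∸ 1 , 1) → lookupE 13 δ ≡ just (B + M * 2 , 13) →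
        lookupE 14 δ ≡ just (B + M * 4 , 13) → lookupE 15 δ ≡ just (XT L , 14) → LevelRegs m φ δ
      level-regs {m} {φ} e₀ e₂ e₇ e₈ e₉ e₁₃ e₁₄ e₁₅ = record
        { r0 = v e₀ ; r2 = v e₂ ; r7 = v e₇ ; r8 = v e₈ ; r9 = v e₉ ; r13 = v e₁₃ ; r14 = v e₁₄ ; r15 = v e₁₅ }
        where
        v : ∀ {δ r x β} {p : T (r <ᵇ T₀)} → lookupE r δ ≡ just (x , β) → Ev m φ δ ($ r) x β
        v {p = p} = ev-var p

      record LevelDone (m m′ : Mem) : Set where
        field
          same     : Same (B + M * 2) m m′
          counted  : Counted m′
          packs    : Packs m′
          inverse  : ∀ x → x < n → val m′ (B + M * 8 + pos n x) ≡ x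
          moved    : ∀ x → x < n → val m′ (B′ + pos n x) ≡ a x
          children : ∀ x → x < n → val m′ (B + M * 7 + π′ x) ≡ cell B′ (π′ x) 0
          absent   : ∀ i → i < n → (∀ x → x < n → i ≢ π′ x) → val m′ (B + M * 7 + i) ≡ 0
          nodes    : ∀ x → x < n → HasNode m′ B′ (π′ x) (lo′ (π′ x)) (hi′ (π′ x))

      step-frontier : ∀ t i → i < M → B + M * t + i < B + M * suc t
      step-frontier t i i<M = subst (_< B + M * suc t) (sym (+-assoc B (M * t) i)) (+-monoʳ-< B
        (subst (M * t + i <_) (trans (+-comm (M * t) M) (sym (*-suc M t))) (+-monoʳ-< (M * t) i<M)))

      frontier-≤ : ∀ t t′ {_ : T (t ≤ᵇ t′)} → B + M * t ≤ B + M * t′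
      frontier-≤ t t′ {p} = +-monoʳ-≤ B (*-monoʳ-≤ M (≤ᵇ⇒≤ t t′ p))

      loc-same : ∀ {φ m m′} → B + M * 3 ≤ φ → Same φ m m′ → Loc m → Loc m′
      loc-same φ≥ s l b t b< t< = trans (Same.eq s _ (<-≤-trans (step-frontier 2 _ (<M 5 (bound-+ 4 1 (bound-* 3 1 (<-trans b< blocks<) d<) (<-trans t< d<)))) φ≥)) (l b t b< t<)

      mid-same : ∀ {φ m m′} → B + M * 5 ≤ φ → Same φ m m′ → Mid m → Mid m′
      mid-same φ≥ s l j j< = trans (Same.eq s _ (<-≤-trans (step-frontier 4 _ (<M 5 (<-trans j< (bound-* 3 2 blocks< e<)))) φ≥)) (l j j<)

      scan-frontier : ∀ {j} → j < rows * e → XT L + j < B + M * 6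
      scan-frontier j< = subst (_< B + M * 6) (sym (+-assoc (B + M * 5) (L * S) _)) (step-frontier 5 _ (<-≤-trans
            (+-monoʳ-< (L * S) (row<S j<))
            (subst₂ _≤_ (+-comm S (L * S)) (sym M≡u^8) (≤-trans (*-mono-≤ L<u (≤-reflexive S≡u^6)) (^-monoʳ-≤ u (n≤1+n 7))))))

      scan-same : ∀ {φ m m′} → B + M * 6 ≤ φ → Same φ m m′ → Scan L (XT L) m → Scan L (XT L) m′
      scan-same φ≥ s l j j< = trans (Same.eq s _ (<-≤-trans (scan-frontier j<) φ≥)) (l j j<)

      counted-same : ∀ {φ m m′} → B + M * 6 ≤ φ → Same φ m m′ → Counted m → Counted m′
      counted-same φ≥ s c = record
        { loc  = loc-same (≤-trans (frontier-≤ 3 6) φ≥) s (Counted.loc c)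
        ; mid  = mid-same (≤-trans (frontier-≤ 5 6) φ≥) s (Counted.mid c)
        ; scan = scan-same φ≥ s (Counted.scan c) }

      symbols-same : ∀ {φ m m′} → B + M * 1 ≤ φ → Same φ m m′ → Symbols m → Symbols m′
      symbols-same φ≥ s l x x< = trans (Same.eq s _ (<-≤-trans (a<φ 0 x<) φ≥)) (l x x<)

      cell-frontier : ∀ {π} f → π < u → f < 12 → cell B π f < B + M * 2
      cell-frontier {π} f π<u f<12 = +-monoʳ-< B (<-≤-trans (+-monoʳ-< M (<M 3 (bound-+ 2 1
          (bound-* 1 1 (one< π<u) (lit< 16)) (<-trans f<12 (lit< 12)))))
        (≤-reflexive (lem M)))
        where
        lem : ∀ M → M + M ≡ M * 2
        lem = solve-∀

      hasNode-same : ∀ {φ m m′ π o h} → π < u → B + M * 2 ≤ φ → Same φ m m′ → HasNode m B π o h → HasNode m′ B π o h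
      hasNode-same π<u φ≥ s l f f<12 = trans (Same.eq s _ (<-≤-trans (cell-frontier f π<u f<12) φ≥)) (l f f<12)

      nodes-same : ∀ {φ m m′} → B + M * 2 ≤ φ → Same φ m m′ → Nodes m → Nodes m′
      nodes-same φ≥ s nd = record { Nodes nd ; node = λ x x<n → hasNode-same (≤-<-trans (÷-≤ (a x) Q) (Nodes.a<u nd x x<n)) φ≥ s (Nodes.node nd x x<n) }

      same-trans : ∀ {φ φ₁ φ₂ m₁ m₂ m₃} → φ ≤ φ₁ → φ ≤ φ₂ → Same φ₁ m₁ m₂ → Same φ₂ m₂ m₃ → Same φ m₁ m₃
      same-trans p q s t = same-by λ α α< → trans (Same.eq t α (<-≤-trans α< q)) (Same.eq s α (<-≤-trans α< p))

    -- Correctness and cost of one level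

    module LevelProof (a : ℕ → ℕ) (B Q Q′ : ℕ) (B<u : B < u ^ 12) (Q<u : Q < u ^ 2)
                      (Q≡ : Q ≡ Q′ * d) (0<Q′ : 0 < Q′) (σ root : ℕ) (lo hi : ℕ → ℕ) where
      open Level a B Q Q′ B<u Q<u Q≡ 0<Q′ σ root lo hi

      countBlocks-ok : ∀ {Q₁ m K W H XT p t} → Symbols m →
        (∀ m′ → Same (B + M * 2) m m′ → Loc m′ → Blk m′ → Main Q₁ m′ (env XT p t (chunks * L)) K W H) →
        Main Q₁ m (env XT p t (chunks * L)) (pardo 20 19 countBlocks ∷ K)
          (suc (chunks * L * (costBlocks * d) + W)) (suc (costBlocks * d + H))
      countBlocks-ok {Q₁} {m} {K} {W} {H} {XT} {p} {t} sym-m cont =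
        subst (λ z → Main Q₁ m (env XT p t (chunks * L)) (pardo 20 19 countBlocks ∷ K) (suc (z + W)) (suc (costBlocks * d + H)))
          (sumUpTo-const (costBlocks * d) (chunks * L))
          (m-par (B + M * 2) ν refl as (λ _ → costBlocks * d) (costBlocks * d)
            (λ b b<N → _ , bound , bound , thread b b<N)
            λ m′ af → cont m′ (same-by λ α → After.below-φ af) (loc af) (blk af))
        where
        -- The final content of a cell by array and index; this turns the values to be written into
        -- a function of the address alone.
        V : ℕ → ℕ → ℕ
        V 2 x = packed (2 ^ d) (x ÷ d * d) (x ﹪ d)
        V 3 b = packed (2 ^ d) (b * d) d
        V _ _ = 0
        ν = decode B M V
        slot : ℕ → ℕ → List ℕ
        slot b i = (B + M * 2 + (b * d + i)) ∷ []
        as : ℕ → List ℕ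
        as b = concatUpTo (slot b) d ++ (B + M * 3 + b) ∷ []
        bound : seqCost countPre + (d * suc (seqCost countBody) + suc (seqCost countPost)) ≤ costBlocks * d
        bound = linear (seqCost countPre) (suc (seqCost countBody)) (suc (seqCost countPost)) costBlocks ≤-refl 0<d
        x< : ∀ {b i} → b < chunks * L → i ≤ d → b * d + i < u ^ 5
        x< b< i≤ = bound-+ 4 1 (bound-* 3 1 (<-trans b< blocks<) d<) (≤-<-trans i≤ d<)
        thread : ∀ b → b < chunks * L →
          ThrE m (B + M * 2) ν (put 20 b 5 (env XT p t (chunks * L))) (countBlocks ∷ []) (as b)
            (seqCost countPre + (d * suc (seqCost countBody) + suc (seqCost countPost)))
        thread b b<N =
          t-seq (t-seq (t-asg (ev-up 2 (auto (‵ 0) refl))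
          (t-seq (t-asg (ev-up 7 (ev-≡ (sym (+-identityʳ (b * d))) (auto ($ 20 *ᵉ $ 2) refl)))
          (t-asg (auto ($ 2) refl)
          (t-seq (t-while d δ (slot b) (seqCost countBody) (λ _ → refl) body
          (t-st (auto (($ 11 +ᵉ $ 6 *ᵉ ‵ 3) +ᵉ $ 20) refl) (auto ($ 21) refl)
            (≤-trans (+-monoʳ-≤ B (*-monoʳ-≤ M (≤-num {2} {3}))) (m≤m+n _ b))
            (sym (decode-≡ B M V 3 (<M 3 (<-trans b<N blocks<))))
          t-done))))))))
          where
          δ : ℕ → Env
          δ i = env XT p t (chunks * L) ++ (20 , b , 5) ∷ (21 , packed (2 ^ d) (b * d) i , 2) ∷
                (22 , b * d + i , 7) ∷ (23 , d ∸ i , 1) ∷ []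
          body : ∀ i → i < d → ∀ {K as s} → ThrE m (B + M * 2) ν (δ (suc i)) K as s →
                 ThrE m (B + M * 2) ν (δ i) (countBody ∷ K) (slot b i ++ as) (seqCost countBody + s)
          body i i<d nxt =
            t-seq (t-st (auto ($ 13 +ᵉ $ 22) refl) (auto ($ 21) refl) (m≤m+n (B + M * 2) _)
              (sym (trans (decode-≡ B M V 2 (<M 5 (x< b<N (<⇒≤ i<d))))
                (cong₂ (λ y z → packed (2 ^ d) (y * d) z) (÷-unique b i<d) (﹪-unique b i<d))))
            (t-seq (t-asg (ev-bd (packed-bound (b * d) i<d) (ev-+ (auto ($ 21) refl)
              (ev-≪ {γ = 1} (shift-eq (dig (b * d + i))) (shift-bound (<⇒≤ (dig<d (b * d + i)))) (auto (‵ 1) refl)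
                (ev-* (ev-bd {β′ = 1} (dig< (b * d + i)) (ev-% (ev-/ (ev-! {β = 20} (auto ($ 11 +ᵉ $ 22) refl) (a<φ 1 (<M 5 (x< b<N (<⇒≤ i<d))))
                  (sym-m (b * d + i) (<M 5 (x< b<N (<⇒≤ i<d)))) val<) (auto ($ 12) refl)) (auto ($ 2) refl))) (auto ($ 2) refl)))))
            (t-seq (t-asg (ev-bd (up 5 7 (x< b<N i<d)) (ev-≡ (trans (+-assoc (b * d) i 1) (cong (b * d +_) (+-comm i 1)))
                (auto ($ 22 +ᵉ ‵ 1) refl)))
            (t-asg (ev-≡ (∸-suc d i) (auto ($ 23 ∸ᵉ ‵ 1) refl))
            nxt))))))
            where
            val< : a (b * d + i) < u ^ 20
            val< = subst (_< u ^ 20) (sym-m (b * d + i) (<M 5 (x< b<N (<⇒≤ i<d)))) (val-bound m _)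
        loc : ∀ {m′} → After m (B + M * 2) ν as (chunks * L) m′ → Loc m′
        loc af b i b<N i<d = trans (After.new af b<N (∈-++⁺ˡ (∈-concatUpTo⁺ (slot b) i<d (here refl))))
          (trans (decode-≡ B M V 2 (<M 5 (x< b<N (<⇒≤ i<d))))
            (cong₂ (λ y z → packed (2 ^ d) (y * d) z) (÷-unique b i<d) (﹪-unique b i<d)))
        blk : ∀ {m′} → After m (B + M * 2) ν as (chunks * L) m′ → Blk m′
        blk af b b<N = trans (After.new af b<N (∈-++⁺ʳ (concatUpTo (slot b) d) (here refl)))
          (decode-≡ B M V 3 (<M 3 (<-trans b<N blocks<)))

      countChunks-ok : ∀ {Q₁ m K W H p t} → Blk m →
        (∀ m′ → Same (B + M * 4) m m′ → Mid m′ → Scan 0 (B + M * 5) m′ →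
          Main Q₁ m′ (env (B + M * 5) p t (chunks * e)) K W H) →
        Main Q₁ m (env (B + M * 5) p t (chunks * e)) (pardo 20 19 countChunks ∷ K)
          (suc (chunks * e * (costChunks * L) + W)) (suc (costChunks * L + H))
      countChunks-ok {Q₁} {m} {K} {W} {H} {p} {t} blk cont =
        subst (λ z → Main Q₁ m δ₀ (pardo 20 19 countChunks ∷ K) (suc (z + W)) (suc (costChunks * L + H)))
          (sumUpTo-const (costChunks * L) (chunks * e))
          (m-par (B + M * 4) ν refl as (λ _ → costChunks * L) (costChunks * L)
            (λ j j<N → _ , bound , bound , thread j j<N)
            λ m′ af → cont m′ (same-by λ α → After.below-φ af) (mid af) (scan af))
        where
        δ₀ = env (B + M * 5) p t (chunks * e)
        V : ℕ → ℕ → ℕ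
        V 4 j = midSpec j
        V 5 j = scanSpec 0 j
        V _ _ = 0
        ν = decode B M V
        midCell : ℕ → ℕ → ℕ → ℕ
        midCell i c s = B + M * 4 + ((i * L + s) * e + c)
        as : ℕ → List ℕ
        as j = concatUpTo (λ s → midCell (j ÷ e) (j ﹪ e) s ∷ []) L ++
               (B + M * 5 + ((j ÷ e + 1) * e + j ﹪ e)) ∷ (B + M * 5 + j ﹪ e) ∷ []
        bound : seqCost chunkPre + (L * suc (seqCost chunkBody) + suc (seqCost chunkPost)) ≤ costChunks * L
        bound = linear (seqCost chunkPre) (suc (seqCost chunkBody)) (suc (seqCost chunkPost)) costChunks ≤-refl 1≤L
        b< : ∀ {i s} → i < chunks → s < L → i * L + s < chunks * L
        b< {i} {s} i< s< = ≤-trans (subst (suc (i * L + s) ≤_) (+-comm (i * L) L) (+-monoʳ-< (i * L) s<)) (*-monoˡ-≤ L i<)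
        idx< : ∀ {b c} → b < u ^ 3 → c ≤ d → b * e + c < u ^ 6
        idx< b< c≤ = bound-+ 5 1 (bound-* 3 2 b< e<) (≤-<-trans c≤ d<)
        mid-≡ : ∀ {i c s} → s < L → c < e → midSpec ((i * L + s) * e + c) ≡ G c ((i * L + s) * d) ∸ G c (i * D)
        mid-≡ {i} {c} {s} s<L c<e = cong₂ (λ b c → G c (b * d) ∸ G c (b ÷ L * D)) (÷-unique (i * L + s) c<e) (﹪-unique (i * L + s) c<e)
          ■ cong (λ i′ → G c ((i * L + s) * d) ∸ G c (i′ * D)) (÷-unique i s<L)
          where _■_ = trans
        thread : ∀ j → j < chunks * e →
          ThrE m (B + M * 4) ν (put 20 j 5 δ₀) (countChunks ∷ []) (as j)
            (seqCost chunkPre + (L * suc (seqCost chunkBody) + suc (seqCost chunkPost)))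
        thread j j<N =
          t-seq (t-seq (t-asg (ev-bd (<-trans i<chunks chunks<) (auto ($ 20 /ᵉ $ 8) refl))
          (t-seq (t-asg (ev-bd (≤-<-trans c≤d d<) (auto ($ 20 %ᵉ $ 8) refl))
          (t-seq (t-asg (ev-up 5 (ev-≡ (sym H₀) (auto (‵ 0) refl)))
          (t-seq (t-asg (ev-up 4 (ev-≡ (sym (+-identityʳ (i * L))) (auto ($ 21 *ᵉ $ 3) refl)))
          (t-asg (auto ($ 3) refl)
          (t-seq (t-while L δ (λ s → midCell i c s ∷ []) (seqCost chunkBody) (λ _ → refl) body
          (t-seq (t-st (auto ($ 15 +ᵉ (($ 21 +ᵉ ‵ 1) *ᵉ $ 8 +ᵉ $ 22)) refl) (auto ($ 23) refl)
            (φ≤ 1 _)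
            (trans H-end (sym (decode-≡ B M V 5 (<M 6 (idx< (bound-+ 2 1 (<-trans i<chunks chunks<) (lit< 1)) c≤d)))))
          (t-st (auto ($ 15 +ᵉ $ 22) refl) (auto (‵ 0) refl) (φ≤ 1 _)
            (trans scan₀ (sym (decode-≡ B M V 5 (<M 1 (≤-<-trans c≤d d<)))))
          t-done))))))))))))))
          where
          i = j ÷ e
          c = j ﹪ e
          i<chunks : i < chunks
          i<chunks = ÷-< chunks j<N
          c<e : c < e
          c<e = ﹪-< j 0<e
          c≤d = ≤d c<e
          H′ : ℕ → ℕ
          H′ s = G c ((i * L + s) * d) ∸ G c (i * D)
          G₀≤ : ∀ s → G c (i * D) ≤ G c ((i * L + s) * d)
          G₀≤ s = G-mono c (≤-trans (≤-reflexive (lem i d L)) (*-monoˡ-≤ d (m≤m+n (i * L) s)))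
            where
            lem : ∀ i d L → i * (d * L) ≡ i * L * d
            lem = solve-∀
          H₀ : H′ 0 ≡ 0
          H₀ = trans (cong (λ z → G c z ∸ G c (i * D)) (lem i d L)) (n∸n≡0 (G c (i * D)))
            where
            lem : ∀ i d L → (i * L + 0) * d ≡ i * (d * L)
            lem = solve-∀
          Hs : ∀ s → H′ s + packed (2 ^ d) ((i * L + s) * d) d ﹪ (2 ^ d) ^ c ﹪ (2 ^ d ∸ 1) ≡ H′ (suc s)
          Hs s = begin
            (X ∸ Z) + Y                 ≡⟨ +-comm (X ∸ Z) Y ⟩
            Y + (X ∸ Z)                 ≡⟨ +-∸-assoc Y (G₀≤ s) ⟨
            (Y + X) ∸ Z                 ≡⟨ cong (_∸ Z) (block-count c ((i * L + s) * d) d ≤-refl) ⟩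
            G c ((i * L + s) * d + d) ∸ Z  ≡⟨ cong (λ z → G c z ∸ Z) (lem i L s d) ⟩
            H′ (suc s)                  ∎
            where
            open ≡-Reasoning
            X = G c ((i * L + s) * d)
            Z = G c (i * D)
            Y = packed (2 ^ d) ((i * L + s) * d) d ﹪ (2 ^ d) ^ c ﹪ (2 ^ d ∸ 1)
            lem : ∀ i L s d → (i * L + s) * d + d ≡ (i * L + suc s) * d
            lem = solve-∀
          H-end : H′ L ≡ scanSpec 0 ((i + 1) * e + c)
          H-end = trans (cong₂ (λ x y → G c x ∸ G c (y * D)) (lem i L d) (sym (m+n∸n≡m i 1)))
            (sym (cong₂ (λ b c → G c (b * D) ∸ G c ((b ∸ 1) * D)) (÷-unique (i + 1) c<e) (﹪-unique (i + 1) c<e)))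
            where
            lem : ∀ i L d → (i * L + L) * d ≡ (i + 1) * (d * L)
            lem = solve-∀
          scan₀ : 0 ≡ scanSpec 0 c
          scan₀ = sym (cong (λ b → G (c ﹪ e) (b * D) ∸ G (c ﹪ e) ((b ∸ 1) * D)) (÷-unique 0 c<e))
          φ≤ : ∀ t x → B + M * 4 ≤ B + M * (4 + t) + x
          φ≤ t x = ≤-trans (+-monoʳ-≤ B (*-monoʳ-≤ M (m≤m+n 4 t))) (m≤m+n _ x)
          H< : ∀ {s} → s ≤ L → H′ s < u ^ 5
          H< {s} s≤L = ≤-<-trans (≤-trans (m∸n≤m _ (G c (i * D))) (G-≤ c _))
            (bound-* 4 1 (bound-+ 3 1 (bound-* 2 1 (<-trans i<chunks chunks<) L<) (≤-<-trans s≤L L<)) d<)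
          δ : ℕ → Env
          δ s = δ₀ ++ (20 , j , 5) ∷ (21 , i , 2) ∷ (22 , c , 1) ∷ (23 , H′ s , 5) ∷
                (24 , i * L + s , 4) ∷ (25 , L ∸ s , 1) ∷ []
          body : ∀ s → s < L → ∀ {K as r} → ThrE m (B + M * 4) ν (δ (suc s)) K as r →
                 ThrE m (B + M * 4) ν (δ s) (chunkBody ∷ K) (midCell i c s ∷ as) (seqCost chunkBody + r)
          body s s<L nxt =
            t-seq (t-st (auto ($ 14 +ᵉ ($ 24 *ᵉ $ 8 +ᵉ $ 22)) refl) (auto ($ 23) refl) (m≤m+n _ _)
              (sym (trans (decode-≡ B M V 4 (<M 6 (idx< (<-trans bs< blocks<) c≤d))) (mid-≡ {i} s<L c<e)))
            (t-seq (t-asg (ev-bd (H< s<L) (ev-≡ (Hs s) (ev-+ (auto ($ 23) refl)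
                (ev-% (ev-% (ev-! {β = 2} (auto (($ 11 +ᵉ $ 6 *ᵉ ‵ 3) +ᵉ $ 24) refl) below₃ (blk (i * L + s) bs<) (packed-bound _ ≤-refl))
                  (ev-≪ {γ = 1} (shift-eq c) (shift-bound c≤d) (auto (‵ 1) refl) (auto ($ 22 *ᵉ $ 2) refl)))
                  (auto ($ 9) refl)))))
            (t-seq (t-asg (ev-bd (bound-+ 3 1 (bound-* 2 1 (<-trans i<chunks chunks<) L<) (≤-<-trans s<L L<))
                (ev-≡ (trans (+-assoc (i * L) s 1) (cong (i * L +_) (+-comm s 1))) (auto ($ 24 +ᵉ ‵ 1) refl)))
            (t-asg (ev-≡ (∸-suc L s) (auto ($ 25 ∸ᵉ ‵ 1) refl))
            nxt))))))
            where
            bs< = b< i<chunks s<L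
            below₃ : B + M * 3 + (i * L + s) < B + M * 4
            below₃ = subst (_< B + M * 4) (sym (+-assoc B (M * 3) _))
              (+-monoʳ-< B (subst (M * 3 + (i * L + s) <_) (lem M) (+-monoʳ-< (M * 3) (<M 3 (<-trans bs< blocks<)))))
              where
              lem : ∀ M → M * 3 + M ≡ M * 4
              lem = solve-∀
        mid : ∀ {m′} → After m (B + M * 4) ν as (chunks * e) m′ → Mid m′
        mid {m′} af y y<N = subst (λ y → val m′ (B + M * 4 + y) ≡ midSpec y) y≡
          (trans (After.new af (pair< i<chunks c<e)
              (∈-++⁺ˡ (∈-concatUpTo⁺ (λ s → midCell ((i * e + c) ÷ e) ((i * e + c) ﹪ e) s ∷ []) s<L
                (here (cong₂ (λ i c → midCell i c s) (sym (÷-unique i c<e)) (sym (﹪-unique i c<e)))))))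
            (decode-≡ B M V 4 (<M 6 (idx< (<-trans (b< i<chunks s<L) blocks<) (≤d c<e)))))
          where
          b = y ÷ e
          c = y ﹪ e
          i = b ÷ L
          s = b ﹪ L
          s<L = ﹪-< b 1≤L
          c<e = ﹪-< y 0<e
          i<chunks : i < chunks
          i<chunks = ÷-< chunks (÷-< (chunks * L) y<N)
          y≡ : (i * L + s) * e + c ≡ y
          y≡ = trans (cong (λ b → b * e + c) (sym (÷-﹪ b 1≤L))) (sym (÷-﹪ y 0<e))
        scan : ∀ {m′} → After m (B + M * 4) ν as (chunks * e) m′ → Scan 0 (B + M * 5) m′
        scan {m′} af y y<N = subst (λ y → val m′ (B + M * 5 + y) ≡ scanSpec 0 y) (sym (÷-﹪ y 0<e))
          (from (y ÷ e) (y ﹪ e) (÷-< rows y<N) (﹪-< y 0<e))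
          where
          from : ∀ i c → i < rows → c < e → val m′ (B + M * 5 + (i * e + c)) ≡ scanSpec 0 (i * e + c)
          -- Row 0 is written from every chunk; chunk 0 always exists and supplies the witness. Any
          -- other row comes from the chunk before it.
          from zero c i< c<e = trans (After.new af {j = 0 * e + c} (pair< {0} {chunks} (subst (0 <_) (+-comm 1 _) (s≤s z≤n)) c<e)
              (∈-++⁺ʳ (concatUpTo (λ s → midCell ((0 * e + c) ÷ e) ((0 * e + c) ﹪ e) s ∷ []) L)
                (there (here (cong (B + M * 5 +_) (sym (﹪-unique 0 c<e)))))))
            (decode-≡ B M V 5 (<M 1 (≤-<-trans (≤d c<e) d<)))
          from (suc i) c i< c<e = trans (After.new af {j = i * e + c} (pair< {i} {chunks} i<chunks c<e)
              (∈-++⁺ʳ (concatUpTo (λ s → midCell ((i * e + c) ÷ e) ((i * e + c) ﹪ e) s ∷ []) L)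
                (here (cong₂ (λ i c → B + M * 5 + (i * e + c)) (trans (+-comm 1 i) (cong (_+ 1) (sym (÷-unique i c<e)))) (sym (﹪-unique i c<e))))))
            (decode-≡ B M V 5 (<M 5 (bound-+ 4 1 (bound-* 2 2 (<-trans i< rows<) e<) (≤-<-trans (≤d c<e) d<))))
            where
            i<chunks : i < chunks
            i<chunks = s≤s⁻¹ (subst (suc i <_) (+-suc (n ÷ D) 1) i<)

      -- The ranges counted at row `i` and at row `i - 2 ^ t` are adjacent, so their counts add up.
      -- If fewer than `2 ^ t` rows precede, the count is already complete and the factor suppresses
      -- the second summand.
      scan-step : ∀ t j → scanSpec t j + scanSpec t (j ∸ 2 ^ t * e) * 𝟙 (2 ^ t <ᵇ j ÷ e + 1) ≡ scanSpec (suc t) j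
      scan-step t j with 2 ^ t ≤? j ÷ e
      ... | no ≰ = begin
          scanSpec t j + scanSpec t (j ∸ p * e) * 𝟙 (p <ᵇ i + 1)
            ≡⟨ cong (λ b → scanSpec t j + scanSpec t (j ∸ p * e) * 𝟙 b) (<ᵇ-false (subst (_≤ p) (+-comm 1 i) i<p)) ⟩
          scanSpec t j + scanSpec t (j ∸ p * e) * 0
            ≡⟨ trans (cong (scanSpec t j +_) (*-zeroʳ (scanSpec t (j ∸ p * e)))) (+-identityʳ _) ⟩
          scanSpec t j
            ≡⟨ cong (λ z → G c (i * D) ∸ G c (z * D)) (trans (m≤n⇒m∸n≡0 (<⇒≤ i<p)) (sym (m≤n⇒m∸n≡0 (≤-trans (<⇒≤ i<p) (m≤m+n p _))))) ⟩
          scanSpec (suc t) j ∎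
        where
        open ≡-Reasoning
        p = 2 ^ t
        i = j ÷ e
        c = j ﹪ e
        i<p = ≰⇒> ≰
      ... | yes p≤i = begin
          scanSpec t j + scanSpec t (j ∸ p * e) * 𝟙 (p <ᵇ i + 1)
            ≡⟨ cong (λ b → scanSpec t j + scanSpec t (j ∸ p * e) * 𝟙 b) (<ᵇ-true (subst (p <_) (+-comm 1 i) (s≤s p≤i))) ⟩
          scanSpec t j + scanSpec t (j ∸ p * e) * 1
            ≡⟨ cong (scanSpec t j +_) (trans (*-identityʳ _) (trans (cong (scanSpec t) earlier)
                 (cong₂ (λ i c → G c (i * D) ∸ G c ((i ∸ p) * D)) (÷-unique (i ∸ p) c<e) (﹪-unique (i ∸ p) c<e)))) ⟩
          (G c (i * D) ∸ G c ((i ∸ p) * D)) + (G c ((i ∸ p) * D) ∸ G c ((i ∸ p ∸ p) * D))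
            ≡⟨ chain (G-mono c (*-monoˡ-≤ D (m∸n≤m i p))) (G-mono c (*-monoˡ-≤ D (m∸n≤m (i ∸ p) p))) ⟩
          G c (i * D) ∸ G c ((i ∸ p ∸ p) * D)
            ≡⟨ cong (λ z → G c (i * D) ∸ G c (z * D)) (trans (∸-+-assoc i p p) (cong (λ z → i ∸ (p + z)) (sym (+-identityʳ p)))) ⟩
          scanSpec (suc t) j ∎
        where
        open ≡-Reasoning
        p = 2 ^ t
        i = j ÷ e
        c = j ﹪ e
        c<e = ﹪-< j 0<e
        earlier : j ∸ p * e ≡ (i ∸ p) * e + c
        earlier = trans (cong (_∸ p * e) (trans (÷-﹪ j 0<e) (+-comm (i * e) c)))
          (trans (+-∸-assoc c (*-monoˡ-≤ e p≤i)) (trans (+-comm c _) (cong (_+ c) (sym (*-distribʳ-∸ e i p)))))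
        chain : ∀ {x y z} → y ≤ x → z ≤ y → (x ∸ y) + (y ∸ z) ≡ x ∸ z
        chain {x} {y} {z} y≤x z≤y = trans (sym (+-∸-assoc (x ∸ y) z≤y)) (cong (_∸ z) (m∸n+n≡m y≤x))

      scanRound-ok : ∀ {Q₁ m K W H r} t → t < L → Scan t (XT t) m →
        (∀ m′ → Same (XT t + S) m m′ → Scan (suc t) (XT t + S) m′ → Main Q₁ m′ (env (XT t) (2 ^ t) r (rows * e)) K W H) →
        Main Q₁ m (env (XT t) (2 ^ t) r (rows * e)) (pardo 20 19 scanRound ∷ K)
          (suc (rows * e * costRound + W)) (suc (costRound + H))
      scanRound-ok {Q₁} {m} {K} {W} {H} {r} t t<L sc cont =
        subst (λ z → Main Q₁ m δ₀ (pardo 20 19 scanRound ∷ K) (suc (z + W)) (suc (costRound + H)))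
          (sumUpTo-const costRound (rows * e))
          (m-par (XT t + S) ν refl (λ j → XT t + S + j ∷ []) (λ _ → costRound) costRound
            (λ j j<N → _ , ≤-num , ≤-num , thread j j<N)
            λ m′ af → cont m′ (same-by λ α → After.below-φ af)
              (λ j j<N → trans (After.new af j<N (here refl)) (cong (scanSpec (suc t)) (m+n∸m≡n (XT t + S) j))))
        where
        δ₀ = env (XT t) (2 ^ t) r (rows * e)
        ν = λ α → scanSpec (suc t) (α ∸ (XT t + S))
        thread : ∀ j → j < rows * e → ThrE m (XT t + S) ν (put 20 j 5 δ₀) (scanRound ∷ []) (XT t + S + j ∷ []) costRound
        thread j j<N =
          t-st (auto (($ 15 +ᵉ $ 16) +ᵉ $ 20) refl)
            (ev-+ (ev-! {β = 4} (auto ($ 15 +ᵉ $ 20) refl) (+-monoʳ-< (XT t) (row<S j<N)) (sc j j<N) (scanSpec< t j<N))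
              (ev-* (ev-! {β = 4} (auto ($ 15 +ᵉ ($ 20 ∸ᵉ $ 17 *ᵉ $ 8)) refl) (+-monoʳ-< (XT t) (row<S j′<)) (sc _ j′<) (scanSpec< t j′<))
                (auto ($ 17 <ᵉ (($ 20 /ᵉ $ 8) +ᵉ ‵ 1)) refl)))
            (m≤m+n _ j)
            (trans (scan-step t j) (cong (scanSpec (suc t)) (sym (m+n∸m≡n (XT t + S) j))))
          t-done
          where
          j′< : j ∸ 2 ^ t * e < rows * e
          j′< = ≤-<-trans (m∸n≤m j (2 ^ t * e)) j<N

      scan-ok : ∀ {Q₁ m K W H} → Scan 0 (XT 0) m →
        (∀ m′ → Same (B + M * 5) m m′ → Scan L (XT L) m′ → Main Q₁ m′ (env (XT L) (2 ^ L) (L ∸ L) (rows * e)) K W H) →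
        Main Q₁ m (env (XT 0) 1 L (rows * e))
          (while 18 (pardo 20 19 scanRound ⨾ 15 ⇐ $ 15 +ᵉ $ 16 ⨾ 17 ⇐ $ 17 *ᵉ ‵ 2 ⨾ 18 ⇐ $ 18 ∸ᵉ ‵ 1) ∷ K)
          (L * suc (suc (rows * e * costRound + restRound)) + suc W) (L * suc (suc (costRound + restRound)) + suc H)
      scan-ok {Q₁} {m} sc cont =
        m-while L (λ t → env (XT t) (2 ^ t) (L ∸ t) (rows * e)) (L ∸_) (λ t m′ → Same (B + M * 5) m m′ × Scan t (XT t) m′)
          (suc (rows * e * costRound + restRound)) (suc (costRound + restRound))
          (λ t → refl) (λ t t<L → L ∸ suc t , sym (trans (sym (+-∸-assoc 1 t<L)) refl)) (n∸n≡0 L)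
          (λ t m₁ t<L (same , sc₁) {K} {W} {H} next′ →
            m-weaken (≤-reflexive (sym (cong suc (+-assoc (rows * e * costRound) restRound W)))) ≤-refl
            (m-seq (scanRound-ok t t<L sc₁ λ m₂ same₂ sc₂ →
              m-seq (m-asg 0 (ev-bd (XT< t<L) (ev-≡ (XT-suc t) (auto ($ 15 +ᵉ $ 16) refl)))
              (m-seq (m-asg 0 (ev-bd (one< (≤-<-trans (^-monoʳ-≤ 2 t<L) 2^L<u)) (ev-≡ (*-comm (2 ^ t) 2) (auto ($ 17 *ᵉ ‵ 2) refl)))
              (m-asg 0 (ev-≡ (∸-suc L t) (auto ($ 18 ∸ᵉ ‵ 1) refl))
              (next′ m₂ ((same-by λ α α< → trans (Same.eq same₂ α (<-≤-trans α< (≤-trans (m≤m+n (B + M * 5) (t * S)) (m≤m+n _ S)))) (Same.eq same α α<)) ,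
                 subst (λ x → Scan (suc t) x m₂) (XT-suc t) sc₂)))))))))
          (λ m′ (same , sc′) → cont m′ same sc′)
          m (same-by (λ _ _ → refl) , sc)
        where
        XT-suc : ∀ t → XT t + S ≡ XT (suc t)
        XT-suc t = trans (+-assoc (B + M * 5) (t * S) S) (cong (B + M * 5 +_) (+-comm (t * S) S))

      module _ {m : Mem} (nodes : Nodes m) where
        open Nodes nodes

        number : ℕ → ℕ
        number x = Node-word.number x

        -- A potential argument that makes packing linear: `Φ x` counts the entries of the level
        -- before the first entry of word `x`. Inside a node it grows by at least `number x`, by
        -- `number-telescopes`; from one node to the next nothing is lost, since each word stays
        -- inside its node.
        sum-number : sumUpTo number n ≤ n
        sum-number = ≤-trans (m≤m+n _ (Φ 0)) (≤-trans (sum-telescope number Φ n step′) (≤-reflexive Φn))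
          where
          Φ₀ Φ : ℕ → ℕ
          Φ₀ x = lo (π x) + (hi (π x) ∸ lo (π x)) ⊓ Node-word.first x
          -- There is no node at position `n`, so the final potential is set by hand.
          Φ x = if x <ᵇ n then Φ₀ x else n
          Φn : Φ n ≡ n
          Φn = cong (λ b → if b then Φ₀ n else n) (<ᵇ-false {n} ≤-refl)
          Φ< : ∀ {x} → x < n → Φ x ≡ Φ₀ x
          Φ< {x} x<n = cong (λ b → if b then Φ₀ x else n) (<ᵇ-true x<n)
          -- As `k ≤ w`, word `q` of a node begins at entry `q` or later; so the potential at the
          -- start of the next node is not below the end of this one.
          Φ₀-≥ : ∀ {x} → x < n → x ≤ Φ₀ x
          Φ₀-≥ {x} x<n = subst (_≤ Φ₀ x) (m+[n∸m]≡n (lo≤ x x<n)) (+-monoʳ-≤ (lo (π x))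
            (⊓-glb (∸-monoˡ-≤ (lo (π x)) (<⇒≤ (<hi x x<n))) (≤-÷ 1≤k (*-monoʳ-≤ (x ∸ lo (π x)) k≤w))))
          lo≤hi : ∀ {x} → x < n → lo (π x) ≤ hi (π x)
          lo≤hi {x} x<n = ≤-trans (lo≤ x x<n) (<⇒≤ (<hi x x<n))
          U : ℕ → ℕ
          U x = lo (π x) + (hi (π x) ∸ lo (π x)) ⊓ (((x ∸ lo (π x)) * w + w) ÷ k)
          U≤hi : ∀ {x} → x < n → U x ≤ hi (π x)
          U≤hi {x} x<n = subst (U x ≤_) (m+[n∸m]≡n (lo≤hi x<n)) (+-monoʳ-≤ (lo (π x)) (m⊓n≤m _ _))
          U≤ : ∀ {x} → x < n → U x ≤ Φ (suc x)
          U≤ {x} x<n with suc x <? n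
          ... | no p = ≤-trans (≤-trans (U≤hi x<n) (hi≤n x x<n))
                  (≤-reflexive (sym (cong (λ b → if b then Φ₀ (suc x) else n) (<ᵇ-false (≮⇒≥ p)))))
          ... | yes sx<n with suc x <? hi (π x)
          ...   | no p = ≤-trans (≤-trans (U≤hi x<n) (≮⇒≥ p)) (≤-trans (Φ₀-≥ sx<n) (≤-reflexive (sym (Φ< sx<n))))
          ...   | yes p = ≤-reflexive (trans (cong (λ z → lo (π x) + (hi (π x) ∸ lo (π x)) ⊓ (z ÷ k)) shift)
                  (sym (trans (Φ< sx<n) (cong (λ z → lo z + (hi z ∸ lo z) ⊓ ((suc x ∸ lo z) * w ÷ k))
                    (member x (suc x) x<n (≤-trans (lo≤ x x<n) (n≤1+n x)) p)))))
            where
            shift : (x ∸ lo (π x)) * w + w ≡ (suc x ∸ lo (π x)) * w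
            shift = trans (+-comm _ w) (cong (_* w) (sym (+-∸-assoc 1 (lo≤ x x<n))))
          step′ : ∀ x → x < n → number x + Φ x ≤ Φ (suc x)
          step′ x x<n = begin
            number x + Φ x      ≡⟨ cong (number x +_) (Φ< x<n) ⟩
            number x + Φ₀ x     ≡⟨ lem (number x) (lo (π x)) _ ⟩
            lo (π x) + (number x + (hi (π x) ∸ lo (π x)) ⊓ Node-word.first x)
                                ≤⟨ +-monoʳ-≤ (lo (π x)) (Node-word.number-telescopes x) ⟩
            U x                 ≤⟨ U≤ x<n ⟩
            Φ (suc x)           ∎
            where
            open ≤-Reasoning
            lem : ∀ a b c → a + (b + c) ≡ b + (a + c)
            lem = solve-∀

        pack-ok : ∀ {Q₁ K W H X p t c} → Symbols m →
          (∀ m′ → Same (B + M * 6) m m′ → Packs m′ → Main Q₁ m′ (env X p t c) K W H) →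
          Main Q₁ m (env X p t c) (pardo 20 0 pack ∷ K) (suc (n * costPack + W)) (suc (costPack * w + H))
        pack-ok {Q₁} {K} {W} {H} {X} {p} {t} {c} sym-m cont =
          -- The slowest thread may need `w` rounds, which the depth can afford; the work is summed
          -- over the actual numbers of rounds.
          m-weaken (s≤s (+-monoˡ-≤ W total)) ≤-refl
          (m-par (B + M * 6) ν refl cells′ cost′ (costPack * w)
            (λ x x<n → _ , ≤-refl , bound x , thread x x<n)
            λ m′ af → cont m′ (same-by λ α → After.below-φ af)
              (λ x x<n → trans (After.new af x<n (∈-++⁺ʳ (concatUpTo (λ _ → []) (number x)) (here refl))) (cong word (m+n∸m≡n (B + M * 6) x))))
          where
          cells′ : ℕ → List ℕ
          cells′ x = concatUpTo (λ _ → []) (number x) ++ B + M * 6 + x ∷ []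
          δ₀ = env X p t c
          ν = λ α → word (α ∸ (B + M * 6))
          pr = seqCost packPre
          bo = suc (seqCost packBody)
          po = suc (seqCost packPost)
          cost′ : ℕ → ℕ
          cost′ x = pr + (number x * bo + po)
          bound : ∀ x → cost′ x ≤ costPack * w
          bound x = ≤-trans (+-monoʳ-≤ pr (+-monoˡ-≤ po (*-monoˡ-≤ bo (Node-word.number-≤ x 1≤k)))) (linear pr bo po costPack ≤-refl {w} 1≤w)
          total : sumUpTo cost′ n ≤ n * costPack
          total = ≤-trans (≤-reflexive (sumUpTo-affine pr bo po number n))
            (≤-trans (+-monoʳ-≤ (n * (pr + po)) (*-monoˡ-≤ bo sum-number))
              (≤-reflexive (lem n pr bo po)))
            where
            lem : ∀ n p b q → n * (p + q) + n * b ≡ n * (p + b + q)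
            lem = solve-∀
          thread : ∀ x → x < n → ThrE m (B + M * 6) ν (put 20 x 1 δ₀) (pack ∷ []) (cells′ x) (cost′ x)
          thread x x<n =
            t-seq (t-seq (t-asg (ev-/ (ev-! {β = 1} (auto ($ 11 +ᵉ $ 20) refl) (a<φ 5 (<M 1 x<)) (sym-m x (<M 1 x<)) (one< (a<u x x<n))) (auto ($ 10) refl))
            (t-seq (t-asg (ev-! {β = 1} (auto (‵rec ($ 11) ($ 28) (‵ 3)) refl) (cell< 3) (node x x<n 3 ≤-num) o<)
            (t-seq (t-asg (ev-! {β = 1} (auto (‵rec ($ 11) ($ 28) (‵ 0)) refl) (cell< 0) (node x x<n 0 ≤-num) m<)
            (t-seq (t-asg (auto ($ 20 ∸ᵉ $ 21) refl)
            (t-seq (t-asg (auto (($ 23 *ᵉ $ 5) /ᵉ $ 4) refl)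
            (t-seq (t-asg (ev-≡ (cong₂ (λ y z → (mm ∸ (mm ∸ y)) ∸ z) (+-comm ((q * w + w) ÷ k) 1) (+-comm first 1))
               (auto (($ 22 ∸ᵉ ($ 22 ∸ᵉ ((($ 23 *ᵉ $ 5) +ᵉ $ 5) /ᵉ $ 4 +ᵉ ‵ 1))) ∸ᵉ ($ 24 +ᵉ ‵ 1)) refl))
            (t-seq (t-asg (ev-up 5 (auto (($ 21 +ᵉ $ 24) +ᵉ $ 25) refl))
            (t-asg (ev-up 20 (ev-≡ (sym (n≤0⇒n≡0 (﹪-≤ 0 (2 ^ w)))) (auto (‵ 0) refl)))
            (t-seq (t-while num δ (λ _ → []) (seqCost packBody) (λ _ → refl) body
            (t-st (auto (($ 11 +ᵉ $ 6 *ᵉ ‵ 6) +ᵉ $ 20) refl)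
              (ev-fill (≤-trans (m∸n≤m k off) k≤w) last< (auto ($ 27) refl) (auto ($ 4 ∸ᵉ (($ 23 *ᵉ $ 5) %ᵉ $ 4)) refl)
                (ev-/ (ev-dig φ≥ sym-m (auto ($ 11) refl) (auto ($ 12) refl) (auto ($ 2) refl) (auto ($ 26) refl) (idx< num))
                  (ev-≪ {γ = 1} (*-identityˡ _) (one< (≤-<-trans off≤ d<u)) (auto (‵ 1) refl) (auto (($ 23 *ᵉ $ 5) %ᵉ $ 4) refl))))
              (m≤m+n _ x) (trans final (cong word (sym (m+n∸m≡n (B + M * 6) x))))
            t-done))))))))))))))))))
            where
            o = lo (π x)
            mm = hi (π x) ∸ o
            q = x ∸ o
            first = Node-word.first x
            off = Node-word.offset x
            num = number x
            f : ℕ → ℕ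
            f j = dig (o + j)
            -- With `r = num ∸ i` this is the accumulator after `i` rounds, before truncation: the
            -- last `i` of the `num` further entries.
            tail-from : ℕ → ℕ → ℕ
            tail-from r i = stream k (λ t → f (first + suc (r + t))) i
            x< : x < u ^ 1
            x< = one< (<-trans x<n n<u)
            o< : o < u ^ 1
            o< = ≤-<-trans (lo≤ x x<n) x<
            m< : mm < u ^ 1
            m< = ≤-<-trans (≤-trans (m∸n≤m (hi (π x)) o) (hi≤n x x<n)) n<
            φ≥ : B + M ≤ B + M * 6
            φ≥ = +-monoʳ-≤ B (m≤m*n M 6)
            cell< : ∀ f {_ : T (f <ᵇ 256)} → cell B (π x) f < B + M * 6
            cell< f {p} = +-monoʳ-< B (<-≤-trans (+-monoʳ-< M (<M 3 (bound-+ 2 1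
                (bound-* 1 1 (≤-<-trans (÷-≤ (a x) Q) (one< (a<u x x<n))) (lit< 16)) (lit< f {p}))))
              (≤-trans (≤-reflexive (lem M)) (*-monoʳ-≤ M (≤-num {2} {6}))))
              where
              lem : ∀ M → M + M ≡ M * 2
              lem = solve-∀
            idx< : ∀ i → o + first + (num ∸ i) < M
            idx< i = <M 4 (bound-+ 3 1 (bound-+ 1 2 o< (≤-<-trans (÷-≤ (q * w) k) (bound-* 1 1 (≤-<-trans (m∸n≤m x o) x<) (one< w<u))))
              (≤-<-trans (≤-trans (m∸n≤m num i) (Node-word.number-≤ x 1≤k)) (one< w<u)))
            off≤ : 2 ^ off ≤ d
            off≤ = ^-monoʳ-≤ 2 (<⇒≤ (﹪-< (q * w) 1≤k))
            last< : dig (o + first + (num ∸ num)) ÷ 2 ^ off < 2 ^ (k ∸ off)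
            last< = ÷-< (2 ^ (k ∸ off)) (<-≤-trans (dig<2^k _) (≤-reflexive
              (trans (cong (2 ^_) (sym (m∸n+n≡m (<⇒≤ (﹪-< (q * w) 1≤k))))) (^-distribˡ-+-* 2 (k ∸ off) off))))
            final : (tail-from (num ∸ num) num * 2 ^ (k ∸ off) + dig (o + first + (num ∸ num)) ÷ 2 ^ off) ﹪ 2 ^ w ≡ word x
            final = cong₂ (λ r v → (tail-from r num * 2 ^ (k ∸ off) + dig v ÷ 2 ^ off) ﹪ 2 ^ w) (n∸n≡0 num)
              (trans (cong (o + first +_) (n∸n≡0 num)) (+-identityʳ _))
            δ : ℕ → Env
            δ i = δ₀ ++ (20 , x , 1) ∷ (28 , π x , 1) ∷ (21 , o , 1) ∷ (22 , mm , 1) ∷ (23 , q , 1) ∷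
              (24 , first , 2) ∷ (25 , num ∸ i , 1) ∷ (26 , o + first + (num ∸ i) , 5) ∷
              (27 , tail-from (num ∸ i) i ﹪ 2 ^ w , 20) ∷ []
            body : ∀ i → i < num → ∀ {K as s} → ThrE m (B + M * 6) ν (δ (suc i)) K as s →
                   ThrE m (B + M * 6) ν (δ i) (packBody ∷ K) as (seqCost packBody + s)
            body i i<num nxt =
              t-seq (t-asg (ev-≡ (cong (_﹪ 2 ^ w) next-entry) (ev-fill k≤w (dig<2^k _) (auto ($ 27) refl) (auto ($ 4) refl)
                (ev-dig φ≥ sym-m (auto ($ 11) refl) (auto ($ 12) refl) (auto ($ 2) refl) (auto ($ 26) refl) (idx< i))))
              (t-seq (t-asg (ev-≡ (trans (+-∸-assoc (o + first) {num ∸ i} (m<n⇒0<n∸m i<num)) (cong (o + first +_) (∸-suc num i))) (auto ($ 26 ∸ᵉ ‵ 1) refl))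
              (t-asg (ev-≡ (∸-suc num i) (auto ($ 25 ∸ᵉ ‵ 1) refl))
              nxt))))
              where
              r = num ∸ suc i
              r≡ : num ∸ i ≡ suc r
              r≡ = +-∸-assoc 1 i<num
              next-entry : tail-from (num ∸ i) i * 2 ^ k + dig (o + first + (num ∸ i)) ≡ tail-from r (suc i)
              next-entry = cong₂ (λ s v → s * 2 ^ k + dig v)
                (stream-cong k i (λ t → cong (λ z → f (first + suc z)) (trans (cong (_+ t) r≡) (sym (+-suc r t)))))
                (trans (+-assoc o first (num ∸ i)) (cong (λ z → o + (first + z)) (trans r≡ (cong suc (sym (+-identityʳ r))))))

      clear-ok : ∀ {Q₁ m K W H X p t c} →
        (∀ m′ → Same (B + M * 7) m m′ → (∀ i → i < n → val m′ (B + M * 7 + i) ≡ 0) → Main Q₁ m′ (env X p t c) K W H) →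
        Main Q₁ m (env X p t c) (pardo 20 0 clear ∷ K) (suc (n * seqCost clear + W)) (suc (seqCost clear + H))
      clear-ok {Q₁} {m} {K} {W} {H} {X} {p} {t} {c} cont =
        subst (λ z → Main Q₁ m δ₀ (pardo 20 0 clear ∷ K) (suc (z + W)) (suc (seqCost clear + H)))
          (sumUpTo-const (seqCost clear) n)
          (m-par (B + M * 7) (λ _ → 0) refl (λ i → B + M * 7 + i ∷ []) (λ _ → seqCost clear) (seqCost clear)
            (λ i i<n → _ , ≤-num , ≤-num , thread i)
            λ m′ af → cont m′ (same-by λ α → After.below-φ af) (λ i i<n → After.new af i<n (here refl)))
        where
        δ₀ = env X p t c
        thread : ∀ i → ThrE m (B + M * 7) (λ _ → 0) (put 20 i 1 δ₀) (clear ∷ []) (B + M * 7 + i ∷ []) (seqCost clear)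
        thread i = t-st (auto (($ 11 +ᵉ $ 6 *ᵉ ‵ 7) +ᵉ $ 20) refl) (auto (‵ 0) refl) (m≤m+n _ i) refl t-done

      record Scattered (m m′ : Mem) : Set where
        field
          same     : Same (B + M * 7) m m′
          inverse  : ∀ x → x < n → val m′ (B + M * 8 + pos n x) ≡ x
          moved    : ∀ x → x < n → val m′ (B′ + pos n x) ≡ a x
          children : ∀ x → x < n → val m′ (B + M * 7 + π′ x) ≡ cell B′ (π′ x) 0
          nodes    : ∀ x → x < n → HasNode m′ B′ (π′ x) (lo′ (π′ x)) (hi′ (π′ x))
          others   : ∀ i → i < M → (∀ x → x < n → i ≢ π′ x) → val m′ (B + M * 7 + i) ≡ val m (B + M * 7 + i)

      scatter-ok : ∀ {Q₁ m K W H p t c} → Symbols m → Counted m → Nodes m →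
        (∀ m′ → Scattered m m′ → Main Q₁ m′ (env (XT L) p t c) K W H) →
        Main Q₁ m (env (XT L) p t c) (pardo 20 0 scatter ∷ K) (suc (n * costScatter + W)) (suc (costScatter + H))
      scatter-ok {Q₁} {m} {K} {W} {H} {p} {t} {c} sym-m cm nodes cont =
        subst (λ z → Main Q₁ m δ₀ (pardo 20 0 scatter ∷ K) (suc (z + W)) (suc (costScatter + H)))
          (sumUpTo-const costScatter n)
          (m-par (B + M * 7) ν refl as (λ _ → costScatter) costScatter
            (λ x x<n → _ , ≤-num , ≤-num , thread x x<n)
            λ m′ af → cont m′ (after m′ af))
        where
        open Nodes nodes
        δ₀ = env (XT L) p t c
        -- The writer of a sorted position is recovered by `inv`, while a child record depends only
        -- on its prefix value, on which all its writers agree. Arrays 16 and 17 are arrays 0 and 1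
        -- of the next level.
        V : ℕ → ℕ → ℕ
        V 7 z = cell B′ z 0
        V 8 y = inv n y
        V 16 y = a (inv n y)
        V 17 z = field-of B′ (z ÷ 16) (lo′ (z ÷ 16)) (hi′ (z ÷ 16)) (z ﹪ 16)
        V _ _ = 0
        ν = decode B M V
        as : ℕ → List ℕ
        as x = (B + M * 8 + pos n x) ∷ (B′ + pos n x) ∷ (B + M * 7 + π′ x) ∷ cells B′ (π′ x) ++ []
        pos<M : ∀ {x} → x < n → pos n x < M
        pos<M x<n = <M 1 (<-trans (pos-< n x<n) n<)
        π′<M : ∀ {x} → x < n → π′ x < M
        π′<M {x} x<n = <M 1 (≤-<-trans (÷-≤ (a x) Q′) (one< (a<u x x<n)))
        ν-node : ∀ x → x < n → ∀ f → f < 12 → ν (cell B′ (π′ x) f) ≡ field-of B′ (π′ x) (lo′ (π′ x)) (hi′ (π′ x)) f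
        ν-node x x<n f f<12 = trans (cong ν (cell-base f (π′ x)))
          (trans (decode-≡ B M V 17 (<M 3 (bound-+ 2 1 (bound-* 1 1 (≤-<-trans (÷-≤ (a x) Q′) (one< (a<u x x<n))) (lit< 16)) (<-trans f<12 (lit< 12)))))
            (cong₂ (λ y g → field-of B′ y (lo′ y) (hi′ y) g) (÷-unique (π′ x) f<16) (﹪-unique (π′ x) f<16)))
          where f<16 = <-≤-trans f<12 (≤-num {12} {16})
        thread : ∀ x → x < n → ThrE m (B + M * 7) ν (put 20 x 1 δ₀) (scatter ∷ []) (as x) costScatter
        thread x x<n =
          t-seq (t-seq (t-asg (ev-! {β = 1} (auto ($ 11 +ᵉ $ 20) refl) (a<φ 6 x<M) (sym-m x x<M) (one< (a<u x x<n)))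
          (t-seq (t-asg (auto (($ 21 /ᵉ $ 12) %ᵉ $ 2) refl)
          (t-seq (t-asg (ev-! {β = 1} (auto (‵rec ($ 11) ($ 21 /ᵉ $ 10) (‵ 3)) refl) (cell< 3) (node x x<n 3 ≤-num) o<)
          (t-seq (t-asg (ev-! {β = 1} (auto (‵rec ($ 11) ($ 21 /ᵉ $ 10) (‵ 4)) refl) (cell< 4) (node x x<n 4 ≤-num) h<)
          (t-seq (t-asg (ev-N φ≥ cm (level-regs refl refl refl refl refl refl refl refl) (auto ($ 22) refl) (auto ($ 20) refl) (dig<d x) (<⇒≤ x<n))
          (t-seq (t-asg (ev-≡ (cong (λ y → N n (dig x) (lo y)) (sym (parent x)))
            (ev-N φ≥ cm (level-regs refl refl refl refl refl refl refl refl) (auto ($ 22) refl) (auto ($ 23) refl) (dig<d x) o≤n))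
          (t-seq (t-asg (ev-≡ (cong (λ y → N n (dig x) (hi y)) (sym (parent x)))
            (ev-N φ≥ cm (level-regs refl refl refl refl refl refl refl refl) (auto ($ 22) refl) (auto ($ 24) refl) (dig<d x) (hi≤n x x<n)))
          (t-seq (t-asg (auto ($ 21 /ᵉ $ 12) refl)
          (t-asg (auto ($ 11 +ᵉ $ 6 *ᵉ ‵ 16) refl)
          (t-seq (t-st (auto (($ 11 +ᵉ $ 6 *ᵉ ‵ 8) +ᵉ $ 25) refl) (auto ($ 20) refl) (φ≤ 1 _)
            (sym (trans (decode-≡ B M V 8 (pos<M x<n)) (inv-pos n x<n)))
          (t-seq (t-st (auto ($ 29 +ᵉ $ 25) refl) (auto ($ 21) refl) (φ≤ 9 _)
            (sym (trans (decode-≡ B M V 16 (pos<M x<n)) (cong a (inv-pos n x<n))))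
          (t-seq (t-st (auto (($ 11 +ᵉ $ 6 *ᵉ ‵ 7) +ᵉ $ 28) refl) (auto (‵rec ($ 29) ($ 28) (‵ 0)) refl) (m≤m+n _ _)
            (sym (decode-≡ B M V 7 (π′<M x<n)))
          (writeNode-ok
            (record { r0 = auto ($ 0) refl ; r2 = auto ($ 2) refl ; r3 = auto ($ 3) refl ; r6 = auto ($ 6) refl ; r7 = auto ($ 7) refl
                    ; r16 = auto ($ 16) refl ; r26 = auto ($ 26) refl ; r27 = auto ($ 27) refl ; r28 = auto ($ 28) refl ; r29 = auto ($ 29) refl })
            (+-monoʳ-≤ B (*-monoʳ-≤ M (≤-num {7} {16}))) (ν-node x x<n)
          t-done))))))))))))))))))))))))
          where
          φ≥ : B + M * 6 ≤ B + M * 7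
          φ≥ = +-monoʳ-≤ B (*-monoʳ-≤ M (≤-num {6} {7}))
          φ≤ : ∀ s y → B + M * 7 ≤ B + M * (7 + s) + y
          φ≤ s y = ≤-trans (+-monoʳ-≤ B (*-monoʳ-≤ M (m≤m+n 7 s))) (m≤m+n _ y)
          x<M : x < M
          x<M = <M 1 (<-trans x<n n<)
          o≤n : lo (π x) ≤ n
          o≤n = ≤-trans (lo≤ x x<n) (<⇒≤ x<n)
          o< : lo (π x) < u ^ 1
          o< = ≤-<-trans o≤n n<
          h< : hi (π x) < u ^ 1
          h< = ≤-<-trans (hi≤n x x<n) n<
          cell< : ∀ f {_ : T (f <ᵇ 256)} → cell B (π x) f < B + M * 7
          cell< f {q} = +-monoʳ-< B (<-≤-trans (+-monoʳ-< M (<M 3 (bound-+ 2 1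
              (bound-* 1 1 (≤-<-trans (÷-≤ (a x) Q) (one< (a<u x x<n))) (lit< 16)) (lit< f {q}))))
            (≤-trans (≤-reflexive (lem M)) (*-monoʳ-≤ M (≤-num {2} {7}))))
            where
            lem : ∀ M → M + M ≡ M * 2
            lem = solve-∀
        after : ∀ m′ → After m (B + M * 7) ν as n m′ → Scattered m m′
        after m′ af = record
          { same     = same-by λ α → below-φ
          ; inverse  = λ x x<n → trans (new x<n (here refl)) (trans (decode-≡ B M V 8 (pos<M x<n)) (inv-pos n x<n))
          ; moved    = λ x x<n → trans (new x<n (there (here refl))) (trans (decode-≡ B M V 16 (pos<M x<n)) (cong a (inv-pos n x<n)))
          ; children = λ x x<n → trans (new x<n (there (there (here refl)))) (decode-≡ B M V 7 (π′<M x<n))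
          ; nodes    = λ x x<n f f<12 → trans (new x<n (there (there (there (∈-++⁺ˡ (∈-applyUpTo⁺ (cell B′ (π′ x)) f<12)))))) (ν-node x x<n f f<12)
          ; others   = others }
          where
          open After af
          others : ∀ i → i < M → (∀ x → x < n → i ≢ π′ x) → val m′ (B + M * 7 + i) ≡ val m (B + M * 7 + i)
          others i i<M i≢ = [ id , (λ ((x , x<n , mem) , _) → ⊥-elim (absurd x x<n mem)) ]
            (either {B + M * 7 + i} (below 14 (bound-+ 13 8 (bound-+ 12 11 B<u
              (bound-* 10 1 (subst (_< u ^ 10) (sym M≡u^8) (^-monoʳ-< u 2≤u (≤-num {9} {10}))) (lit< 7)))
              (subst (i <_) M≡u^8 i<M))))
            where
            far : ∀ s y → B + M * 7 + i ≢ B + M * (8 + s) + y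
            far s y q = <⇒≢ (<-≤-trans (subst (_< B + M * 8) (sym (+-assoc B (M * 7) i)) (+-monoʳ-< B
                (subst (M * 7 + i <_) (lem M) (+-monoʳ-< (M * 7) i<M))))
              (≤-trans (+-monoʳ-≤ B (*-monoʳ-≤ M (m≤m+n 8 s))) (m≤m+n _ y))) q
              where
              lem : ∀ M → M * 7 + M ≡ M * 8
              lem = solve-∀
            absurd : ∀ x → x < n → B + M * 7 + i ∈ as x → ⊥
            absurd x x<n (here q) = far 0 _ q
            absurd x x<n (there (here q)) = far 8 _ q
            absurd x x<n (there (there (here q))) = i≢ x x<n (+-cancelˡ-≡ (B + M * 7) _ _ q)
            absurd x x<n (there (there (there q))) =
              [ (λ r → let f , _ , e = ∈-applyUpTo⁻ (cell B′ (π′ x)) r in far 9 _ (trans e (cell-base f (π′ x)))) , (λ ()) ]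
              (∈-++⁻ (cells B′ (π′ x)) q)

      level-ok : ∀ {Q₁ m K W H} → B′ < u ^ 12 → Symbols m → Nodes m →
        (∀ m′ → LevelDone m m′ → Main Q₁ m′ (base-env σ root Q′ B′) K W H) →
        Main Q₁ m (base-env σ root Q B) (level ∷ K) (workL + W) (depthL + H)
      level-ok {Q₁} {m} {K} {W} {H} B′<u sym-m nd cont =
        m-weaken (≤-reflexive (reassoc pre (chunks * L * (costBlocks * d)) mid₁ (chunks * e * (costChunks * L)) mid₂ _
                    (n * costPack) (n * seqCost clear) (n * costScatter) post W))
                 (≤-reflexive (reassoc pre (costBlocks * d) mid₁ (costChunks * L) mid₂ _
                    (costPack * w) (seqCost clear) costScatter post H))
        (m-seq (m-asg 0 (ev-≡ (trans (cong (_÷ d) Q≡) (m*n÷n Q′ 0<d)) (auto ($ 10 /ᵉ $ 2) refl))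
        (m-seq (m-asg 0 (auto ($ 11 +ᵉ $ 6 *ᵉ ‵ 2) refl)
        (m-seq (m-asg 0 (auto ($ 11 +ᵉ $ 6 *ᵉ ‵ 4) refl)
        (m-seq (m-asg 0 (ev-up 14 (auto ($ 11 +ᵉ $ 6 *ᵉ ‵ 5) refl))
        (m-seq (m-asg 0 (auto (‵ 1) refl)
        (m-seq (m-asg 0 (auto ($ 3) refl)
        (m-seq (m-asg 0 (ev-up 5 (auto (($ 0 /ᵉ $ 7 +ᵉ ‵ 1) *ᵉ $ 3) refl))
        (m-seq (countBlocks-ok sym-m λ m₁ s₁ loc₁ blk₁ →
         m-seq (m-asg 0 (ev-up 5 (auto (($ 0 /ᵉ $ 7 +ᵉ ‵ 1) *ᵉ $ 8) refl))
        (m-seq (countChunks-ok blk₁ λ m₂ s₂ mid₂ scan₂ →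
         m-seq (m-asg 0 (ev-up 5 (auto (($ 0 /ᵉ $ 7 +ᵉ ‵ 2) *ᵉ $ 8) refl))
        (m-seq (start₀ m₂ (scan-ok (subst (λ x → Scan 0 x m₂) (sym (+-identityʳ (B + M * 5))) scan₂) λ m₃ s₃ scan₃ →
         let S₃ = same-trans {B + M * 2} ≤-refl (frontier-≤ 2 5) (same-trans {B + M * 2} ≤-refl (frontier-≤ 2 4) s₁ s₂) s₃
             loc₃ = loc-same (frontier-≤ 3 4) (same-trans {B + M * 4} ≤-refl (frontier-≤ 4 5) s₂ s₃) loc₁
             mid₃ = mid-same ≤-refl s₃ mid₂
             cm₃ = record { loc = loc₃ ; mid = mid₃ ; scan = scan₃ }
             sym₃ = symbols-same (frontier-≤ 1 2) S₃ sym-m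
             nd₃ = nodes-same ≤-refl S₃ nd
         in m-seq (pack-ok nd₃ sym₃ λ m₄ s₄ packs₄ →
            m-seq (clear-ok λ m₅ s₅ clear₅ →
         let S₅ : Same (B + M * 6) m₃ m₅
             S₅ = same-trans {B + M * 6} ≤-refl (frontier-≤ 6 7) s₄ s₅
             cm₅ = counted-same ≤-refl S₅ cm₃
             sym₅ = symbols-same (frontier-≤ 1 6) S₅ sym₃
             nd₅ = nodes-same (frontier-≤ 2 6) S₅ nd₃
             packs₅ : Packs m₅
             packs₅ = λ x x<n → trans (Same.eq s₅ _ (step-frontier 6 x (<M 1 (<-trans x<n n<)))) (packs₄ x x<n)
         in m-seq (scatter-ok sym₅ cm₅ nd₅ λ m₆ sc →
            let s₆ = Scattered.same sc in
            m-seq (m-asg 0 (auto ($ 12) refl)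
            (m-seq (m-asg 0 (ev-bd B′<u (auto ($ 11 +ᵉ $ 6 *ᵉ ‵ 16) refl))
            (m-asg 0 (auto (‵ 1 <ᵉ $ 10) refl)
            (m-forget (λ r → lookup-++ r (base-env σ root Q′ B′) extra)
              (cont m₆ record
                { same = same-trans {B + M * 2} ≤-refl (frontier-≤ 2 7)
                    (same-trans {B + M * 2} ≤-refl (frontier-≤ 2 6) S₃ S₅) s₆
                ; counted = counted-same (frontier-≤ 6 7) s₆ cm₅
                ; packs = λ x x<n → trans (Same.eq s₆ _ (step-frontier 6 x (<M 1 (<-trans x<n n<)))) (packs₅ x x<n)
                ; inverse = Scattered.inverse sc ; moved = Scattered.moved sc ; children = Scattered.children sc
                ; absent = λ i i<n ≢ → trans (Scattered.others sc i (<M 1 (<-trans i<n n<)) ≢) (clear₅ i i<n)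
                ; nodes = Scattered.nodes sc }))))))))))))))))))))))))))))))))
        where
        extra : Env
        extra = (12 , Q′ , 2) ∷ (13 , B + M * 2 , 13) ∷ (14 , B + M * 4 , 13) ∷ (15 , XT L , 14) ∷
                (17 , 2 ^ L , 1) ∷ (18 , L ∸ L , 1) ∷ (19 , rows * e , 5) ∷ []
        start₀ : ∀ m₂ {p t c K W H} → Main Q₁ m₂ (env (XT 0) p t c) K W H → Main Q₁ m₂ (env (B + M * 5) p t c) K W H
        start₀ m₂ {p} {t} {c} {K} {W} {H} = subst (λ x → Main Q₁ m₂ (env x p t c) K W H) (+-identityʳ (B + M * 5))

    -- The whole construction and its cost

    module Setup (K σ : ℕ) (σ≤n : σ ≤ n) (u≡ : u ≡ 2 ^ ((K + 8) * L)) (w≡ : w ≡ (K + 8) * E * L)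
                 (cube : d * d * d ≤ K * L) where
      open Threads

      κ wf h : ℕ
      κ  = K + 8
      wf = κ * E
      h  = ⌈log[ d ] σ ⌉

      1≤d : 1 ≤ d
      1≤d = ≤-trans (s≤s z≤n) 2≤d

      d≤dd : d ≤ d * d
      d≤dd = subst (_≤ d * d) (*-identityʳ d) (*-monoʳ-≤ d 1≤d)

      d≤κL : d ≤ κ * L
      d≤κL = ≤-trans d≤dd (≤-trans (subst (_≤ d * d * d) (*-identityʳ (d * d)) (*-monoʳ-≤ (d * d) 1≤d))
        (≤-trans cube (*-monoˡ-≤ L (m≤m+n K 8))))

      σ<u : σ < u
      σ<u = ≤-<-trans σ≤n n<u

      wf<u : wf < u
      wf<u = ≤-<-trans (subst₂ _≤_ (*-identityʳ wf) (sym w≡) (*-monoʳ-≤ wf 1≤L)) w<u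

      κ<u : κ < u
      κ<u = ≤-<-trans (m≤m*n κ E) wf<u

      k<d : k < d
      k<d = n<2^n k

      open Log d 2≤d

      -- Already `d ^ L ≥ 2 ^ L ≥ n ≥ σ`, so the exponent `L` is not among those counted.
      h≤L : h ≤ L
      h≤L with h ≤? L
      ... | yes p = p
      ... | no p = ⊥-elim (<⇒≱ (<-log σ L (≰⇒> p)) (≤-trans σ≤n (≤-trans n≤2^L (^-monoˡ-≤ L 2≤d))))

      -- The last power computed may exceed `lim`, but it is `b` times a power below `lim`, hence
      -- the exponent 2.
      power< : ∀ b lim N → b < u → lim < u → (∀ i → i < N → b ^ i < lim) → ∀ i → i ≤ N → b ^ i < u ^ 2
      power< b lim N b<u lim<u below′ zero _ = up 1 2 (lit< 1)
      power< b lim N b<u lim<u below′ (suc i) i< = bound-* 1 1 (one< b<u) (<-trans (below′ i i<) (one< lim<u))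

      d^h<u² : d ^ h < u ^ 2
      d^h<u² = power< d σ h d<u σ<u (<-log σ) h ≤-refl

      powers-env : (b lim p c q : ℕ) → Env → Env
      powers-env b lim p c q δ = (34 , b , 1) ∷ (35 , lim , 1) ∷ (32 , p , 2) ∷ (33 , c , 1) ∷ (36 , q , 1) ∷ δ

      powers-env₂ : (b lim p pb c q : ℕ) → Env → Env
      powers-env₂ b lim p pb c q δ = (34 , b , 1) ∷ (35 , lim , 1) ∷ (32 , p , pb) ∷ (33 , c , 1) ∷ (36 , q , 1) ∷ δ

      powers-ok : ∀ {Q m δ K W H p pb c q} b lim N → b < u → lim < u → N < u →
        (∀ i → i < N → b ^ i < lim) → lim ≤ b ^ N →
        Main Q m (powers-env b lim (b ^ N) N (𝟙 (b ^ N <ᵇ lim)) δ) K W H →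
        Main Q m (powers-env₂ b lim p pb c q δ) (powers ∷ K) (powersPre + (N * powersStep + suc W)) (powersPre + (N * powersStep + suc H))
      powers-ok {Q} {m} {δ} b lim N b<u lim<u N<u below′ stop′ cont =
        m-seq (m-asg 0 (ev-up 2 (auto (‵ 1) refl))
        (m-seq (m-asg 0 (auto (‵ 0) refl)
        (m-seq (m-asg 0 (auto ($ 32 <ᵉ $ 35) refl)
        (m-while N env (λ i → 𝟙 (b ^ i <ᵇ lim)) (λ _ m′ → m′ ≡ m) (pred powersStep) (pred powersStep)
          (λ i → refl) (λ i i<N → 0 , cong 𝟙 (<ᵇ-true (below′ i i<N))) (cong 𝟙 (<ᵇ-false stop′))
          (λ { i .m i<N refl next′ →
            m-seq (m-asg 0 (ev-bd (power< b lim N b<u lim<u below′ (suc i) i<N) (ev-≡ (*-comm (b ^ i) b) (auto ($ 32 *ᵉ $ 34) refl)))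
            (m-seq (m-asg 0 (ev-bd {β′ = 1} (one< (≤-<-trans i<N N<u)) (ev-≡ (+-comm i 1) (auto ($ 33 +ᵉ ‵ 1) refl)))
            (m-asg 0 (auto ($ 32 <ᵉ $ 35) refl) (next′ m refl))))) })
          (λ { .m refl → cont }) m refl))))))
        where
        env : ℕ → Env
        env i = powers-env b lim (b ^ i) i (𝟙 (b ^ i <ᵇ lim)) δ

      -- Registers that are still zero are listed as well: later assignments then replace entries in
      -- place and the environment keeps its shape.
      start-env : Env
      start-env = powers-env₂ 0 0 0 1 0 0
        ((0 , n , 1) ∷ (1 , σ , 1) ∷ (2 , d , 1) ∷ (3 , 0 , 1) ∷ (4 , 0 , 1) ∷ (5 , 0 , 1) ∷
         (6 , 0 , 1) ∷ (16 , 0 , 1) ∷ (7 , 0 , 1) ∷ (8 , 0 , 1) ∷ (9 , 0 , 1) ∷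
         (30 , 0 , 1) ∷ (10 , 0 , 1) ∷ (11 , 0 , 1) ∷ (37 , 0 , 1) ∷ [])

      prepCost : ℕ
      prepCost = prep₁ + prep₂ + prep₃ + prep₄ + 3 * suc powersPre + (⌈log₂ n ⌉ + k + h) * powersStep

      prepare-ok : ∀ {Q m K W H} → Main Q m (base-env σ (M + M) (d ^ h) M) K W H →
        Main Q m start-env (prepare κ wf ∷ K) (prepCost + W) (prepCost + H)
      prepare-ok {Q} {m} {K} {W} {H} cont =
        m-weaken (≤-reflexive (reassoc′ prep₁ powersPre prep₂ prep₃ prep₄ powersStep ⌈log₂ n ⌉ k h W))
                 (≤-reflexive (reassoc′ prep₁ powersPre prep₂ prep₃ prep₄ powersStep ⌈log₂ n ⌉ k h H))
        (m-seq (m-asg 0 (auto (‵ 2) refl)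
        (m-seq (m-asg 0 (auto ($ 0) refl)
        (m-seq (powers-ok 2 n ⌈log₂ n ⌉ (≤-trans (s≤s (s≤s (s≤s z≤n))) 256≤u) n<u (≤-<-trans (m≤n⊔m 1 ⌈log₂ n ⌉) L<u) (<-⌈log₂⌉ n) (≤-2^⌈log₂⌉ n)
        (m-seq (m-asg 0 (ev-bd {β′ = 1} (one< L<u) (ev-≡ (1⊔ ⌈log₂ n ⌉) (auto ($ 33 +ᵉ (‵ 1 ∸ᵉ $ 33)) refl)))
        (m-seq (m-asg 0 (auto ($ 2) refl)
        (m-seq (powers-ok 2 d k (≤-trans (s≤s (s≤s (s≤s z≤n))) 256≤u) d<u (<-trans k<d d<u) (λ i → ^-monoʳ-< 2 (s≤s (s≤s z≤n))) ≤-refl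
        (m-seq (m-asg 0 (auto ($ 33) refl)
        (m-seq (m-asg 0 (auto ($ 2) refl)
        (m-seq (m-asg 0 (auto ($ 1) refl)
        (m-seq (powers-ok d σ h d<u σ<u (≤-<-trans h≤L L<u) (<-log σ) (≤-^log σ)
        (m-seq (m-asg 0 (auto ($ 32) refl)
        (m-seq (m-asg 0 (ev-bd {β′ = 1} (one< w<u) (ev-≡ (sym w≡) (ev-* (ev-lit wf<u) (auto ($ 3) refl))))
        (m-seq (m-asg 0 (ev-≪ {γ = 9} (trans (size 8) (sym M≡u^8)) M< (auto (‵ 1) refl) (ev-* (ev-* (auto ($ 3) refl) (ev-lit κ<u)) (auto (‵ 8) refl)))
        (m-seq (m-asg 0 (ev-≪ {γ = 7} (trans (size 6) (sym S≡u^6)) S< (auto (‵ 1) refl) (ev-* (ev-* (auto ($ 3) refl) (ev-lit κ<u)) (auto (‵ 6) refl)))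
        (m-seq (m-asg 0 (auto ($ 2 *ᵉ $ 3) refl)
        (m-seq (m-asg 0 (auto ($ 2 +ᵉ ‵ 1) refl)
        (m-seq (m-asg 0 (ev-∸ (ev-≪ {γ = 1} (*-identityˡ _) (one< (≤-<-trans (^-monoʳ-≤ 2 d≤dd) 2^dd<u)) (auto (‵ 1) refl) (auto ($ 2) refl)) (auto (‵ 1) refl))
        (m-seq (m-asg 0 (ev-up 12 (auto ($ 6) refl))
        (m-seq (m-asg 0 (auto (‵ 1 <ᵉ $ 10) refl)
        (m-asg 0 (auto ($ 11 +ᵉ $ 6) refl)
        (m-forget (λ r → lookup-All (powers-env d σ (d ^ h) h (𝟙 (d ^ h <ᵇ σ)) (base-env σ (M + M) (d ^ h) M)) (base-env σ (M + M) (d ^ h) M)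
          (refl ∷ refl ∷ refl ∷ refl ∷ refl ∷ refl ∷ refl ∷ refl ∷ refl ∷ refl ∷ refl ∷ refl ∷ refl ∷ refl ∷ refl ∷ []) r)
        cont))))))))))))))))))))))))))))))))))))))))
        where
        size : ∀ e → 1 * 2 ^ (L * κ * e) ≡ u ^ e
        size e = trans (*-identityˡ _) (trans (cong (λ z → 2 ^ (z * e)) (*-comm L κ)) (trans (sym (^-*-assoc 2 (κ * L) e)) (cong (_^ e) (sym u≡))))
        reassoc′ : ∀ a p b c f s x y z W →
          a + (p + (x * s + suc (b + (p + (y * s + suc (c + (p + (z * s + suc (f + W))))))))) ≡
          (a + b + c + f + 3 * suc p + (x + y + z) * s) + W
        reassoc′ = solve-∀

      open Constants K using (levelWork; levelDepth; prepConst; buildWork; buildDepth)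

      L≤4n : L ≤ 4 * n
      L≤4n = ≤-trans (subst (_≤ L * L) (*-identityʳ L) (*-monoʳ-≤ L 1≤L)) (log₂²-≤ n 1≤n)

      D≤ : d * L ≤ 4 * κ * n
      D≤ = begin
        d * L          ≤⟨ *-monoˡ-≤ L d≤κL ⟩
        κ * L * L      ≡⟨ *-assoc κ L L ⟩
        κ * (L * L)    ≤⟨ *-monoʳ-≤ κ (log₂²-≤ n 1≤n) ⟩
        κ * (4 * n)    ≡⟨ lem κ n ⟩
        4 * κ * n      ∎
        where
        open ≤-Reasoning
        lem : ∀ κ n → κ * (4 * n) ≡ 4 * κ * n
        lem = solve-∀

      module Work = Scaled n 1≤n
      module Depth = Scaled L 1≤L

      rounded : ∀ r → (n ÷ (d * L) + r) * (d * L) ≤ (1 + r * (4 * κ)) * n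
      rounded r = begin
        (n ÷ (d * L) + r) * (d * L)           ≡⟨ *-distribʳ-+ (d * L) (n ÷ (d * L)) r ⟩
        n ÷ (d * L) * (d * L) + r * (d * L)   ≤⟨ +-mono-≤ (÷-*-≤ n (d * L)) (*-monoʳ-≤ r D≤) ⟩
        n + r * (4 * κ * n)                   ≡⟨ lem r κ n ⟩
        (1 + r * (4 * κ)) * n                 ∎
        where
        open ≤-Reasoning
        lem : ∀ r κ n → n + r * (4 * κ * n) ≡ (1 + r * (4 * κ)) * n
        lem = solve-∀

      work-bound :
        pre + chunks * L * (costBlocks * d) + mid₁ + chunks * (d + 1) * (costChunks * L) + mid₂ +
        L * suc (suc ((n ÷ (d * L) + 2) * (d + 1) * costRound + restRound)) + n * costPack + n * seqCost clear + n * costScatter + post + 6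
          ≤ levelWork * n
      work-bound =
        bounded {c = levelWork} (const pre ⊹ via (≤-reflexive (lem₁ chunks L costBlocks d)) (times costBlocks (by {c = 1 + 1 * (4 * κ)} (rounded 1))) ⊹ const mid₁ ⊹
        via (double chunks costChunks L 1≤d) (times costChunks (times 2 (by {c = 1 + 1 * (4 * κ)} (rounded 1)))) ⊹ const mid₂ ⊹
        via (≤-reflexive (lem₂ L ((n ÷ (d * L) + 2) * (d + 1)) costRound restRound))
          (times (2 + restRound) (by {c = 4} L≤4n) ⊹ via (double (n ÷ (d * L) + 2) costRound L 1≤d) (times costRound (times 2 (by {c = 1 + 2 * (4 * κ)} (rounded 2))))) ⊹
        exact costPack ⊹ exact (seqCost clear) ⊹ exact costScatter ⊹ const post ⊹ const 6)
        where
        open Work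
        lem₁ : ∀ c L b d → c * L * (b * d) ≡ b * (c * (d * L))
        lem₁ = solve-∀
        lem₂ : ∀ L x r s → L * suc (suc (x * r + s)) ≡ (2 + s) * L + x * (r * L)
        lem₂ = solve-∀

      depth-bound :
        pre + costBlocks * d + mid₁ + costChunks * L + mid₂ + L * suc (suc (costRound + restRound)) + costPack * w +
        seqCost clear + costScatter + post + 6 ≤ levelDepth * L
      depth-bound =
        bounded {c = levelDepth} (const pre ⊹ times costBlocks (by {c = κ} d≤κL) ⊹ const mid₁ ⊹ times costChunks (by {c = 1} (≤-reflexive (sym (*-identityˡ L)))) ⊹ const mid₂ ⊹
        exact (suc (suc (costRound + restRound))) ⊹ times costPack (by {c = wf} (≤-reflexive w≡)) ⊹ const (seqCost clear) ⊹ const costScatter ⊹ const post ⊹ const 6)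
        where open Depth

      prep-bound : prepCost ≤ prepConst * L
      prep-bound = bounded {c = prepConst} (const (prep₁ + prep₂ + prep₃ + prep₄ + 3 * suc powersPre) ⊹
        via (≤-reflexive (*-comm (⌈log₂ n ⌉ + k + h) powersStep))
          (times powersStep (by {c = 1} (≤-trans (m≤n⊔m 1 ⌈log₂ n ⌉) (≤-reflexive (sym (*-identityˡ L)))) ⊹
            by {c = κ} (≤-trans (<⇒≤ k<d) d≤κL) ⊹ by {c = 1} (≤-trans h≤L (≤-reflexive (sym (*-identityˡ L)))))))
        where open Depth

      ℓ′ : ℕ
      ℓ′ = 1 ⊔ h

      widen : ∀ {x c z} → x ≤ c * z → x ≤ c * (z * ℓ′)
      widen {c = c} {z} p = ≤-trans p (*-monoʳ-≤ c (m≤m*n z ℓ′ {{>-nonZero (m≤m⊔n 1 h)}}))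

      -- The summand 1 in the constant pays for the loop tests. `ℓ′` takes the place of `h`, which
      -- vanishes for an alphabet of one symbol.
      levels : ∀ {x c z} → 1 ≤ z → x ≤ c * z → h * suc x ≤ (1 + c) * (z * ℓ′)
      levels {x} {c} {z} 1≤z p = begin
        h * suc x           ≤⟨ *-mono-≤ (m≤n⊔m 1 h) (+-mono-≤ 1≤z p) ⟩
        ℓ′ * (z + c * z)    ≡⟨ lem ℓ′ z c ⟩
        (1 + c) * (z * ℓ′)  ∎
        where
        open ≤-Reasoning
        lem : ∀ l z c → l * (z + c * z) ≡ (1 + c) * (z * l)
        lem = solve-∀

      1≤nℓ : 1 ≤ n * ℓ′
      1≤nℓ = *-mono-≤ 1≤n (m≤m⊔n 1 h)

      1≤Lℓ : 1 ≤ L * ℓ′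
      1≤Lℓ = *-mono-≤ 1≤L (m≤m⊔n 1 h)

      build-work : ∀ {x} → x ≤ levelWork * n →
        prepCost + suc (n * costInit + (h * suc x + suc (endCost + 0))) ≤ buildWork * (n * ℓ′)
      build-work {x} p = bounded {c = buildWork} (by {c = prepConst * 4} (widen {prepCost} {prepConst * 4} {n} (≤-trans prep-bound (≤-trans (*-monoʳ-≤ prepConst L≤4n) (≤-reflexive (sym (*-assoc prepConst 4 n)))))) ⊹
        (const 1 ⊹ by {c = costInit} (widen {n * costInit} {costInit} {n} (≤-reflexive (*-comm n costInit))) ⊹
          (by {c = 1 + levelWork} (levels {x} {levelWork} {n} 1≤n p) ⊹ via (≤-reflexive (cong suc (+-identityʳ endCost))) (const (1 + endCost)))))
        where open Scaled (n * ℓ′) 1≤nℓ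

      build-depth : ∀ {x} → x ≤ levelDepth * L →
        prepCost + suc (costInit + (h * suc x + suc (endCost + 0))) ≤ buildDepth * (L * ℓ′)
      build-depth {x} p = bounded {c = buildDepth} (by {c = prepConst} (widen {prepCost} {prepConst} {L} prep-bound) ⊹
        (const 1 ⊹ const costInit ⊹
          (by {c = 1 + levelDepth} (levels {x} {levelDepth} {L} 1≤L p) ⊹ via (≤-reflexive (cong suc (+-identityʳ endCost))) (const (1 + endCost)))))
        where open Scaled (L * ℓ′) 1≤Lℓ

      private
        instance
          2^k≢0 : NonZero (2 ^ k)
          2^k≢0 = m^n≢0 2 k

      -- The value of a prefix in base `d`. The program knows a node by this number, obtained as a
      -- quotient of any of its symbols.
      pv : List ℕ → ℕ
      pv = foldl (λ π c → π * d + c) 0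

      -- From the levels to the tree

      module Tree (S₀ : Vec (Fin σ) n) (m₀ : Mem)
                  (input : ∀ (i : Fin n) → m₀ (trunc (toℕ i)) ≡ trunc (toℕ (lookupᵛ S₀ i))) where
        open WaveletTree (2 ^ k) S₀ renaming (content to text)

        symbol₀ : ∀ i → val m₀ (toℕ i) ≡ toℕ (lookupᵛ S₀ i)
        symbol₀ i = trans (cong toℕ (input i)) (toℕ-trunc-< (below 1 (one< (<-trans (toℕ<n (lookupᵛ S₀ i)) σ<u))))

        input< : ∀ x → x < n → val m₀ x < σ
        input< x x<n = subst (λ x → val m₀ x < σ) (toℕ-fromℕ< x<n) (subst (_< σ) (sym (symbol₀ (fromℕ< x<n))) (toℕ<n _))

        syms : List ℕ
        syms = applyUpTo (val m₀) n

        syms<σ : ∀ s → s ∈ syms → s < σ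
        syms<σ s s∈ with ∈-applyUpTo⁻ (val m₀) s∈
        ... | x , x<n , refl = input< x x<n

        syms<u : ∀ s → s ∈ syms → s < u
        syms<u s s∈ = <-trans (syms<σ s s∈) σ<u

        root : ℕ
        root = M + M

        -- The first `M` cells are left to the input, which also keeps node addresses away from 0.
        base : ℕ → ℕ
        base zero    = M
        base (suc l) = base l + M * 16

        quot : ℕ → ℕ
        quot l = d ^ (h ∸ l)

        base-≡ : ∀ l → base l ≡ M + l * (M * 16)
        base-≡ zero    = sym (+-identityʳ M)
        base-≡ (suc l) = trans (cong (_+ M * 16) (base-≡ l)) (lem M (M * 16) (l * (M * 16)))
          where
          lem : ∀ a b c → a + c + b ≡ a + (b + c)
          lem = solve-∀

        base< : ∀ {l} → l ≤ L → base l < u ^ 12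
        base< {l} l≤L = subst (_< u ^ 12) (sym (base-≡ l))
          (bound-+ 9 11 M< (bound-* 1 10 (≤-<-trans l≤L L<) (bound-* 9 1 M< (lit< 16))))

        base-mono : ∀ {l l′} → l ≤ l′ → base l ≤ base l′
        base-mono = monotone base (λ l → m≤m+n (base l) _)

        quot-≡ : ∀ {l} → l < h → quot l ≡ quot (suc l) * d
        quot-≡ {l} l<h = trans (cong (d ^_) (+-∸-assoc 1 l<h)) (*-comm d _)

        0<quot : ∀ l → 0 < quot l
        0<quot l = m^n>0 d {{>-nonZero 0<d}} (h ∸ l)

        quot< : ∀ l → quot l < u ^ 2
        quot< l = ≤-<-trans (^-monoʳ-≤ d {{>-nonZero 0<d}} (m∸n≤m h l)) d^h<u²

        module At-level (a : ℕ → ℕ) (lo hi : ℕ → ℕ) (l : ℕ) (l<h : l < h) where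
          open Level a (base l) (quot l) (quot (suc l)) (base< (≤-trans (<⇒≤ l<h) h≤L)) (quot< l) (quot-≡ l<h) (0<quot (suc l)) σ root lo hi public

          record Facts (m : Mem) : Set where
            field
              content  : Content n syms a lo hi (quot l)
              node     : ∀ x → x < n → HasNode m (base l) (π x) (lo (π x)) (hi (π x))
              counted  : Counted m
              packs    : Packs m
              inverse  : ∀ x → x < n → val m (base l + M * 8 + pos n x) ≡ x
              children : ∀ x → x < n → val m (base l + M * 7 + π′ x) ≡ cell (base (suc l)) (π′ x) 0
              absent   : ∀ i → i < n → (∀ x → x < n → i ≢ π′ x) → val m (base l + M * 7 + i) ≡ 0

          a<u : Content n syms a lo hi (quot l) → ∀ x → x < n → a x < u
          a<u c x x<n = syms<u (a x) (Content.a∈ c x x<n)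

          tag< : ∀ t {_ : T (t <ᵇ 16)} {i φ} → base (suc l) ≤ φ → i < M → base l + M * t + i < φ
          tag< t {p} φ≥ i<M = <-≤-trans (step-frontier t _ i<M)
            (≤-trans (+-monoʳ-≤ (base l) (*-monoʳ-≤ M (<ᵇ⇒< t 16 p))) φ≥)

          facts-same : ∀ {φ m m′} → base (suc l) ≤ φ → Same φ m m′ → Facts m → Facts m′
          facts-same φ≥ s f = record
            { content  = content
            ; node     = λ x x<n → hasNode-same (≤-<-trans (÷-≤ (a x) (quot l)) (a<u content x x<n)) (≤-trans (frontier-≤ 2 16) φ≥) s (node x x<n)
            ; counted  = counted-same (≤-trans (frontier-≤ 6 16) φ≥) s counted
            ; packs    = λ x x<n → trans (Same.eq s _ (tag< 6 φ≥ (<M 1 (<-trans x<n n<)))) (packs x x<n)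
            ; inverse  = λ x x<n → trans (Same.eq s _ (tag< 8 φ≥ (<M 1 (<-trans (pos-< n x<n) n<)))) (inverse x x<n)
            ; children = λ x x<n → trans (Same.eq s _ (tag< 7 φ≥ (<M 1 (≤-<-trans (÷-≤ (a x) (quot (suc l))) (one< (a<u content x x<n)))))) (children x x<n)
            ; absent   = λ i i<n ≢ → trans (Same.eq s _ (tag< 7 φ≥ (<M 1 (<-trans i<n n<)))) (absent i i<n ≢) }
            where open Facts f

        module Queries (a lo hi : ℕ → ℕ) (l : ℕ) (l<h : l < h) where
          open At-level a lo hi l l<h

          B : ℕ
          B = base l

          B< : B < u ^ 12
          B< = base< (≤-trans (<⇒≤ l<h) h≤L)

          tag-bound : ∀ t {_ : T (t <ᵇ 256)} → B + M * t < u ^ 13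
          tag-bound t {p} = bound-+ 12 10 B< (bound-* 9 1 M< (lit< t {p}))

          module _ {m : Mem} (F : Facts m) {x : ℕ} (x<n : x < n) where
            open Facts F

            o w′ : ℕ
            o = lo (π x)
            w′ = hi (π x)

            o≤n : o ≤ n
            o≤n = ≤-trans (Content.lo≤ content x x<n) (<⇒≤ x<n)

            v : ℕ
            v = cell B (π x) 0

            cell-bound : ∀ f {_ : T (f <ᵇ 256)} → cell B (π x) f < u ^ 13
            cell-bound f {p} = bound-+ 12 10 B< (bound-+ 9 3 M< (bound-+ 2 1 (bound-* 1 1
              (≤-<-trans (÷-≤ (a x) (quot l)) (one< (a<u content x x<n))) (lit< 16)) (lit< f {p})))

            query-env : ℕ → ℕ → Env
            query-env c i = (0 , v , 13) ∷ (1 , c , 1) ∷ (2 , i , 1) ∷ []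

            level-env : ℕ → ℕ → Env
            level-env c i = (0 , n , 1) ∷ (1 , c , 1) ∷ (2 , d , 1) ∷ (20 , v , 13) ∷ (21 , c , 1) ∷ (22 , i , 1) ∷
              (23 , o , 1) ∷ (7 , d * L , 2) ∷ (8 , d + 1 , 2) ∷ (9 , 2 ^ d ∸ 1 , 1) ∷
              (13 , B + M * 2 , 13) ∷ (14 , B + M * 4 , 13) ∷ (15 , XT L , 14) ∷ []

            -- A query runs alone and writes nothing, so it may read the entire memory.
            φ : ℕ
            φ = 2 ^ w

            load-field : ∀ {δ} f {_ : T (f <ᵇ 12)} {_ : T (f <ᵇ 256)} β → lookupE 20 δ ≡ just (v , 13) →
                         field-of B (π x) o w′ f < u ^ β → Ev m φ δ (! ($ 20 +ᵉ ‵ f)) (field-of B (π x) o w′ f) β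
            load-field f {p} {q} β e bd = ev-! (ev-+ (ev-var tt′ e) (ev-num f {q})) (below 14 (bound-+ 13 1 (cell-bound 0) (lit< f {q})))
                (trans (cong (val m) (lem B M (π x * 16) f)) (node x x<n f (<ᵇ⇒< f 12 p))) bd
              where
              tt′ : T (20 <ᵇ T₀)
              tt′ = _
              lem : ∀ B M z f → B + (M + (z + 0)) + f ≡ B + (M + (z + f))
              lem = solve-∀

            loadLevel-ok : ∀ {Q c i K W H} → Main Q m (level-env c i) K W H →
              Main Q m (query-env c i) (loadLevel ∷ K) (seqCost loadLevel + W) (seqCost loadLevel + H)
            loadLevel-ok {c = c} {i} cont =
              m-seq (m-asg φ (auto ($ 0) refl) (m-seq (m-asg φ (auto ($ 1) refl) (m-seq (m-asg φ (auto ($ 2) refl)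
              (m-seq (m-asg φ (load-field 3 1 refl (≤-<-trans o≤n n<))
              (m-seq (m-asg φ (load-field 5 1 refl d<)
              (m-seq (m-asg φ (load-field 6 2 refl D<)
              (m-seq (m-asg φ (auto ($ 2 +ᵉ ‵ 1) refl)
              (m-seq (m-asg φ (ev-∸ (ev-≪ {γ = 1} (*-identityˡ _) 2^d< (auto (‵ 1) refl) (auto ($ 2) refl)) (auto (‵ 1) refl))
              (m-seq (m-asg φ (load-field 7 13 refl (tag-bound 2))
              (m-seq (m-asg φ (load-field 8 13 refl (tag-bound 4))
              (m-seq (m-asg φ (load-field 9 14 refl (XT< ≤-refl))
              (m-asg φ (load-field 11 1 refl n<) cont))))))))))))))))))))))
              where
              2^d< : 2 ^ d < u ^ 1
              2^d< = one< (≤-<-trans (^-monoʳ-≤ 2 (subst (_≤ d * d) (*-identityʳ d) (*-monoʳ-≤ d 0<d))) 2^dd<u)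

            φ≥ : B + M * 6 ≤ φ
            φ≥ = <⇒≤ (below 13 (tag-bound 6))

            rank-ok : ∀ {c i} → c < d → o + suc i ≤ n → ∀ m′ ρ → (∀ α → m′ α ≡ m α) →
              (∀ r {v β} → lookupE r (query-env c i) ≡ just (v , β) → toℕ (ρ r) ≡ v × v < u ^ β) →
              Terminates (λ ρ m′ → toℕ (ρ 0) ≡ G (suc c) (o + suc i) ∸ G (suc c) o × (∀ α → m′ α ≡ m α)) m′ (run ρ (rankQuery ∷ []))
                (seqCost rankQuery + 0) (seqCost rankQuery + 0)
            rank-ok {c} {i} c<d le m′ ρ eq sat = Main.terminates
              (m-seq (loadLevel-ok (m-asg φ (ev-∸
                  (ev-G φ≥ counted regs (ev-suc φ≥ counted (auto ($ 21) refl) c<d) (ev-bd {β′ = 1} (≤-<-trans le n<) (ev-≡ (trans (+-assoc o i 1) (cong (o +_) (+-comm i 1)))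
                    (auto (($ 23 +ᵉ $ 22) +ᵉ ‵ 1) refl))) c<d le)
                  (ev-G φ≥ counted regs (ev-suc φ≥ counted (auto ($ 21) refl) c<d) (auto ($ 23) refl) c<d o≤n))
                (m-stop λ m″ ρ′ eq′ sat′ → proj₁ (sat′ 0 (s≤s z≤n) refl) , eq′))))
              eq (λ r _ → sat r)
              where
              regs : LevelRegs m φ (level-env c i)
              regs = level-regs refl refl refl refl refl refl refl refl

            -- On the next level the occurrences of `c` in the node are consecutive from `N n c o`
            -- on, so the `i`'th one is at `N n c o + i - 1`; the inverse permutation leads back to
            -- its position on this level.
            select-ok : ∀ {c i j} → c < d → i ≤ n → o + j < n → dig (o + j) ≡ c → N n c o + i ≡ suc (pos n (o + j)) →
              ∀ m′ ρ → (∀ α → m′ α ≡ m α) →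
              (∀ r {v β} → lookupE r (query-env c i) ≡ just (v , β) → toℕ (ρ r) ≡ v × v < u ^ β) →
              Terminates (λ ρ m′ → toℕ (ρ 0) ≡ j × (∀ α → m′ α ≡ m α)) m′ (run ρ (selectQuery ∷ []))
                (seqCost selectQuery + 0) (seqCost selectQuery + 0)
            select-ok {c} {i} {j} c<d i≤n le refl at m′ ρ eq sat = Main.terminates
              (m-seq (loadLevel-ok (m-seq (m-asg φ (load-field 10 13 refl (tag-bound 8))
                (m-asg φ (ev-≡ (m+n∸m≡n o j) (ev-∸
                    (ev-! {β = 1} (ev-+ (auto ($ 24) refl) (ev-≡ (cong (_∸ 1) at)
                        (ev-∸ (ev-+ (ev-N φ≥ counted regs (auto ($ 21) refl) (auto ($ 23) refl) c<d o≤n) (auto ($ 22) refl)) (auto (‵ 1) refl))))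
                      (below 14 (bound-+ 13 1 (tag-bound 8) (<-trans (pos-< n le) n<)))
                      (inverse (o + j) le) (<-trans le n<))
                    (auto ($ 23) refl)))
                (m-stop λ m″ ρ′ eq′ sat′ → proj₁ (sat′ 0 (s≤s z≤n) refl) , eq′))))))
              eq (λ r _ → sat r)
              where
              regs : LevelRegs m φ (level-env c i ++ (24 , B + M * 8 , 13) ∷ [])
              regs = level-regs refl refl refl refl refl refl refl refl

        symbol : ℕ → Mem → ℕ → ℕ
        symbol l m x = val m (base l + x)

        record Ready (l : ℕ) (m : Mem) : Set where
          field
            lo hi   : ℕ → ℕ
            content : Content n syms (symbol l m) lo hi (quot l)
            node    : ∀ x → x < n → let π = symbol l m x ÷ quot l in HasNode m (base l) π (lo π) (hi π)

        record Built (l : ℕ) (l<h : l < h) (m : Mem) : Set where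
          field
            {a lo hi} : ℕ → ℕ
            facts     : At-level.Facts a lo hi l l<h m

        -- Symbols and node records of a level are written in the round before its own, everything
        -- else in its own round; hence two kinds of facts.
        Invariant : ℕ → Mem → Set
        Invariant l m = Ready l m × (∀ l′ → l′ < l → (l′<h : l′ < h) → Built l′ l′<h m)

        built-≡ : ∀ {l l′ m} → l′ ≡ l → {l<h : l < h} → Built l l<h m → (l′<h : l′ < h) → Built l′ l′<h m
        built-≡ {l} {m = m} refl b l<h = subst (λ p → Built l p m) (<-irrelevant _ l<h) b

        one-level : ∀ {Q₁ m K W H} l → l < h → Invariant l m →
          (∀ m′ → Invariant (suc l) m′ → Main Q₁ m′ (base-env σ root (quot (suc l)) (base (suc l))) K W H) →
          Main Q₁ m (base-env σ root (quot l) (base l)) (level ∷ K) (workL + W) (depthL + H)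
        one-level {Q₁} {m} l l<h (rd , bt) cont =
          LevelProof.level-ok (symbol l m) (base l) (quot l) (quot (suc l)) (base< (≤-trans (<⇒≤ l<h) h≤L)) (quot< l) (quot-≡ l<h)
            (0<quot (suc l)) σ root lo hi (base< (≤-trans l<h h≤L)) (λ _ _ → refl) nodes λ m′ lvl → cont m′ (invariant m′ lvl)
          where
          open Ready rd
          open At-level (symbol l m) lo hi l l<h
          nodes : Nodes m
          nodes = record
            { lo≤ = Content.lo≤ content ; <hi = Content.<hi content
            ; hi≤n = λ x x<n → Content.hi≤n content _ (Content.a∈ content x x<n)
            ; a<u = a<u content ; node = node
            ; member = λ x y x<n → Content.member content (symbol l m x) y (Content.a∈ content x x<n) }
          invariant : ∀ m′ → LevelDone m m′ → Invariant (suc l) m′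
          invariant m′ lvl = record { lo = lo′ ; hi = hi′ ; content = content′ ; node = node′ } , built
            where
            open LevelDone lvl renaming (nodes to new-nodes)
            content′ : Content n syms (symbol (suc l) m′) lo′ hi′ (quot (suc l))
            content′ = content-step n syms content 0<d (quot-≡ l<h) moved (λ _ → refl) (λ _ → refl)
            node′ : ∀ y → y < n → let π = symbol (suc l) m′ y ÷ quot (suc l) in HasNode m′ (base (suc l)) π (lo′ π) (hi′ π)
            node′ y y<n = let x , x<n , e = pos-surjective n dig<d y<n in
              subst (λ y → Described (symbol (suc l) m′ y)) e (subst Described (sym (moved x x<n)) (new-nodes x x<n))
              where
              Described : ℕ → Set
              Described s = HasNode m′ (base (suc l)) (s ÷ quot (suc l)) (lo′ (s ÷ quot (suc l))) (hi′ (s ÷ quot (suc l)))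
            facts : At-level.Facts (symbol l m) lo hi l l<h m′
            facts = record
              { content = content
              ; node = λ x x<n → hasNode-same (≤-<-trans (÷-≤ (symbol l m x) (quot l)) (a<u content x x<n)) ≤-refl same (node x x<n)
              ; counted = record { loc = Counted.loc counted ; mid = Counted.mid counted ; scan = Counted.scan counted }
              ; packs = packs ; inverse = inverse ; children = children ; absent = absent }
            earlier : ∀ l′ → l′ < l → (l′<h : l′ < h) → Built l′ l′<h m′
            earlier l′ l′<l l′<h = record { facts = At-level.facts-same _ _ _ l′ l′<h
              (≤-trans (base-mono l′<l) (m≤m+n (base l) (M * 2))) same (Built.facts (bt l′ l′<l l′<h)) }
            built : ∀ l′ → l′ < suc l → (l′<h : l′ < h) → Built l′ l′<h m′
            built l′ l′<1+l l′<h = [ (λ l′<l → earlier l′ l′<l l′<h) , (λ e → built-≡ e (record { facts = facts }) l′<h) ]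
              (m≤n⇒m<n∨m≡n (s≤s⁻¹ l′<1+l))

        loop-ok : ∀ {Q₁ m K W H} → Invariant 0 m →
          (∀ m′ → Invariant h m′ → Main Q₁ m′ (base-env σ root (quot h) (base h)) K W H) →
          Main Q₁ m (base-env σ root (quot 0) (base 0)) (while 37 level ∷ K) (h * suc workL + suc W) (h * suc depthL + suc H)
        loop-ok {m = m} inv₀ cont =
          m-while h (λ l → base-env σ root (quot l) (base l)) (λ l → 𝟙 (1 <ᵇ quot l)) Invariant workL depthL
            (λ l → refl) (λ l l<h → 0 , cong 𝟙 (<ᵇ-true (large l l<h))) (cong (λ z → 𝟙 (1 <ᵇ d ^ z)) (n∸n≡0 h))
            (λ l m₁ l<h inv next′ → one-level l l<h inv next′) cont m inv₀
          where
          large : ∀ l → l < h → 1 < quot l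
          large l l<h = subst (1 <_) (sym (quot-≡ l<h)) (≤-trans 2≤d (m≤n*m d (quot (suc l)) {{>-nonZero (0<quot (suc l))}}))

        n<M : n < M
        n<M = <M 1 n<

        initial-ok : ∀ {Q K W H} → (∀ m′ → Invariant 0 m′ → Main Q m′ (base-env σ (M + M) (d ^ h) M) K W H) →
          Main Q m₀ (base-env σ (M + M) (d ^ h) M) (pardo 20 0 initial ∷ K) (suc (n * costInit + W)) (suc (costInit + H))
        initial-ok {Q} {K} {W} {H} cont =
          subst (λ z → Main Q m₀ δ₀ (pardo 20 0 initial ∷ K) (suc (z + W)) (suc (costInit + H))) (sumUpTo-const costInit n)
            (m-par M ν refl as (λ _ → costInit) costInit (λ x x<n → _ , ≤-num , ≤-num , thread x x<n)
              λ m′ af → cont m′ (invariant m′ af))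
          where
          δ₀ = base-env σ (M + M) (d ^ h) M
          V : ℕ → ℕ → ℕ
          V 0 x = val m₀ x
          V 1 z = field-of M (z ÷ 16) 0 n (z ﹪ 16)
          V _ _ = 0
          ν = decode M M V
          as : ℕ → List ℕ
          as x = (M + x) ∷ cells M 0 ++ []
          ν-symbol : ∀ x → x < n → ν (M + x) ≡ val m₀ x
          ν-symbol x x<n = trans (cong (λ z → ν (z + x)) (sym (trans (cong (M +_) (*-zeroʳ M)) (+-identityʳ M))))
            (decode-≡ M M V 0 (<-trans x<n n<M))
          ν-node : ∀ f → f < 12 → ν (cell M 0 f) ≡ field-of M 0 0 n f
          ν-node f f<12 = trans (cong ν (lem M f)) (trans (decode-≡ M M V 1 (<M 1 (<-trans f<12 (lit< 12))))
              (cong₂ (λ y g → field-of M y 0 n g) (÷-unique 0 f<16) (﹪-unique 0 f<16)))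
            where
            f<16 = <-≤-trans f<12 (≤-num {12} {16})
            lem : ∀ M f → M + (M + f) ≡ M + M * 1 + f
            lem = solve-∀
          thread : ∀ x → x < n → ThrE m₀ M ν (put 20 x 1 δ₀) (initial ∷ []) (as x) costInit
          thread x x<n =
            t-seq (t-st (auto ($ 11 +ᵉ $ 20) refl)
              (ev-! {β = 1} (auto ($ 20) refl) (<-trans x<n n<M) refl (one< (<-trans (input< x x<n) σ<u)))
              (m≤m+n M x) (sym (ν-symbol x x<n))
            (t-seq (t-asg (auto (‵ 0) refl)
            (t-seq (t-asg (auto ($ 0) refl)
            (t-seq (t-asg (auto (‵ 0) refl)
            (t-seq (t-asg (ev-up 13 (auto ($ 11) refl))
            (writeNode-ok
              (record { r0 = auto ($ 0) refl ; r2 = auto ($ 2) refl ; r3 = auto ($ 3) refl ; r6 = auto ($ 6) refl ; r7 = auto ($ 7) refl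
                      ; r16 = auto ($ 16) refl ; r26 = auto ($ 26) refl ; r27 = auto ($ 27) refl ; r28 = auto ($ 28) refl ; r29 = auto ($ 29) refl })
              ≤-refl ν-node t-done))))))))))
          invariant : ∀ m′ → After m₀ M ν as n m′ → Invariant 0 m′
          invariant m′ af = record { lo = λ _ → 0 ; hi = λ _ → n ; content = content ; node = node } , λ _ ()
            where
            symbols-≡ : ∀ x → x < n → symbol 0 m′ x ≡ val m₀ x
            symbols-≡ x x<n = trans (After.new af x<n (here refl)) (ν-symbol x x<n)
            s÷Q : ∀ s → s ∈ syms → s ÷ quot 0 ≡ 0
            s÷Q s s∈ = ÷-small (<-≤-trans (syms<σ s s∈) (≤-^log σ))
            content : Content n syms (symbol 0 m′) (λ _ → 0) (λ _ → n) (quot 0)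
            content = record
              { a∈ = λ x x<n → subst (_∈ syms) (sym (symbols-≡ x x<n)) (∈-applyUpTo⁺ (val m₀) x<n)
              ; lo≤ = λ _ _ → z≤n ; <hi = λ _ x<n → x<n ; hi≤n = λ _ _ → ≤-refl
              ; slices = λ s s∈ → trans (applyUpTo-cong n symbols-≡) (sym (filter-all (λ x → x ÷ quot 0 ≟ s ÷ quot 0)
                  (applyUpTo⁺₁ (val m₀) n (λ {i} i<n → trans (s÷Q _ (∈-applyUpTo⁺ (val m₀) i<n)) (sym (s÷Q s s∈)))))) }
            node : ∀ x → x < n → let π = symbol 0 m′ x ÷ quot 0 in HasNode m′ M π 0 n
            node x x<n = subst (λ π → HasNode m′ M π 0 n)
              (sym (trans (cong (_÷ quot 0) (symbols-≡ x x<n)) (s÷Q (val m₀ x) (∈-applyUpTo⁺ (val m₀) x<n))))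
              -- Every initial thread writes the root record, and `1 ≤ n` provides one of them.
              λ f f<12 → trans (After.new af 1≤n (there (∈-++⁺ˡ (∈-applyUpTo⁺ (cell M 0) f<12)))) (ν-node f f<12)

        totalWork totalDepth : ℕ
        totalWork  = prepCost + suc (n * costInit + (h * suc workL + suc (endCost + 0)))
        totalDepth = prepCost + suc (costInit + (h * suc depthL + suc (endCost + 0)))

        opaque
          unfolding construct

          construct-ok : ∀ {Q} → (∀ m ρ → Invariant h m → toℕ (ρ 0) ≡ M + M → Q ρ m) →
            Main Q m₀ start-env (construct κ wf ∷ []) totalWork totalDepth
          construct-ok {Q} q =
            m-seq (prepare-ok (m-seq (initial-ok λ m₁ inv₁ → m-seq (loop-ok inv₁ λ m₂ inv₂ →
              m-asg 0 (auto ($ 30) refl) (m-stop λ m₃ ρ eq sat →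
                q m₃ ρ (transfer m₂ m₃ eq inv₂) (proj₁ (sat 0 (s≤s z≤n) refl)))))))
            where
            transfer : ∀ m m′ → (∀ α → m′ α ≡ m α) → Invariant h m → Invariant h m′
            transfer m m′ eq (rd , bt) = record
              { lo = lo ; hi = hi
              ; content = record
                  { a∈ = λ x x<n → subst (_∈ syms) (sym (v x)) (a∈ x x<n)
                  ; lo≤ = λ x x<n → subst (λ s → lo (s ÷ quot h) ≤ x) (sym (v x)) (lo≤ x x<n)
                  ; <hi = λ x x<n → subst (λ s → x < hi (s ÷ quot h)) (sym (v x)) (<hi x x<n)
                  ; hi≤n = hi≤n
                  ; slices = λ s s∈ → trans (applyUpTo-cong (hi (s ÷ quot h) ∸ lo (s ÷ quot h)) (λ t _ → v (lo (s ÷ quot h) + t))) (slices s s∈) }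
              ; node = λ x x<n f f< → trans (cong toℕ (eq _)) (subst (λ s → val m (cell (base h) (s ÷ quot h) f) ≡ field-of (base h) (s ÷ quot h) (lo (s ÷ quot h)) (hi (s ÷ quot h)) f)
                  (sym (v x)) (node x x<n f f<)) }
              , λ l l<h l<h′ → record { facts = At-level.facts-same _ _ _ l l<h′ ≤-refl (same-by λ α _ → cong toℕ (eq (trunc α))) (Built.facts (bt l l<h l<h′)) }
              where
              open Ready rd
              open Content content
              v : ∀ x → symbol h m′ x ≡ symbol h m x
              v x = cong toℕ (eq (trunc (base h + x)))

        symbols≡ : symbols ≡ applyUpTo (val m₀) n
        symbols≡ = toList-applyUpTo S₀ (val m₀) symbol₀

        sym∈ : ∀ {s} → s ∈ symbols → s ∈ syms
        sym∈ {s} = subst (s ∈_) symbols≡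

        sym∈′ : ∀ {s} → s ∈ syms → s ∈ symbols
        sym∈′ {s} = subst (s ∈_) (sym symbols≡)

        <d^h : ∀ {s} → s ∈ symbols → s < d ^ h
        <d^h s∈ = <-≤-trans (syms<σ _ (sym∈ s∈)) (≤-^log σ)

        digit≡ : ∀ s j → digit s j ≡ (s ÷ quot (suc j)) ﹪ d
        digit≡ s j = sym (trans (cong (_﹪ d) (÷≡/ s (d ^ (h ∸ suc j)) {{m^n≢0 d (h ∸ suc j)}})) (﹪≡% _ d))

        quot-parent : ∀ s {l} → l < h → s ÷ quot (suc l) ÷ d ≡ s ÷ quot l
        quot-parent s {l} l<h = trans (÷-÷ s (quot (suc l)) d) (cong (s ÷_) (sym (quot-≡ l<h)))

        split : ∀ s {l} → l < h → s ÷ quot (suc l) ≡ s ÷ quot l * d + digit s l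
        split s {l} l<h = trans (÷-﹪ (s ÷ quot (suc l)) 0<d) (cong₂ (λ x y → x * d + y) (quot-parent s l<h) (sym (digit≡ s l)))

        prefix-∷ʳ : ∀ s l → prefix (suc l) s ≡ prefix l s ∷ʳ digit s l
        prefix-∷ʳ s l = trans (cong (map (digit s)) (sym (upTo-∷ʳ l))) (map-++ (digit s) (upTo l) (l ∷ []))

        -- The last digit is split off on both sides, by Horner's rule and by division with
        -- remainder. The induction starts because all symbols are below `d ^ h`.
        pv-prefix : ∀ {s} l → s ∈ symbols → l ≤ h → pv (prefix l s) ≡ s ÷ quot l
        pv-prefix zero s∈ _ = sym (÷-small (<d^h s∈))
        pv-prefix {s} (suc l) s∈ l<h = trans (cong pv (prefix-∷ʳ s l)) (trans (foldl-∷ʳ _ 0 (digit s l) (prefix l s))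
          (trans (cong (λ z → z * d + digit s l) (pv-prefix l s∈ (<⇒≤ l<h))) (sym (split s l<h))))

        prefix-≡ : ∀ s s′ l → l ≤ h → s ÷ quot l ≡ s′ ÷ quot l → prefix l s ≡ prefix l s′
        prefix-≡ s s′ zero    _   _ = refl
        prefix-≡ s s′ (suc l) l<h e = trans (prefix-∷ʳ s l) (trans (cong₂ _∷ʳ_
          (prefix-≡ s s′ l (<⇒≤ l<h) (trans (sym (quot-parent s l<h)) (trans (cong (_÷ d) e) (quot-parent s′ l<h))))
          (trans (digit≡ s l) (trans (cong (_﹪ d) e) (sym (digit≡ s′ l))))) (sym (prefix-∷ʳ s′ l)))

        addr : List ℕ → Word
        addr p = trunc (cell (base (length p)) (pv p) 0)

        π< : ∀ s l → s ∈ symbols → s ÷ quot l < u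
        π< s l s∈ = ≤-<-trans (÷-≤ s (quot l)) (syms<u s (sym∈ s∈))

        cell< : ∀ {l π} f {_ : T (f <ᵇ 256)} → l ≤ h → π < u → cell (base l) π f < u ^ 13
        cell< f {p} l≤h π<u = bound-+ 12 10 (base< (≤-trans l≤h h≤L)) (bound-+ 9 3 M< (bound-+ 2 1 (bound-* 1 1
          (one< π<u) (lit< 16)) (lit< f {p})))

        cell-address : ∀ {p} → Node p → toℕ (addr p) ≡ cell (base (length p)) (pv p) 0
        cell-address {p} (l<h , p∈) with ∈-map⁻ (prefix (length p)) p∈
        ... | s , s∈ , e = toℕ-trunc-< (below 13 (cell< 0 (<⇒≤ l<h)
            (subst (_< u) (sym (trans (cong pv e) (pv-prefix (length p) s∈ (<⇒≤ l<h)))) (π< s (length p) s∈))))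

        -- A single node of the tree

        module AtNode (m : Mem) (inv : Invariant h m) (p : List ℕ) (l<h : length p < h)
                      (s : ℕ) (s∈ : s ∈ symbols) (p≡ : p ≡ prefix (length p) s) where
          l : ℕ
          l = length p

          built : Built l l<h m
          built = proj₂ inv l l<h l<h

          a lo hi : ℕ → ℕ
          a  = Built.a built
          lo = Built.lo built
          hi = Built.hi built

          open At-level a lo hi l l<h
          open Facts (Built.facts built)

          B : ℕ
          B = base l

          origin : ∃ λ x → x < n × a x ≡ s
          origin = Content.onto content s (sym∈ s∈)

          x : ℕ
          x = proj₁ origin

          x<n : x < n
          x<n = proj₁ (proj₂ origin)

          π≡ : π x ≡ pv p
          π≡ = trans (cong (_÷ quot l) (proj₂ (proj₂ origin))) (sym (trans (cong pv p≡) (pv-prefix l s∈ (<⇒≤ l<h))))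

          o len : ℕ
          o = lo (π x)
          len = hi (π x) ∸ o

          o≤ : o ≤ hi (π x)
          o≤ = ≤-trans (Content.lo≤ content x x<n) (<⇒≤ (Content.<hi content x x<n))

          o+len≤n : o + len ≤ n
          o+len≤n = subst (_≤ n) (sym (m+[n∸m]≡n o≤)) (Content.hi≤n content _ (Content.a∈ content x x<n))

          -- For symbols that occur, equal prefixes and equal quotients are the same, by `pv-prefix`
          -- and `prefix-≡`; this turns the filter of the specification into the one in `Content`.
          T≡ : text p ≡ slice dig o len
          T≡ = begin
            map (λ s → digit s l) (filter (λ s → ≡-dec _≟_ (prefix l s) p) symbols)
              ≡⟨ cong (map (λ s → digit s l)) (filter-cong (λ s → ≡-dec _≟_ (prefix l s) p) (λ s′ → s′ ÷ quot l ≟ a x ÷ quot l) symbols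
                   (λ {s′} s′∈ e → trans (sym (pv-prefix l s′∈ (<⇒≤ l<h))) (trans (cong pv e) (sym π≡)))
                   (λ {s′} s′∈ e → trans (prefix-≡ s′ s l (<⇒≤ l<h) (trans e (cong (_÷ quot l) (proj₂ (proj₂ origin))))) (sym p≡))) ⟩
            map (λ s → digit s l) (filter (λ s′ → s′ ÷ quot l ≟ a x ÷ quot l) symbols)
              ≡⟨ cong (λ z → map (λ s → digit s l) (filter (λ s′ → s′ ÷ quot l ≟ a x ÷ quot l) z)) symbols≡ ⟩
            map (λ s → digit s l) (filter (λ s′ → s′ ÷ quot l ≟ a x ÷ quot l) syms)
              ≡⟨ cong (map (λ s → digit s l)) (Content.slices content (a x) (Content.a∈ content x x<n)) ⟨
            map (λ s → digit s l) (slice a o len)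
              ≡⟨ map-applyUpTo (λ t → a (o + t)) (λ s → digit s l) len ⟩
            applyUpTo (λ t → digit (a (o + t)) l) len
              ≡⟨ applyUpTo-cong len (λ t _ → digit≡ (a (o + t)) l) ⟩
            slice dig o len ∎
            where open ≡-Reasoning

          length-T : length (text p) ≡ len
          length-T = trans (cong length T≡) (length-applyUpTo _ len)

          lookup-T : ∀ j → lookup (text p) j ≡ dig (o + toℕ j)
          lookup-T = lookup-slice _ T≡
            where
            lookup-slice : ∀ xs → xs ≡ slice dig o len → ∀ j → lookup xs j ≡ dig (o + toℕ j)
            lookup-slice _ refl j = lookup-applyUpTo (λ t → dig (o + t)) len j

          take-T : ∀ {i} → i ≤ len → take i (text p) ≡ slice dig o i
          take-T i≤ = trans (cong (take _) T≡) (take-applyUpTo (λ t → dig (o + t)) i≤)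

          v : Word
          v = addr p

          toℕ-v : toℕ v ≡ cell B (π x) 0
          toℕ-v = trans (cell-address (l<h , subst (_∈ map (prefix l) symbols) (sym p≡) (∈-map⁺ (prefix l) s∈))) (cong (λ π → cell B π 0) (sym π≡))

          field-≡ : ∀ f {_ : T (f <ᵇ 12)} → toℕ (m (v ⊞ f)) ≡ field-of B (π x) o (hi (π x)) f
          field-≡ f {q} = trans (cong (λ z → val m (z + f)) toℕ-v) (trans (cong (val m) (lem B M (π x * 16) f)) (node x x<n f (<ᵇ⇒< f 12 q)))
            where
            lem : ∀ B M z f → B + (M + (z + 0)) + f ≡ B + (M + (z + f))
            lem = solve-∀

          size-ok : toℕ (m v) ≡ length (text p)
          size-ok = trans (cong (λ z → toℕ (m z)) (trans (sym (trunc-toℕ v)) (cong trunc (sym (+-identityʳ (toℕ v))))))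
            (trans (field-≡ 0) (sym length-T))

          entries-ok : Packed m (m (v ⊞ 1)) k (text p)
          entries-ok j b q r b<k r<w e = begin
            bit r (toℕ (m (m (v ⊞ 1) ⊞ q)))       ≡⟨ cong (λ z → bit r (val m (z + q))) (field-≡ 1) ⟩
            bit r (val m (B + M * 6 + o + q))     ≡⟨ cong (λ z → bit r (val m z)) (+-assoc (B + M * 6) o q) ⟩
            bit r (val m (B + M * 6 + (o + q)))   ≡⟨ cong (bit r) (packs (o + q) (<-≤-trans (+-monoʳ-< o q<len) o+len≤n)) ⟩
            bit r (word (o + q))                  ≡⟨ cong (bit r) word≡ ⟩
            bit r (Words.word w k len (λ j → dig (o + j)) q)  ≡⟨ bit≡tb r _ ⟩
            tb r (Words.word w k len (λ j → dig (o + j)) q)   ≡⟨ Words.tb-word w k len (λ j → dig (o + j)) q 1≤k (λ j → dig<2^k (o + j)) j<len b<k r<w e ⟩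
            tb b (dig (o + toℕ j))                ≡⟨ bit≡tb b _ ⟨
            bit b (dig (o + toℕ j))               ≡⟨ cong (bit b) (lookup-T j) ⟨
            bit b (lookup (text p) j) ∎
            where
            open ≡-Reasoning
            j<len : toℕ j < len
            j<len = subst (toℕ j <_) length-T (toℕ<n j)
            -- A word holds at least one entry as `k ≤ w`, so a word that meets the sequence lies
            -- among the `len` words owned by the node.
            q<len : q < len
            q<len = *-cancelʳ-< w q len (≤-<-trans (≤-trans (m≤m+n (q * w) r) (≤-reflexive e))
              (<-≤-trans (subst (toℕ j * k + b <_) (+-comm (toℕ j * k) k) (+-monoʳ-< (toℕ j * k) b<k))
                (*-mono-≤ j<len k≤w)))
            word≡ : word (o + q) ≡ Words.word w k len (λ j → dig (o + j)) q
            word≡ = trans (cong (λ π → Words.word w k (hi π ∸ lo π) (λ j → dig (lo π + j)) (o + q ∸ lo π))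
                (Content.member content (a x) (o + q) (Content.a∈ content x x<n) (m≤m+n o q)
                  (subst (o + q <_) (m+[n∸m]≡n o≤) (+-monoʳ-< o q<len))))
              (cong (Words.word w k len (λ j → dig (o + j))) (m+n∸m≡n o q))

          slot : ∀ c → toℕ (m (v ⊞ 2)) + c ≡ B + M * 7 + (π x * d + c)
          slot c = trans (cong (_+ c) (field-≡ 2)) (+-assoc (B + M * 7) (π x * d) c)

          length-∷ʳ : ∀ c → length (p ∷ʳ c) ≡ suc l
          length-∷ʳ c = trans (length-++ p) (+-comm l 1)

          pv-∷ʳ : ∀ c → pv (p ∷ʳ c) ≡ π x * d + c
          pv-∷ʳ c = trans (foldl-∷ʳ _ 0 c p) (cong (λ z → z * d + c) (sym π≡))

          child-ok : suc l < h → ∀ c → c < 2 ^ k → Node (p ∷ʳ c) → m (m (v ⊞ 2) ⊞ c) ≡ addr (p ∷ʳ c)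
          child-ok sl<h c c<d nd@(_ , mem) with ∈-map⁻ (prefix (length (p ∷ʳ c))) mem
          ... | s′ , s′∈ , e with Content.onto content s′ (sym∈ s′∈)
          ...   | x′ , x′<n , refl = toℕ-injective (begin
              val m (toℕ (m (v ⊞ 2)) + c)              ≡⟨ cong (val m) (trans (slot c) (cong (B + M * 7 +_) (sym π′≡))) ⟩
              val m (B + M * 7 + π′ x′)                ≡⟨ children x′ x′<n ⟩
              cell (base (suc l)) (π′ x′) 0            ≡⟨ cong₂ (λ l π → cell (base l) π 0) (sym (length-∷ʳ c)) (trans π′≡ (sym (pv-∷ʳ c))) ⟩
              cell (base (length (p ∷ʳ c))) (pv (p ∷ʳ c)) 0  ≡⟨ cell-address nd ⟨
              toℕ (addr (p ∷ʳ c))                      ∎)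
              where
              open ≡-Reasoning
              π′≡ : π′ x′ ≡ π x * d + c
              π′≡ = trans (sym (pv-prefix (suc l) s′∈ l<h)) (trans (cong (λ l → pv (prefix l (a x′))) (sym (length-∷ʳ c))) (trans (cong pv (sym e)) (pv-∷ʳ c)))

          -- As a further level exists, the index is below `d ^ (l + 1) < σ ≤ n`, so the cell has
          -- been cleared. A thread that wrote to it later would own a symbol with the prefix
          -- `p ∷ʳ c`.
          no-child-ok : suc l < h → ∀ c → c < 2 ^ k → ¬ Node (p ∷ʳ c) → toℕ (m (m (v ⊞ 2) ⊞ c)) ≡ 0
          no-child-ok sl<h c c<d ¬nd = trans (cong (val m) (slot c)) (absent (π x * d + c) i<n none)
            where
            π<d^l : π x < d ^ l
            π<d^l = ÷-< (d ^ l) (<-≤-trans (<d^h (sym∈′ (Content.a∈ content x x<n))) (≤-reflexive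
              (trans (cong (d ^_) (sym (m+[n∸m]≡n (<⇒≤ l<h)))) (^-distribˡ-+-* d l (h ∸ l)))))
            i<n : π x * d + c < n
            i<n = <-≤-trans (<-trans (<-≤-trans (subst (π x * d + c <_) (+-comm (π x * d) d) (+-monoʳ-< (π x * d) c<d))
                (≤-trans (*-monoˡ-≤ d π<d^l) (≤-reflexive (*-comm (d ^ l) d)))) (<-log σ (suc l) sl<h)) σ≤n
            none : ∀ x′ → x′ < n → π x * d + c ≢ π′ x′
            none x′ x′<n e = ¬nd (subst (_< h) (sym (length-∷ʳ c)) sl<h ,
              subst (_∈ map (prefix (length (p ∷ʳ c))) symbols)
                (trans (cong (λ l → prefix l (a x′)) (length-∷ʳ c)) (trans (prefix-∷ʳ (a x′) l) (cong₂ _∷ʳ_ same-prefix same-digit)))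
                (∈-map⁺ (prefix (length (p ∷ʳ c))) (sym∈′ (Content.a∈ content x′ x′<n))))
              where
              same-prefix : prefix l (a x′) ≡ p
              same-prefix = trans (prefix-≡ (a x′) s l (<⇒≤ l<h) (trans (sym (quot-parent (a x′) l<h)) (trans (cong (_÷ d) (sym e))
                (trans (÷-unique (π x) c<d) (cong (_÷ quot l) (proj₂ (proj₂ origin))))))) (sym p≡)
              same-digit : digit (a x′) l ≡ c
              same-digit = trans (digit≡ (a x′) l) (trans (cong (_﹪ d) (sym e)) (﹪-unique (π x) c<d))

          args-ok : ∀ {c i} → c < d → i ≤ n → ∀ r {z β} → lookupE r (Queries.query-env a lo hi l l<h (Built.facts built) x<n c i) ≡ just (z , β) →
                    toℕ (args (toℕ v) c i r) ≡ z × z < u ^ β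
          args-ok {c} {i} c<d i≤n = ⊨-All (Queries.query-env a lo hi l l<h (Built.facts built) x<n c i)
            ((trans (cong toℕ (trunc-toℕ v)) toℕ-v , cell< 0 (<⇒≤ l<h) (subst (_< u) (sym (cong (_÷ quot l) (proj₂ (proj₂ origin)))) (π< s l s∈))) ∷
             (toℕ-trunc-< (below 1 c<) , c<) ∷ (toℕ-trunc-< (below 1 i<) , i<) ∷ [])
            where
            c< : c < u ^ 1
            c< = <-trans c<d d<
            i< : i < u ^ 1
            i< = ≤-<-trans i≤n n<

          ranks-ok : ∀ c i → c < 2 ^ k → i < length (text p) →
            Answers m rankQuery (toℕ v) c i rankCost (rank c (text p) i)
          ranks-ok c i c<d i<T = subst (Answers m rankQuery (toℕ v) c i rankCost) value
            (Queries.rank-ok a lo hi l l<h (Built.facts built) x<n c<d o+i≤n m (args (toℕ v) c i) (λ _ → refl) (args-ok c<d (≤-trans (≤-trans (n≤1+n i) (m≤n+m (suc i) o)) o+i≤n)))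
            where
            i<len = subst (i <_) length-T i<T
            o+i≤n : o + suc i ≤ n
            o+i≤n = ≤-trans (+-monoʳ-≤ o i<len) o+len≤n
            value : G (suc c) (o + suc i) ∸ G (suc c) o ≡ rank c (text p) i
            value = trans (cong (_∸ G (suc c) o) (sym (count≤-slice dig c o (suc i)))) (trans (m+n∸n≡m _ (G (suc c) o))
              (cong (count≤ c) (sym (take-T i<len))))

          selects-ok : ∀ c i j → c < 2 ^ k → IsSelect c (text p) i j →
            Answers m selectQuery (toℕ v) c i selectCost (toℕ j)
          selects-ok c i j c<d (found , number) =
            Queries.select-ok a lo hi l l<h (Built.facts built) x<n c<d i≤n o+j<n hit position m (args (toℕ v) c i) (λ _ → refl) (args-ok c<d i≤n)
            where
            j<len = subst (toℕ j <_) length-T (toℕ<n j)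
            o+j<n : o + toℕ j < n
            o+j<n = <-≤-trans (+-monoʳ-< o j<len) o+len≤n
            hit : dig (o + toℕ j) ≡ c
            hit = trans (sym (lookup-T j)) found
            counted≡ : i + cnt c o ≡ cnt c (o + suc (toℕ j))
            counted≡ = trans (cong (_+ cnt c o) (trans (sym number) (cong (count≡ c) (take-T j<len)))) (count≡-slice dig c o (suc (toℕ j)))
            i≤n : i ≤ n
            i≤n = ≤-trans (m≤m+n i (cnt c o)) (≤-trans (≤-reflexive counted≡) (≤-trans (subst (cnt c (o + suc (toℕ j)) ≤_) (sym (G-suc c (o + suc (toℕ j)))) (m≤n+m _ (G c (o + suc (toℕ j)))))
              (≤-trans (G-≤ (suc c) (o + suc (toℕ j))) (≤-trans (+-monoʳ-≤ o j<len) o+len≤n))))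
            position : N n c o + i ≡ suc (pos n (o + toℕ j))
            position = begin
              G c n + cnt c o + i              ≡⟨ trans (+-assoc (G c n) (cnt c o) i) (cong (G c n +_) (trans (+-comm (cnt c o) i) counted≡)) ⟩
              N n c (o + suc (toℕ j))          ≡⟨ cong (N n c) (+-suc o (toℕ j)) ⟩
              N n c (suc (o + toℕ j))          ≡⟨ N-hit n hit ⟩
              suc (N n c (o + toℕ j))          ≡⟨ cong (λ c → suc (N n c (o + toℕ j))) hit ⟨
              suc (pos n (o + toℕ j))          ∎
              where open ≡-Reasoning

        0<M : 0 < M
        0<M = ≤-<-trans z≤n n<M

        origin : ∀ {p} → Node p → ∃ λ s → s ∈ symbols × p ≡ prefix (length p) s
        origin {p} (_ , p∈) = ∈-map⁻ (prefix (length p)) p∈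

        pv≡ : ∀ {p} (nd : Node p) → pv p ≡ proj₁ (origin nd) ÷ quot (length p)
        pv≡ {p} nd = let s , s∈ , e = origin nd in
          trans (cong pv e) (pv-prefix (length p) s∈ (<⇒≤ (proj₁ nd)))

        pv*16< : ∀ {p} → Node p → pv p * 16 < M
        pv*16< {p} nd = <M 2 (bound-* 1 1 (one< (subst (_< u) (sym (pv≡ nd)) (π< (proj₁ (origin nd)) (length p) (proj₁ (proj₂ (origin nd)))))) (lit< 16))

        -- Read in base `M`, an address has a leading part that reveals the level and a remainder
        -- that reveals the prefix value; this makes addresses distinct.
        cell-tag : ∀ l π → cell (base l) π 0 ≡ (l * 16 + 2) * M + π * 16
        cell-tag l π = trans (cong (λ b → cell b π 0) (base-≡ l)) (lem M l (π * 16))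
          where
          lem : ∀ M l z → M + l * (M * 16) + (M + (z + 0)) ≡ (l * 16 + 2) * M + z
          lem = solve-∀

        distinct : ∀ p q → Node p → Node q → addr p ≡ addr q → p ≡ q
        distinct p q np nq e = trans (proj₂ (proj₂ (origin np))) (trans (cong (λ l → prefix l (proj₁ (origin np))) length≡)
          (trans (prefix-≡ _ _ (length q) (<⇒≤ (proj₁ nq))
            (trans (cong (λ l → proj₁ (origin np) ÷ quot l) (sym length≡)) (trans (sym (pv≡ np)) (trans pv-≡ (pv≡ nq)))))
            (sym (proj₂ (proj₂ (origin nq))))))
          where
          tags : (length p * 16 + 2) * M + pv p * 16 ≡ (length q * 16 + 2) * M + pv q * 16
          tags = trans (sym (cell-tag (length p) (pv p))) (trans (sym (cell-address np))
            (trans (cong toℕ e) (trans (cell-address nq) (cell-tag (length q) (pv q)))))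
          length≡ : length p ≡ length q
          length≡ = *-cancelʳ-≡ (length p) (length q) 16 (+-cancelʳ-≡ 2 _ _
            (trans (sym (÷-unique _ (pv*16< np))) (trans (cong (_÷ M) tags) (÷-unique _ (pv*16< nq)))))
          pv-≡ : pv p ≡ pv q
          pv-≡ = *-cancelʳ-≡ (pv p) (pv q) 16
            (trans (sym (﹪-unique (length p * 16 + 2) (pv*16< np))) (trans (cong (_﹪ M) tags) (﹪-unique (length q * 16 + 2) (pv*16< nq))))

        tree : ∀ (m : Mem) (ρ : Regs) → Invariant h m → toℕ (ρ 0) ≡ M + M → IsTree w k S₀ (ρ 0) m
        tree m ρ inv root≡ = record
          { addr     = addr
          ; isRoot   = λ nd → toℕ-injective (trans (cell-address nd)
                         (trans (cong (M +_) (+-identityʳ M)) (sym root≡)))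
          ; non-null = λ p nd → subst (0 <_) (sym (cell-address nd))
                         (≤-trans 0<M (≤-trans (base-mono {0} {length p} z≤n) (m≤m+n _ _)))
          ; distinct = distinct
          ; nodes    = λ p nd → let s , s∈ , e = origin nd in at-node p (proj₁ nd) s s∈ e }
          where
          at-node : ∀ p → length p < h → ∀ s → s ∈ symbols → p ≡ prefix (length p) s → IsNode w k S₀ m addr p
          at-node p l<h s s∈ e = record
            { size = size-ok ; entries = entries-ok ; child = child-ok ; no-child = no-child-ok
            ; ranks = ranks-ok ; selects = selects-ok }
            where open AtNode m inv p l<h s s∈ e

        start-ok : ∀ r {v β} → lookupE r start-env ≡ _ → toℕ (args n σ d r) ≡ v × v < u ^ β
        start-ok = ⊨-All start-env (zero′ ∷ zero′ ∷ zero′ ∷ zero′ ∷ zero′ ∷ value n<u ∷ value σ<u ∷ (value d<u) ∷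
            zero′ ∷ zero′ ∷ zero′ ∷ zero′ ∷ zero′ ∷ zero′ ∷ zero′ ∷ zero′ ∷ zero′ ∷ zero′ ∷ zero′ ∷ zero′ ∷ [])
          where
          value : ∀ {x} → x < u → toℕ (trunc x) ≡ x × x < u ^ 1
          value x<u = toℕ-trunc-< (below 1 (one< x<u)) , one< x<u
          zero′ : toℕ (trunc 0) ≡ 0 × 0 < u ^ 1
          zero′ = value (≤-trans (s≤s z≤n) 256≤u)

        builds-tree : Terminates (λ ρ → IsTree w k S₀ (ρ 0)) m₀ (start (construct κ wf) n σ d)
          (buildWork * (n * log[ d ] σ)) (buildDepth * (L * log[ d ] σ))
        builds-tree = weaken (build-work work-bound) (build-depth depth-bound)
          (Main.terminates (construct-ok tree) (λ _ → refl) (λ r _ → start-ok r))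

-- Choice of the parameters

module Magnitudes (K n k : ℕ) (1≤n : 1 ≤ n) (1≤k : 1 ≤ k)
                  (cube : 2 ^ k * 2 ^ k * 2 ^ k ≤ K * log₂ n) where

  -- In `κ = K + 8` the part `K` pays for `d³ ≤ K log n`. The 8 makes this strict, so that
  -- `2 ^ (d * d) < u`, and yields `256 ≤ u` and, with `20x<2^x`, a word length below `u`. The
  -- factor `E` gives a word the range `u ^ 20`.
  κ wf L w u d : ℕ
  κ  = K + 8
  wf = κ * E
  L  = log₂ n
  w  = wf * L
  u  = 2 ^ (κ * L)
  d  = 2 ^ k

  1≤L : 1 ≤ L
  1≤L = m≤m⊔n 1 ⌈log₂ n ⌉

  8≤κL : 8 ≤ κ * L
  8≤κL = *-mono-≤ (m≤n+m 8 K) 1≤L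

  256≤u : 256 ≤ u
  256≤u = ^-monoʳ-≤ 2 8≤κL

  2^w≡u^E : 2 ^ w ≡ u ^ E
  2^w≡u^E = trans (cong (2 ^_) (lem κ L)) (sym (^-*-assoc 2 (κ * L) E))
    where
    lem : ∀ κ L → κ * E * L ≡ κ * L * E
    lem = solve-∀

  2≤d : 2 ≤ d
  2≤d = ^-monoʳ-≤ 2 1≤k

  1≤d : 1 ≤ d
  1≤d = ≤-trans (s≤s z≤n) 2≤d

  ddd<κL : d * d * d < κ * L
  ddd<κL = ≤-<-trans cube (*-monoˡ-< L {{>-nonZero 1≤L}} (m<m+n K (s≤s z≤n)))

  d≤dd : d ≤ d * d
  d≤dd = subst (_≤ d * d) (*-identityʳ d) (*-monoʳ-≤ d 1≤d)

  dd≤ddd : d * d ≤ d * d * d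
  dd≤ddd = subst (_≤ d * d * d) (*-identityʳ (d * d)) (*-monoʳ-≤ (d * d) 1≤d)

  <u : ∀ {x} → x ≤ κ * L → x < u
  <u p = ≤-<-trans p (n<2^n (κ * L))

  exp<u : ∀ {x} → x < κ * L → 2 ^ x < u
  exp<u = ^-monoʳ-< 2 (s≤s (s≤s z≤n))

  L≤κL : L ≤ κ * L
  L≤κL = m≤n*m L κ {{>-nonZero (≤-trans (s≤s z≤n) (m≤n+m 8 K))}}

  d≤κL : d ≤ κ * L
  d≤κL = ≤-trans d≤dd (≤-trans dd≤ddd (<⇒≤ ddd<κL))

  L<κL : L < κ * L
  L<κL = subst (_< κ * L) (*-identityˡ L) (*-monoˡ-< L {{>-nonZero 1≤L}} {1} {κ} (≤-trans (s≤s (s≤s z≤n)) (m≤n+m 8 K)))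

  n≤2^L : n ≤ 2 ^ L
  n≤2^L = ≤-trans (≤-2^⌈log₂⌉ n) (^-monoʳ-≤ 2 (m≤n⊔m 1 ⌈log₂ n ⌉))

  n<u : n < u
  n<u = ≤-<-trans n≤2^L (exp<u L<κL)

  w<u : w < u
  w<u = subst (_< u) (lem κ L) (20x<2^x (κ * L) 8≤κL)
    where
    lem : ∀ κ L → 20 * (κ * L) ≡ κ * E * L
    lem = solve-∀

  κL≤w : κ * L ≤ w
  κL≤w = *-monoˡ-≤ L (m≤m*n κ E)

  k<d : k < d
  k<d = n<2^n k

  P : Params w u
  P = record
    { n = n ; k = k ; M = u ^ 8 ; S = u ^ 6 ; 1≤n = 1≤n ; n<u = n<u ; 2≤d = 2≤d
    ; d<u = <u d≤κL ; 1≤L = 1≤L ; L<u = <u L≤κL ; 1≤k = 1≤k ; w<u = w<u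
    ; k≤w = ≤-trans (<⇒≤ k<d) (≤-trans d≤κL κL≤w) ; n≤2^L = n≤2^L ; 2^L<u = exp<u L<κL
    ; 2^dd<u = exp<u (≤-<-trans dd≤ddd ddd<κL) ; M≡u^8 = refl ; S≡u^6 = refl }

-- Assembly of the theorem

module Result (K n k σ : ℕ) (1≤n : 1 ≤ n) (1≤k : 1 ≤ k)
              (cube : 2 ^ k * 2 ^ k * 2 ^ k ≤ K * log₂ n) (σ≤n : σ ≤ n) (S₀ : Vec (Fin σ) n) where
  open Magnitudes K n k 1≤n 1≤k cube
  open Machine w
  open Constants K using (buildWork; buildDepth)

  stored : ∀ {root m} → IsTree w k S₀ root m → StoredTree (algorithm K) (constant K) k S₀ root m
  stored {m = m} t = record
    { addr = addr ; isRoot = isRoot ; non-null = non-null ; distinct = distinct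
    ; nodes = λ p nd → stored-node (nodes p nd) }
    where
    open IsTree t
    stored-node : ∀ {p} → IsNode w k S₀ m addr p → StoredNode (algorithm K) (constant K) k S₀ m addr p
    stored-node nd = record
      { size = size ; entries = entries ; child = child ; no-child = no-child
      ; ranks = λ c i c< i< → Verification.weaken w u 256≤u 2^w≡u^E (rank≤ K) (rank≤ K) (ranks c i c< i<)
      ; selects = λ c i j c< is → Verification.weaken w u 256≤u 2^w≡u^E (select≤ K) (select≤ K) (selects c i j c< is) }
      where open IsNode nd

  module _ (m : Mem) (input : ∀ (i : Fin n) → m (trunc (toℕ i)) ≡ trunc (toℕ (lookupᵛ S₀ i))) where

    builds-tree : Terminates (λ ρ → IsTree w k S₀ (ρ 0)) m (start (construct κ wf) n σ d)
      (buildWork * (n * log[ d ] σ)) (buildDepth * (L * log[ d ] σ))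
    builds-tree = Verification.Program.Setup.Tree.builds-tree w u 256≤u 2^w≡u^E P K σ σ≤n refl refl cube S₀ m input

    builds-stored : Terminates (λ ρ → StoredTree (algorithm K) (constant K) k S₀ (ρ 0)) m (start (construct κ wf) n σ d)
      (constant K * (n * log[ d ] σ)) (constant K * (L * log[ d ] σ))
    builds-stored = Verification.relax w u 256≤u 2^w≡u^E
      {λ ρ → IsTree w k S₀ (ρ 0)} {λ ρ → StoredTree (algorithm K) (constant K) k S₀ (ρ 0)} stored
      (*-monoˡ-≤ (n * log[ d ] σ) {buildWork} {constant K} (buildWork≤ K))
      (*-monoˡ-≤ (L * log[ d ] σ) {buildDepth} {constant K} (buildDepth≤ K)) builds-tree

  constructs : Constructs (algorithm K) (constant K) k S₀
    (constant K * (n * log[ 2 ^ k ] σ)) (constant K * (log₂ n * log[ 2 ^ k ] σ))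
  constructs = builds-stored

open import Data.Integer using (+_)

mainTheorem7 : (ε : ℚ) → 0ℚ <ℚ ε → ε <ℚ + 1 / 3 → (K : ℕ) →
    Σ Algorithm λ A → Σ ℕ λ C →
    ∀ (n k σ : ℕ) → 1 ≤ n → 1 ≤ k → (2 ^ k) ≤[ K ]·log^[ ε ] n → σ ≤ n →
    (S : Vec (Fin σ) n) →
    Constructs A C k S (C * (n * log[ 2 ^ k ] σ)) (C * (log₂ n * log[ 2 ^ k ] σ))
mainTheorem7 ε 0<ε ε<⅓ K = algorithm K , constant K , λ n k σ 1≤n 1≤k d≤ σ≤n S →
  Result.constructs K n k σ 1≤n 1≤k (cube-≤ ε K (2 ^ k) n 0<ε ε<⅓ (m^n>0 2 k) d≤) σ≤n S
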